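{- Let $\mathsf a=(\mathsf a_\ell)_{\ell\ge0}$, $\mathsf b=(\mathsf b_{\ell,\ell'})_{\ell,\ell'\ge0}$, $\mathsf c=(\mathsf c_{\ell,\ell'})$, $\mathsf d=(\mathsf d_{\ell,\ell'})$, $\mathsf e=(\mathsf e_\ell)_{\ell\ge0}$, $\mathsf f=(\mathsf f_\ell)_{\ell\ge0}$ and $\lambda$ be indeterminates, and for $n\ge0$ define $$\widehat{\widehat Q}_n=\sum_{\sigma\in\mathfrak D_{2n}}\lambda^{\mathrm{cyc}(\sigma)}\prod_{i\in\mathrm{Cval}(\sigma)}\mathsf a_{\mathrm{ucross}(i,\sigma)+\mathrm{unest}(i,\sigma)}\prod_{i\in\mathrm{Cpeak}(\sigma)}\mathsf b_{\mathrm{lcross}(i,\sigma),\mathrm{lnest}(i,\sigma)}\prod_{i\in\mathrm{Cdfall}(\sigma)}\mathsf c_{\mathrm{lcross}(i,\sigma),\mathrm{lnest}(i,\sigma)}\prod_{i\in\mathrm{Cdrise}(\sigma)}\mathsf d_{\mathrm{ucross}'(i,\sigma),\mathrm{unest}'(i,\sigma)}\prod_{i\in\mathrm{Evenfix}(\sigma)}\mathsf e_{\mathrm{psnest}(i,\sigma)}\prod_{i\in\mathrm{Oddfix}(\sigma)}\mathsf f_{\mathrm{psnest}(i,\sigma)}.$$ Then $\sum_{n\ge0}\widehat{\widehat Q}_nt^n$ equals the T-type continued fraction with coefficients $\alpha_{2k-1}=(\lambda+k-1)\,\mathsf a_{k-1}\sum_{\xi=0}^{k-1}\mathsf b_{k-1-\xi,\xi}$,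 $\alpha_{2k}=\bigl(\lambda\mathsf e_k+\sum_{\xi=0}^{k-1}\mathsf c_{k-1-\xi,\xi}\bigr)\bigl(\lambda\mathsf f_k+\sum_{\xi=0}^{k-1}\mathsf d_{k-1-\xi,\xi}\bigr)$ for $k\ge1$, $\delta_1=\lambda^2\mathsf e_0\mathsf f_0$, $\delta_n=0$ for $n\ge2$.
   Context: $\mathfrak D_{2n}$: permutations $\sigma$ of $[2n]$ with $\sigma(2k-1)\ge2k-1$ and $\sigma(2k)\le2k$ for all $k\in[n]$; $\mathrm{cyc}(\sigma)$ = number of cycles (fixed points included). $\mathrm{Cval}(\sigma)=\{i:\sigma^{ -1}(i)>i<\sigma(i)\}$, $\mathrm{Cpeak}(\sigma)=\{i:\sigma^{ -1}(i)<i>\sigma(i)\}$, $\mathrm{Cdrise}(\sigma)=\{i:\sigma^{ -1}(i)<i<\sigma(i)\}$, $\mathrm{Cdfall}(\sigma)=\{i:\sigma^{ -1}(i)>i>\sigma(i)\}$; $\mathrm{Evenfix},\mathrm{Oddfix}$ = sets of even/odd fixed points. $\mathrm{ucross}(j,\sigma)=\#\{(i,k,l):i<j<k<l,k=\sigma(i),l=\sigma(j)\}$, $\mathrm{unest}(j,\sigma)=\#\{(i,k,l):i<j<k<l,k=\sigma(j),l=\sigma(i)\}$, $\mathrm{lcross}(k,\sigma)=\#\{(i,j,l):i<j<k<l,i=\sigma(k),j=\sigma(l)\}$, $\mathrm{lnest}(k,\sigma)=\#\{(i,j,l):i<j<k<l,i=\sigma(l),j=\sigma(k)\}$, $\mathrm{ucross}'(k,\sigma)=\#\{(i,j,l):i<j<k<l,k=\sigma(i),l=\sigma(j)\}$,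 $\mathrm{unest}'(k,\sigma)=\#\{(i,j,l):i<j<k<l,k=\sigma(j),l=\sigma(i)\}$; for a fixed point $j$, $\mathrm{psnest}(j,\sigma)=\#\{i<j:\sigma(i)>j\}$. T-type continued fraction with coefficients $(\alpha_n),(\delta_n)$: $1/(1-\delta_1t-\alpha_1t/(1-\delta_2t-\alpha_2t/(1-\delta_3t-\cdots)))$. -}

module Defs where

open import Level using (Level)
open import Data.Bool.Base using (Bool; true; false; _∧_; not; if_then_else_)
open import Data.Nat.Base using (ℕ; zero; suc; _∸_; _≡ᵇ_; _<ᵇ_; _≤ᵇ_)
open import Data.Nat.Base as ℕ using ()
open import Data.List.Base using (List; []; _∷_; map; foldr; concatMap; upTo; filterᵇ; length)
open import Data.Bool.ListAction using (any; all)
open import Algebra.Bundles using (CommutativeRing)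

-- Combinatorial part (everything on ℕ, positions are 1-based).

range : ℕ → List ℕ
range m = map suc (upTo m)

lists : List ℕ → ℕ → List (List ℕ)
lists A zero    = [] ∷ []
lists A (suc k) = concatMap (λ x → map (x ∷_) (lists A k)) A

-- A permutation σ of [m] is stored as the word σ(1) σ(2) … σ(m).
-- at σ i = σ(i) for 1 ≤ i ≤ length σ (and 0 otherwise).
at : List ℕ → ℕ → ℕ
at []       _             = 0
at (x ∷ xs) zero          = 0
at (x ∷ xs) (suc zero)    = x
at (x ∷ xs) (suc (suc i)) = at xs (suc i)

distinct : List ℕ → Bool
distinct []       = true
distinct (x ∷ xs) = not (any (x ≡ᵇ_) xs) ∧ distinct xs

isEven : ℕ → Bool
isEven zero          = true
isEven (suc zero)    = false
isEven (suc (suc n)) = isEven n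

inD : ℕ → List ℕ → Bool
inD n σ = all (λ k → ((2 ℕ.* k ∸ 1) ≤ᵇ at σ (2 ℕ.* k ∸ 1)) ∧ (at σ (2 ℕ.* k) ≤ᵇ 2 ℕ.* k)) (range n)

Perms : ℕ → List (List ℕ)
Perms m = filterᵇ distinct (lists (range m) m)

𝔇 : ℕ → List (List ℕ)
𝔇 n = filterᵇ (inD n) (Perms (2 ℕ.* n))

countB : {ℓ : Level} {A : Set ℓ} → List A → (A → Bool) → ℕ
countB xs p = length (filterᵇ p xs)

count3 : ℕ → (ℕ → ℕ → ℕ → Bool) → ℕ
count3 m P = foldr ℕ._+_ 0 (map (λ x → foldr ℕ._+_ 0 (map (λ y → countB (range m) (P x y)) (range m))) (range m))

inv : ℕ → List ℕ → ℕ → ℕ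
inv m σ i = foldr ℕ._+_ 0 (map (λ j → if at σ j ≡ᵇ i then j else 0) (range m))

iter : List ℕ → ℕ → ℕ → ℕ
iter σ zero    i = i
iter σ (suc k) i = at σ (iter σ k i)

-- cyc(σ): number of cycles of σ ∈ S_m, counted by their minimal elements
-- (i is the minimum of its cycle iff σ^k(i) ≥ i for all 1 ≤ k ≤ m).
cyc : ℕ → List ℕ → ℕ
cyc m σ = countB (range m) (λ i → all (λ k → i ≤ᵇ iter σ k i) (range m))

ucross : ℕ → List ℕ → ℕ → ℕ
ucross m σ j = count3 m (λ i k l → (i <ᵇ j) ∧ (j <ᵇ k) ∧ (k <ᵇ l) ∧ (k ≡ᵇ at σ i) ∧ (l ≡ᵇ at σ j))

unest : ℕ → List ℕ → ℕ → ℕ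
unest m σ j = count3 m (λ i k l → (i <ᵇ j) ∧ (j <ᵇ k) ∧ (k <ᵇ l) ∧ (k ≡ᵇ at σ j) ∧ (l ≡ᵇ at σ i))

lcross : ℕ → List ℕ → ℕ → ℕ
lcross m σ k = count3 m (λ i j l → (i <ᵇ j) ∧ (j <ᵇ k) ∧ (k <ᵇ l) ∧ (i ≡ᵇ at σ k) ∧ (j ≡ᵇ at σ l))

lnest : ℕ → List ℕ → ℕ → ℕ
lnest m σ k = count3 m (λ i j l → (i <ᵇ j) ∧ (j <ᵇ k) ∧ (k <ᵇ l) ∧ (i ≡ᵇ at σ l) ∧ (j ≡ᵇ at σ k))

ucross' : ℕ → List ℕ → ℕ → ℕ
ucross' m σ k = count3 m (λ i j l → (i <ᵇ j) ∧ (j <ᵇ k) ∧ (k <ᵇ l) ∧ (k ≡ᵇ at σ i) ∧ (l ≡ᵇ at σ j))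

unest' : ℕ → List ℕ → ℕ → ℕ
unest' m σ k = count3 m (λ i j l → (i <ᵇ j) ∧ (j <ᵇ k) ∧ (k <ᵇ l) ∧ (k ≡ᵇ at σ j) ∧ (l ≡ᵇ at σ i))

psnest : ℕ → List ℕ → ℕ → ℕ
psnest m σ j = countB (range m) (λ i → (i <ᵇ j) ∧ (j <ᵇ at σ i))

-- Algebraic part, over an arbitrary commutative ring R
-- (the values of the indeterminates λ, a, b, c, d, e, f).

module _ {c ℓ : Level} (R : CommutativeRing c ℓ) where
  open CommutativeRing R renaming (Carrier to A)

  pow : A → ℕ → A
  pow x zero    = 1#
  pow x (suc k) = x * pow x k

  nat : ℕ → A
  nat zero    = 0#
  nat (suc k) = 1# + nat k

  sumR : List A → A
  sumR = foldr _+_ 0#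

  prodR : List A → A
  prodR = foldr _*_ 1#

  sumUpTo : ℕ → (ℕ → A) → A
  sumUpTo k g = sumR (map g (upTo k))

  weightQ : A → (ℕ → A) → (ℕ → ℕ → A) → (ℕ → ℕ → A) → (ℕ → ℕ → A) →
            (ℕ → A) → (ℕ → A) → ℕ → List ℕ → A
  weightQ lam a b cc d e f m σ = pow lam (cyc m σ) * prodR (map factor (range m))
    where
    factor : ℕ → A
    factor i =
      if at σ i ≡ᵇ i then
        (if isEven i then e (psnest m σ i) else f (psnest m σ i))
      else if (i <ᵇ inv m σ i) ∧ (i <ᵇ at σ i) then
        a (ucross m σ i ℕ.+ unest m σ i)
      else if (inv m σ i <ᵇ i) ∧ (at σ i <ᵇ i) then
        b (lcross m σ i) (lnest m σ i)
      else if (i <ᵇ inv m σ i) ∧ (at σ i <ᵇ i) then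
        cc (lcross m σ i) (lnest m σ i)
      else
        d (ucross' m σ i) (unest' m σ i)

  Qhh : A → (ℕ → A) → (ℕ → ℕ → A) → (ℕ → ℕ → A) → (ℕ → ℕ → A) →
        (ℕ → A) → (ℕ → A) → ℕ → A
  Qhh lam a b cc d e f n = sumR (map (weightQ lam a b cc d e f (2 ℕ.* n)) (𝔇 n))

  Series : Set c
  Series = ℕ → A

  oneS : Series
  oneS zero    = 1#
  oneS (suc _) = 0#

  -- dot g (h_n ∷ … ∷ h_0) = Σ_k g_k h_{n-k}
  dot : Series → List A → A
  dot g []       = 0#
  dot g (x ∷ xs) = g 0 * x + dot (λ i → g (suc i)) xs

  -- coefficients h_n ∷ … ∷ h_0 of h = 1/(1 - t g), i.e. h = 1 + t g h
  geomHist : Series → ℕ → List A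
  geomHist g zero    = 1# ∷ []
  geomHist g (suc n) = dot g (geomHist g n) ∷ geomHist g n

  headOr0 : List A → A
  headOr0 []      = 0#
  headOr0 (x ∷ _) = x

  geom : Series → Series
  geom g n = headOr0 (geomHist g n)

  -- convergents of the T-fraction
  --   1/(1 - δ_m t - α_m t/(1 - δ_{m+1} t - α_{m+1} t/(1 - ⋯)))
  -- truncated after N levels (the remaining tail replaced by 1).
  Tconv : (α δ : ℕ → A) → ℕ → ℕ → Series
  Tconv α δ zero    m = oneS
  Tconv α δ (suc N) m = geom (λ n → δ m * oneS n + α m * Tconv α δ N (suc m) n)

  -- the coefficients of Theorem 4.10
  -- alt A B j = A k if j = 2k-1, B k if j = 2k (k ≥ 1), 0 for j = 0
  altIdx : (ℕ → A) → (ℕ → A) → ℕ → ℕ → A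
  altIdx P Q zero                k = 0#
  altIdx P Q (suc zero)          k = P k
  altIdx P Q (suc (suc zero))    k = Q k
  altIdx P Q (suc (suc (suc j))) k = altIdx P Q (suc j) (suc k)

  alpha410 : A → (ℕ → A) → (ℕ → ℕ → A) → (ℕ → ℕ → A) → (ℕ → ℕ → A) →
             (ℕ → A) → (ℕ → A) → ℕ → A
  alpha410 lam a b cc d e f j = altIdx oddα evenα j 1
    where
    oddα : ℕ → A
    oddα k = (lam + nat (k ∸ 1)) * a (k ∸ 1) * sumUpTo k (λ ξ → b (k ∸ 1 ∸ ξ) ξ)
    evenα : ℕ → A
    evenα k = (lam * e k + sumUpTo k (λ ξ → cc (k ∸ 1 ∸ ξ) ξ))
            * (lam * f k + sumUpTo k (λ ξ → d (k ∸ 1 ∸ ξ) ξ))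

  -- δ_1 = λ² e_0 f_0, δ_n = 0 for n ≥ 2 (δ_0 unused)
  delta410 : A → (ℕ → A) → (ℕ → A) → ℕ → A
  delta410 lam e f (suc zero) = pow lam 2 * e 0 * f 0
  delta410 lam e f _          = 0#

{-# OPTIONS --safe #-}
module Submission where

-- Reveal σ one position at a time: its trace on [j] keeps the arcs with both ends in [j], so it
-- is a union of cycles and h paths.  Position j + 1 opens a new path (valley), extends one of the
-- h paths at its end (double rise) or at its start (double fall), becomes a fixed point, or joins
-- the end of one path to the start of another (peak).  The weight of each choice depends only on
-- the rank of the chosen path among the h available ones, so summing over choices leaves a
-- function of h.  For a peak the start is weighted by its rank and the end is free; exactly one of
-- the h ends closes a cycle, whence the factor λ + h − 1.  Cycles are thus counted by their
-- maxima, which are as many as the minima used by cyc.  What remains is a sum over height walks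
-- whose odd steps are up or level and whose even steps are level or down: the even contraction
-- of the T-fraction, identified through its first-passage factorisation.

open import Defs
open import Level using (Level)
open import Algebra.Bundles using (CommutativeRing)
import Algebra.Properties.CommutativeSemigroup as CommutativeSemigroup
open import Algebra.Solver.Ring.NaturalCoefficients.Default as CommutativeSemiringSolver using ()
open import Data.Bool.Base using (Bool; true; false; _∧_; not; if_then_else_; T)
open import Data.Bool.ListAction using (any; all)
open import Data.Bool.Properties using (T-∧)
open import Data.Empty using (⊥-elim)
open import Data.Fin.Base using (Fin; toℕ; fromℕ<)
import Data.Fin.Properties as Fin
open import Data.List.Base using (List; []; _∷_; _++_; _∷ʳ_; map; foldr; concatMap; upTo; applyUpTo; filterᵇ; length; cartesianProductWith)
open import Data.List.Membership.Propositional using (_∈_)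
open import Data.List.Membership.Propositional.Properties using (∈-++⁺ˡ; ∈-++⁺ʳ; ∈-++⁻; ∈-cartesianProductWith⁺; ∈-cartesianProductWith⁻; ∈-filter⁺; ∈-filter⁻; ∈-map⁺; ∈-map⁻; ∈-upTo⁺; ∈-upTo⁻)
open import Data.List.Properties using (map-++; foldr-++; upTo-∷ʳ; length-applyUpTo; map-applyUpTo; map-upTo; map-∘; ≡-dec)
open import Data.List.Relation.Unary.All as All using (All; []; _∷_)
import Data.List.Relation.Unary.All.Properties as All
open import Data.List.Relation.Unary.AllPairs using (AllPairs; []; _∷_)
import Data.List.Relation.Unary.AllPairs.Properties as AllPairs
open import Data.List.Relation.Unary.Any as Any using (here; there)
import Data.List.Relation.Unary.Any.Properties as Any
open import Data.List.Relation.Unary.Unique.Propositional using (Unique)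
import Data.List.Relation.Unary.Unique.Propositional.Properties as Unique
open import Data.Nat.Base using (ℕ; zero; suc; pred; _+_; _*_; _∸_; _≤_; _<_; z≤n; s≤s; _≡ᵇ_; _<ᵇ_; _≤ᵇ_; >-nonZero)
open import Data.Nat.Properties using
  ( _≟_; _≤?_; <-cmp; ≡ᵇ⇒≡; ≡⇒≡ᵇ; <ᵇ⇒<; <⇒<ᵇ; ≤ᵇ⇒≤; ≤⇒≤ᵇ
  ; ≤-refl; ≤-reflexive; ≤-trans; ≤-antisym; ≤-total; ≤-pred; ≤⇒≯; ≤∧≢⇒<; ≰⇒>
  ; <-irrefl; <-trans; <-asym; <⇒≤; <⇒≱; <⇒≢; >⇒≢; n<1+n; n≤1+n; m≤n⇒m≤1+n; n≢0⇒n>0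
  ; 0≢1+n; 1+n≢0; suc-injective; suc-pred; +-suc; +-cancelˡ-≡; +-mono-≤; m<m+n; m+n≡0⇒m≡0; m+n≡0⇒n≡0
  ; *-cancelˡ-≤; *-cancelˡ-<; *-monoʳ-≤; ∸-+-assoc; m∸n≤m; m∸n+n≡m; m+[n∸m]≡n; m<n⇒0<n∸m )
import Data.Nat.Properties as ℕ
open import Data.Product.Base using (_×_; _,_; proj₁; proj₂; ∃-syntax)
open import Data.Sum.Base using (_⊎_; inj₁; inj₂; [_,_]′)
open import Data.Unit.Base using (tt)
open import Function.Base using (_∘_; id; const)
open import Function.Bundles using (module Equivalence)
open import Relation.Binary.Definitions using (tri<; tri≈; tri>)
open import Relation.Binary.PropositionalEquality using (_≡_; _≢_; refl; sym; trans; cong; cong₂; subst; module ≡-Reasoning)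
import Relation.Binary.Reasoning.Setoid as SetoidReasoning
open import Relation.Nullary using (¬_; Dec; yes; no; does)
open import Relation.Nullary.Decidable using (T?; dec-true; dec-false)
open CommutativeSemigroup ℕ.+-commutativeSemigroup using (interchange)

-- A weight can be charged to position j + 1 only if the trace on [j] and the choice made there
-- determine it. At a valley the images of the open ends and of j + 1 are all unknown, so `ucross`
-- and `unest` are not determined separately; their sum is, namely h, which is why `a` has a single
-- index. At rises, falls and peaks the two indices are the numbers above and below in a ranking,
-- and add up to h - 1. A cycle is charged at its maximum because that position closes it, whereas a
-- minimum cannot be recognised when it is revealed. No inverse of an encoding is built: `𝔇` is
-- partitioned by traces, each part is refined by the options for the next position, and only a
-- complete trace without open ends has to be recognised as a permutation. A pair of steps returns
-- to height h as up-down, with weight α_{2h+1}, or as level-level, with weight α_{2h}. At height 0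
-- there is no α_0, and the weight of two level steps, which can only be two fixed points, becomes
-- δ_1.

T-intro : ∀ {b} → b ≡ true → T b
T-intro refl = tt

T⇒≡true : ∀ {b} → T b → b ≡ true
T⇒≡true {true} _ = refl

¬T⇒≡false : ∀ {b} → ¬ T b → b ≡ false
¬T⇒≡false {true}  ¬t = ⊥-elim (¬t tt)
¬T⇒≡false {false} _  = refl

T-ext : ∀ {b c} → (T b → T c) → (T c → T b) → b ≡ c
T-ext {true}  {true}  _ _ = refl
T-ext {true}  {false} f _ = ⊥-elim (f tt)
T-ext {false} {true}  _ g = ⊥-elim (g tt)
T-ext {false} {false} _ _ = refl

T-∧⁺ : ∀ {b c} → T b → T c → T (b ∧ c)
T-∧⁺ x y = Equivalence.from T-∧ (x , y)

T-∧⁻ : ∀ b c → T (b ∧ c) → T b × T c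
T-∧⁻ b c = Equivalence.to (T-∧ {b} {c})

T-not⁻ : ∀ b → T (not b) → ¬ T b
T-not⁻ false _ ()

≡ᵇ-true : ∀ {m n} → m ≡ n → (m ≡ᵇ n) ≡ true
≡ᵇ-true {m} {n} p = T⇒≡true (≡⇒≡ᵇ m n p)

≡ᵇ-false : ∀ {m n} → m ≢ n → (m ≡ᵇ n) ≡ false
≡ᵇ-false {m} {n} p = ¬T⇒≡false (p ∘ ≡ᵇ⇒≡ m n)

<ᵇ-true : ∀ {m n} → m < n → (m <ᵇ n) ≡ true
<ᵇ-true p = T⇒≡true (<⇒<ᵇ p)

<ᵇ-false : ∀ {m n} → n ≤ m → (m <ᵇ n) ≡ false
<ᵇ-false {m} {n} p = ¬T⇒≡false (λ t → ≤⇒≯ p (<ᵇ⇒< m n t))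

≤ᵇ-true : ∀ {m n} → m ≤ n → (m ≤ᵇ n) ≡ true
≤ᵇ-true p = T⇒≡true (≤⇒≤ᵇ p)

≤ᵇ-false : ∀ {m n} → n < m → (m ≤ᵇ n) ≡ false
≤ᵇ-false {m} {n} p = ¬T⇒≡false (λ t → <⇒≱ p (≤ᵇ⇒≤ m n t))

-- Positions between 1 and m

Within : ℕ → ℕ → Set
Within m i = 1 ≤ i × i ≤ m

within-≤ : ∀ {j m i} → j ≤ m → Within j i → Within m i
within-≤ j≤m (l , u) = l , ≤-trans u j≤m

within-suc : ∀ {j i} → Within j i → Within (suc j) i
within-suc {j} = within-≤ (n≤1+n j)

within-last : ∀ j → Within (suc j) (suc j)
within-last j = s≤s z≤n , ≤-refl

within-suc⁻ : ∀ {j i} → Within (suc j) i → i ≢ suc j → Within j i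
within-suc⁻ (l , u) i≢ = l , ≤-pred (≤∧≢⇒< u i≢)

0-∉ : ∀ {m i} → Within m i → i ≢ 0
0-∉ (() , _) refl

∈-range⁺ : ∀ {m i} → Within m i → i ∈ range m
∈-range⁺ {i = suc i} (_ , u) = ∈-map⁺ suc (∈-upTo⁺ u)

∈-range⁻ : ∀ {m i} → i ∈ range m → Within m i
∈-range⁻ p with ∈-map⁻ suc p
... | _ , q , refl = s≤s z≤n , ∈-upTo⁻ q

range-unique : ∀ m → Unique (range m)
range-unique m = Unique.map⁺ suc-injective (Unique.upTo⁺ m)

range-suc : ∀ m → range (suc m) ≡ range m ∷ʳ suc m
range-suc m = trans (cong (map suc) (sym (upTo-∷ʳ m))) (map-++ suc (upTo m) (m ∷ []))

-- Finite sums over {1, …, m}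

𝟙 : Bool → ℕ
𝟙 true  = 1
𝟙 false = 0

∑ : ℕ → (ℕ → ℕ) → ℕ
∑ zero    f = 0
∑ (suc m) f = ∑ m f + f (suc m)

foldr-+-init : ∀ x (ys : List ℕ) → foldr _+_ x ys ≡ foldr _+_ 0 ys + x
foldr-+-init x []       = refl
foldr-+-init x (y ∷ ys) = trans (cong (y +_) (foldr-+-init x ys)) (sym (ℕ.+-assoc y _ x))

∑-range : ∀ m f → foldr _+_ 0 (map f (range m)) ≡ ∑ m f
∑-range zero    f = refl
∑-range (suc m) f = begin
  foldr _+_ 0 (map f (range (suc m)))              ≡⟨ cong (foldr _+_ 0 ∘ map f) (range-suc m) ⟩
  foldr _+_ 0 (map f (range m ∷ʳ suc m))           ≡⟨ cong (foldr _+_ 0) (map-++ f (range m) _) ⟩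
  foldr _+_ 0 (map f (range m) ∷ʳ f (suc m))       ≡⟨ foldr-++ _+_ 0 (map f (range m)) _ ⟩
  foldr _+_ (f (suc m) + 0) (map f (range m))      ≡⟨ foldr-+-init _ (map f (range m)) ⟩
  foldr _+_ 0 (map f (range m)) + (f (suc m) + 0)  ≡⟨ cong₂ _+_ (∑-range m f) (ℕ.+-identityʳ _) ⟩
  ∑ m f + f (suc m) ∎
  where open ≡-Reasoning

countB-∑ : ∀ {ℓ} {A : Set ℓ} (xs : List A) p → countB xs p ≡ foldr _+_ 0 (map (𝟙 ∘ p) xs)
countB-∑ []       p = refl
countB-∑ (x ∷ xs) p with p x
... | true  = cong suc (countB-∑ xs p)
... | false = countB-∑ xs p

countB-range : ∀ m p → countB (range m) p ≡ ∑ m (𝟙 ∘ p)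
countB-range m p = trans (countB-∑ (range m) p) (∑-range m (𝟙 ∘ p))

∑-cong : ∀ m {f g} → (∀ i → Within m i → f i ≡ g i) → ∑ m f ≡ ∑ m g
∑-cong zero    h = refl
∑-cong (suc m) h = cong₂ _+_ (∑-cong m (λ i → h i ∘ within-suc)) (h (suc m) (within-last m))

∑-zero : ∀ m {f} → (∀ i → Within m i → f i ≡ 0) → ∑ m f ≡ 0
∑-zero zero    h = refl
∑-zero (suc m) h = cong₂ _+_ (∑-zero m (λ i → h i ∘ within-suc)) (h (suc m) (within-last m))

∑-one : ∀ m → ∑ m (const 1) ≡ m
∑-one zero    = refl
∑-one (suc m) = trans (ℕ.+-comm (∑ m (const 1)) 1) (cong suc (∑-one m))

∑-mono : ∀ m {f g} → (∀ i → Within m i → f i ≤ g i) → ∑ m f ≤ ∑ m g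
∑-mono zero    h = z≤n
∑-mono (suc m) h = +-mono-≤ (∑-mono m (λ i → h i ∘ within-suc)) (h (suc m) (within-last m))

∑-+ : ∀ m f g → ∑ m (λ i → f i + g i) ≡ ∑ m f + ∑ m g
∑-+ zero    f g = refl
∑-+ (suc m) f g = trans (cong (_+ (f (suc m) + g (suc m))) (∑-+ m f g))
                        (interchange (∑ m f) (∑ m g) (f (suc m)) (g (suc m)))

∑-swap : ∀ m n (f : ℕ → ℕ → ℕ) → ∑ m (λ i → ∑ n (f i)) ≡ ∑ n (λ y → ∑ m (λ i → f i y))
∑-swap zero    n f = sym (∑-zero n (λ _ _ → refl))
∑-swap (suc m) n f = trans (cong (_+ ∑ n (f (suc m))) (∑-swap m n f))
                           (sym (∑-+ n (λ y → ∑ m (λ i → f i y)) (f (suc m))))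

∑-single : ∀ m {f} c → Within m c → (∀ i → Within m i → i ≢ c → f i ≡ 0) → ∑ m f ≡ f c
∑-single zero    c (l , z≤n) _ = ⊥-elim (<⇒≱ l z≤n)
∑-single (suc m) {f} c wc h with c ≟ suc m
... | yes refl = cong (_+ f (suc m)) (∑-zero m (λ i wi → h i (within-suc wi) (λ { refl → <-irrefl refl (proj₂ wi) })))
... | no  c≢   = trans (cong₂ _+_ (∑-single m c (within-suc⁻ wc c≢) (λ i → h i ∘ within-suc))
                                  (h (suc m) (within-last m) (c≢ ∘ sym)))
                       (ℕ.+-identityʳ (f c))

∑-select : ∀ m {b : ℕ → Bool} {g : ℕ → ℕ} c → Within m c → T (b c) → (∀ i → Within m i → T (b i) → i ≡ c) →
           ∑ m (λ i → if b i then g i else 0) ≡ g c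
∑-select m {b} {g} c wc bc h = trans (∑-single m c wc off) (cong (λ z → if z then g c else 0) (T⇒≡true bc))
  where
  off : ∀ i → Within m i → i ≢ c → (if b i then g i else 0) ≡ 0
  off i wi i≢c = cong (λ z → if z then g i else 0) (¬T⇒≡false (i≢c ∘ h i wi))

∑-𝟙-unique : ∀ m {b : ℕ → Bool} c → Within m c → T (b c) → (∀ i → Within m i → T (b i) → i ≡ c) →
             ∑ m (𝟙 ∘ b) ≡ 1
∑-𝟙-unique m {b} c wc bc h = trans (∑-single m c wc (λ i wi i≢c → cong 𝟙 (¬T⇒≡false (i≢c ∘ h i wi)))) (cong 𝟙 (T⇒≡true bc))

∑-𝟙-none : ∀ m {b : ℕ → Bool} → (∀ i → Within m i → ¬ T (b i)) → ∑ m (𝟙 ∘ b) ≡ 0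
∑-𝟙-none m h = ∑-zero m (λ i wi → cong 𝟙 (¬T⇒≡false (h i wi)))

∑-prefix : ∀ {j m} f → j ≤ m → (∀ i → j < i → i ≤ m → f i ≡ 0) → ∑ m f ≡ ∑ j f
∑-prefix {j} {zero}  f z≤n _ = refl
∑-prefix {j} {suc m} f j≤m h with j ≟ suc m
... | yes refl = refl
... | no  j≢   = trans (cong₂ _+_ (∑-prefix f j≤m′ (λ i l u → h i l (m≤n⇒m≤1+n u))) (h (suc m) (s≤s j≤m′) ≤-refl))
                       (ℕ.+-identityʳ _)
  where
  j≤m′ : j ≤ m
  j≤m′ = ≤-pred (≤∧≢⇒< j≤m j≢)

∑-drop : ∀ m {f g} c → Within m c → f c ≡ suc (g c) → (∀ i → Within m i → i ≢ c → f i ≡ g i) → ∑ m f ≡ suc (∑ m g)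
∑-drop m {f} {g} c wc e h = begin
  ∑ m f                                        ≡⟨ ∑-cong m split ⟩
  ∑ m (λ i → 𝟙 (i ≡ᵇ c) + g i)                 ≡⟨ ∑-+ m (λ i → 𝟙 (i ≡ᵇ c)) g ⟩
  ∑ m (λ i → 𝟙 (i ≡ᵇ c)) + ∑ m g               ≡⟨ cong (_+ ∑ m g) (∑-𝟙-unique m c wc (≡⇒≡ᵇ c c refl) (λ i _ → ≡ᵇ⇒≡ i c)) ⟩
  suc (∑ m g) ∎
  where
  open ≡-Reasoning
  split : ∀ i → Within m i → f i ≡ 𝟙 (i ≡ᵇ c) + g i
  split i wi with i ≟ c
  ... | yes refl = trans e (cong (λ z → 𝟙 z + g i) (sym (≡ᵇ-true {i} refl)))
  ... | no  i≢c  = trans (h i wi i≢c) (cong (λ z → 𝟙 z + g i) (sym (≡ᵇ-false i≢c)))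

∑-𝟙-≡0 : ∀ m b → ∑ m (𝟙 ∘ b) ≡ 0 → ∀ i → Within m i → ¬ T (b i)
∑-𝟙-≡0 zero    b _ i (l , u) _ = <⇒≱ l u
∑-𝟙-≡0 (suc m) b e i wi t with i ≟ suc m
... | yes refl = 1+n≢0 {0} (trans (sym (cong 𝟙 (T⇒≡true t))) (m+n≡0⇒n≡0 (∑ m (𝟙 ∘ b)) e))
... | no  i≢   = ∑-𝟙-≡0 m b (m+n≡0⇒m≡0 _ e) i (within-suc⁻ wi i≢) t

∑-𝟙-any : ∀ m b → ∑ m (𝟙 ∘ b) ≢ 0 → ∃[ i ] Within m i × T (b i)
∑-𝟙-any zero    b e = ⊥-elim (e refl)
∑-𝟙-any (suc m) b e with b (suc m) in eq
... | true  = suc m , within-last m , T-intro eq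
... | false with ∑-𝟙-any m b (e ∘ trans (ℕ.+-identityʳ _))
...   | i , wi , t = i , within-suc wi , t

-- Double counting of the incidences `f i ≡ y` with `p i`: each row marked by `p` contains exactly
-- one, and injectivity leaves at most one in each column, which `q` then marks.
∑-𝟙-injection : ∀ m (p q : ℕ → Bool) (f : ℕ → ℕ) → (∀ i → Within m i → T (p i) → Within m (f i) × T (q (f i))) →
                (∀ i i′ → Within m i → Within m i′ → T (p i) → T (p i′) → f i ≡ f i′ → i ≡ i′) →
                ∑ m (𝟙 ∘ p) ≤ ∑ m (𝟙 ∘ q)
∑-𝟙-injection m p q f maps inj = ≤-trans (≤-reflexive (trans (∑-cong m row) (∑-swap m m hit))) (∑-mono m col)
  where
  sel : ℕ → ℕ → Bool
  sel i y = p i ∧ (f i ≡ᵇ y)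
  hit : ℕ → ℕ → ℕ
  hit i y = 𝟙 (sel i y)
  row : ∀ i → Within m i → 𝟙 (p i) ≡ ∑ m (hit i)
  row i wi with p i in eq
  ... | false = sym (∑-zero m (λ _ _ → refl))
  ... | true  = sym (∑-𝟙-unique m (f i) (proj₁ (maps i wi (T-intro eq))) (≡⇒≡ᵇ (f i) (f i) refl) (λ y _ t → sym (≡ᵇ⇒≡ (f i) y t)))
  col-hit : ∀ i y → Within m i → T (p i) → f i ≡ y → ∑ m (λ i → hit i y) ≤ 𝟙 (q y)
  col-hit i .(f i) wi pi refl =
    ≤-reflexive (trans (∑-𝟙-unique m i wi (T-∧⁺ pi (≡⇒≡ᵇ (f i) (f i) refl)) only)
                       (cong 𝟙 (sym (T⇒≡true (proj₂ (maps i wi pi))))))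
    where
    only : ∀ i′ → Within m i′ → T (sel i′ (f i)) → i′ ≡ i
    only i′ wi′ t′ with T-∧⁻ (p i′) _ t′
    ... | pi′ , e = inj i′ i wi′ wi pi′ pi (≡ᵇ⇒≡ (f i′) (f i) e)
  col : ∀ y → Within m y → ∑ m (λ i → hit i y) ≤ 𝟙 (q y)
  col y wy with ∑ m (λ i → hit i y) ≟ 0
  ... | yes z = ≤-trans (≤-reflexive z) z≤n
  ... | no nz with ∑-𝟙-any m (λ i → sel i y) nz
  ...   | i , wi , t with T-∧⁻ (p i) _ t
  ...     | pi , e = col-hit i y wi pi (≡ᵇ⇒≡ (f i) y e)

-- A state s : [j] → {0, …, j}, with 0 standing for an image not yet known.
record PartialInjection (j : ℕ) (s : ℕ → ℕ) : Set where
  field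
    bounded   : ∀ {i} → Within j i → s i ≤ j
    injective : ∀ {i i′} → Within j i → Within j i′ → s i ≢ 0 → s i ≡ s i′ → i ≡ i′

free : ℕ → (ℕ → ℕ) → ℕ → Bool
free j s v = ∑ j (λ p → 𝟙 (s p ≡ᵇ v)) ≡ᵇ 0

free⁻ : ∀ {j s v} → T (free j s v) → ∀ p → Within j p → s p ≢ v
free⁻ {j} {s} {v} t p wp e = ∑-𝟙-≡0 j (λ p → s p ≡ᵇ v) (≡ᵇ⇒≡ _ 0 t) p wp (≡⇒≡ᵇ _ v e)

free⁺ : ∀ {j s v} → (∀ p → Within j p → s p ≢ v) → T (free j s v)
free⁺ {j} {s} {v} h = ≡⇒≡ᵇ _ 0 (∑-𝟙-none j (λ p wp t → h p wp (≡ᵇ⇒≡ _ v t)))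

¬free⁻ : ∀ {j s v} → ¬ T (free j s v) → ∃[ p ] Within j p × s p ≡ v
¬free⁻ {j} {s} {v} nf with ∑-𝟙-any j (λ p → s p ≡ᵇ v) (nf ∘ ≡⇒≡ᵇ _ 0)
... | p , wp , t = p , wp , ≡ᵇ⇒≡ _ v t

+-cancelˡ-complement : ∀ x {y z w} → x + y ≡ w → x + z ≡ w → y ≡ z
+-cancelˡ-complement x p q = +-cancelˡ-≡ x _ _ (trans p (sym q))

-- The pairs with `s p ≡ v` are counted twice. By rows they miss exactly the positions without an
-- image, by columns exactly the values without a preimage, and each completed total is `j`. For a
-- trace: there are as many path ends as path starts.
zeros≡frees : ∀ {j s} → PartialInjection j s → ∑ j (λ p → 𝟙 (s p ≡ᵇ 0)) ≡ ∑ j (λ v → 𝟙 (free j s v))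
zeros≡frees {j} {s} pinj = +-cancelˡ-complement (∑ j (λ p → ∑ j (λ v → 𝟙 (s p ≡ᵇ v)))) rows cols
  where
  open PartialInjection pinj
  row : ∀ p → Within j p → ∑ j (λ v → 𝟙 (s p ≡ᵇ v)) + 𝟙 (s p ≡ᵇ 0) ≡ 1
  row p wp with s p ≟ 0
  ... | yes z  = cong₂ _+_ (∑-𝟙-none j (λ v wv t → 0-∉ wv (trans (sym (≡ᵇ⇒≡ _ v t)) z))) (cong 𝟙 (≡ᵇ-true z))
  ... | no  nz = cong₂ _+_ (∑-𝟙-unique j (s p) (n≢0⇒n>0 nz , bounded wp) (≡⇒≡ᵇ (s p) _ refl) (λ v _ t → sym (≡ᵇ⇒≡ _ v t)))
                           (cong 𝟙 (≡ᵇ-false nz))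
  col : ∀ v → Within j v → ∑ j (λ p → 𝟙 (s p ≡ᵇ v)) + 𝟙 (free j s v) ≡ 1
  col v wv with T? (free j s v)
  ... | yes f = cong₂ _+_ (≡ᵇ⇒≡ _ 0 f) (cong 𝟙 (T⇒≡true f))
  ... | no nf with ¬free⁻ {j} {s} nf
  ...   | p , wp , e = cong₂ _+_
    (∑-𝟙-unique j p wp (≡⇒≡ᵇ _ v e) (λ q wq t → injective wq wp (λ z → 0-∉ wv (trans (sym (≡ᵇ⇒≡ _ v t)) z)) (trans (≡ᵇ⇒≡ _ v t) (sym e))))
    (cong 𝟙 (¬T⇒≡false nf))
  rows : ∑ j (λ p → ∑ j (λ v → 𝟙 (s p ≡ᵇ v))) + ∑ j (λ p → 𝟙 (s p ≡ᵇ 0)) ≡ j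
  rows = trans (sym (∑-+ j _ _)) (trans (∑-cong j row) (∑-one j))
  cols : ∑ j (λ p → ∑ j (λ v → 𝟙 (s p ≡ᵇ v))) + ∑ j (λ v → 𝟙 (free j s v)) ≡ j
  cols = trans (cong (_+ ∑ j (λ v → 𝟙 (free j s v))) (∑-swap j j _)) (trans (sym (∑-+ j _ _)) (trans (∑-cong j col) (∑-one j)))

-- Parity, words and membership in `𝔇`

isEven-double : ∀ k → isEven (k + k) ≡ true
isEven-double zero    = refl
isEven-double (suc k) rewrite +-suc k k = isEven-double k

isEven-suc : ∀ i → isEven (suc i) ≡ not (isEven i)
isEven-suc zero          = refl
isEven-suc (suc zero)    = refl
isEven-suc (suc (suc i)) = isEven-suc i

halve : ∀ i → (∃[ k ] i ≡ k + k) ⊎ (∃[ k ] i ≡ suc (k + k))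
halve zero    = inj₁ (0 , refl)
halve (suc i) with halve i
... | inj₁ (k , e) = inj₂ (k , cong suc e)
... | inj₂ (k , e) = inj₁ (suc k , trans (cong suc e) (cong suc (sym (+-suc k k))))

2*-double : ∀ k → 2 * k ≡ k + k
2*-double k = cong (k +_) (ℕ.+-identityʳ k)

2*suc∸1 : ∀ k → 2 * suc k ∸ 1 ≡ suc (k + k)
2*suc∸1 k = trans (+-suc k (k + 0)) (cong suc (2*-double k))

at-within : ∀ xs {i} → Within (length xs) i → at xs i ∈ xs
at-within []       (l , u) = ⊥-elim (<⇒≱ l u)
at-within (x ∷ xs) {suc zero}    _             = here refl
at-within (x ∷ xs) {suc (suc i)} (_ , s≤s u)   = there (at-within xs (s≤s z≤n , u))

at-hit : ∀ {xs x} → x ∈ xs → ∃[ i ] Within (length xs) i × at xs i ≡ x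
at-hit (here refl) = 1 , (s≤s z≤n , s≤s z≤n) , refl
at-hit (there p) with at-hit p
... | suc i , (_ , u) , e = suc (suc i) , (s≤s z≤n , s≤s u) , e
... | zero  , (() , _) , _

AtInjective : List ℕ → Set
AtInjective xs = ∀ {i i′} → Within (length xs) i → Within (length xs) i′ → at xs i ≡ at xs i′ → i ≡ i′

distinct⁻ : ∀ xs → T (distinct xs) → AtInjective xs
distinct⁻ []       _ (l , u) _ _ = ⊥-elim (<⇒≱ l u)
distinct⁻ (x ∷ xs) t = go
  where
  fresh : ∀ {i} → Within (length xs) i → x ≢ at xs i
  fresh w e = T-not⁻ _ (proj₁ (T-∧⁻ (not (any (x ≡ᵇ_) xs)) _ t))
    (Any.any⁺ {xs = xs} (x ≡ᵇ_) (Any.map (λ { refl → ≡⇒≡ᵇ x x refl }) (subst (_∈ xs) (sym e) (at-within xs w))))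
  go : AtInjective (x ∷ xs)
  go {suc zero}    {suc zero}     _ _ _ = refl
  go {suc zero}    {suc (suc i′)} _ (_ , s≤s u) e = ⊥-elim (fresh (s≤s z≤n , u) e)
  go {suc (suc i)} {suc zero}     (_ , s≤s u) _ e = ⊥-elim (fresh (s≤s z≤n , u) (sym e))
  go {suc (suc i)} {suc (suc i′)} (_ , s≤s u) (_ , s≤s u′) e =
    cong suc (distinct⁻ xs (proj₂ (T-∧⁻ (not (any (x ≡ᵇ_) xs)) _ t)) (s≤s z≤n , u) (s≤s z≤n , u′) e)

distinct⁺ : ∀ xs → AtInjective xs → T (distinct xs)
distinct⁺ []       _   = tt
distinct⁺ (x ∷ xs) inj = T-∧⁺ fresh (distinct⁺ xs tail-inj)
  where
  tail-inj : AtInjective xs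
  tail-inj {suc i} {suc i′} (_ , u) (_ , u′) e = suc-injective (inj (s≤s z≤n , s≤s u) (s≤s z≤n , s≤s u′) e)
  fresh : T (not (any (x ≡ᵇ_) xs))
  fresh with any (x ≡ᵇ_) xs in eq
  ... | false = tt
  ... | true with at-hit (Any.map (λ {y} t → ≡ᵇ⇒≡ x y t) (Any.any⁻ (x ≡ᵇ_) xs (T-intro eq)))
  ...   | suc i , (_ , u) , e = 0≢1+n (suc-injective (inj (s≤s z≤n , s≤s z≤n) (s≤s z≤n , s≤s u) (sym e)))
  ...   | zero , (() , _) , _

concatMap-map≡cartesianProductWith : ∀ {a b c} {A : Set a} {B : Set b} {C : Set c} (f : A → B → C) xs ys →
  concatMap (λ x → map (f x) ys) xs ≡ cartesianProductWith f xs ys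
concatMap-map≡cartesianProductWith f []       ys = refl
concatMap-map≡cartesianProductWith f (x ∷ xs) ys = cong (map (f x) ys ++_) (concatMap-map≡cartesianProductWith f xs ys)

lists-suc : ∀ A k → lists A (suc k) ≡ cartesianProductWith _∷_ A (lists A k)
lists-suc A k = concatMap-map≡cartesianProductWith _∷_ A (lists A k)

∈-lists⁻ : ∀ A k {xs} → xs ∈ lists A k → length xs ≡ k × All (_∈ A) xs
∈-lists⁻ A zero    (here refl) = refl , []
∈-lists⁻ A (suc k) p with ∈-cartesianProductWith⁻ _∷_ A (lists A k) (subst (_ ∈_) (lists-suc A k) p)
... | x , ys , x∈ , ys∈ , refl with ∈-lists⁻ A k ys∈
...   | len , all∈ = cong suc len , x∈ ∷ all∈

∈-lists⁺ : ∀ A k {xs} → length xs ≡ k → All (_∈ A) xs → xs ∈ lists A k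
∈-lists⁺ A zero    {[]}    _ _ = here refl
∈-lists⁺ A (suc k) {_ ∷ _} e (x∈ ∷ xs∈) =
  subst (_ ∈_) (sym (lists-suc A k)) (∈-cartesianProductWith⁺ _∷_ x∈ (∈-lists⁺ A k (suc-injective e) xs∈))

lists-unique : ∀ {A} k → Unique A → Unique (lists A k)
lists-unique     zero    _ = [] ∷ []
lists-unique {A} (suc k) u = subst Unique (sym (lists-suc A k))
  (Unique.cartesianProductWith⁺ _∷_ (λ { refl → refl , refl }) u (lists-unique k u))

filterᵇ-unique : ∀ {a} {A : Set a} (p : A → Bool) {xs} → Unique xs → Unique (filterᵇ p xs)
filterᵇ-unique p = Unique.filter⁺ (T? ∘ p)

𝔇-unique : ∀ n → Unique (𝔇 n)
𝔇-unique n = filterᵇ-unique (inD n) (filterᵇ-unique distinct (lists-unique (2 * n) (range-unique (2 * n))))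

-- The parity of a position replaces the index k of the pair 2k - 1, 2k, so that positions can be
-- treated one at a time.
record DPermutation (m : ℕ) (σ : List ℕ) : Set where
  field
    length≡   : length σ ≡ m
    into      : ∀ {i} → Within m i → Within m (at σ i)
    injective : ∀ {i i′} → Within m i → Within m i′ → at σ i ≡ at σ i′ → i ≡ i′
    odd≤      : ∀ {i} → Within m i → isEven i ≡ false → i ≤ at σ i
    even≥     : ∀ {i} → Within m i → isEven i ≡ true → at σ i ≤ i

double-within : ∀ {n k} → Within (2 * n) (k + k) → Within n k
double-within {n} {zero}  (() , _)
double-within {n} {suc k} (_ , u) = s≤s z≤n , *-cancelˡ-≤ 2 (≤-trans (≤-reflexive (2*-double (suc k))) u)

suc-double-within : ∀ {n k} → Within (2 * n) (suc (k + k)) → Within n (suc k)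
suc-double-within {n} {k} (_ , u) = s≤s z≤n , *-cancelˡ-< 2 k n (≤-trans (≤-reflexive (cong suc (2*-double k))) u)

inD⁻ : ∀ n {σ} → T (inD n σ) → ∀ {k} → Within n k → 2 * k ∸ 1 ≤ at σ (2 * k ∸ 1) × at σ (2 * k) ≤ 2 * k
inD⁻ n {σ} t {k} wk with T-∧⁻ (2 * k ∸ 1 ≤ᵇ at σ (2 * k ∸ 1)) _ (All.lookup (All.all⁺ _ (range n) t) (∈-range⁺ wk))
... | p , q = ≤ᵇ⇒≤ _ _ p , ≤ᵇ⇒≤ _ _ q

∈-filterᵇ⁺ : ∀ {a} {A : Set a} (p : A → Bool) {x xs} → x ∈ xs → T (p x) → x ∈ filterᵇ p xs
∈-filterᵇ⁺ p = ∈-filter⁺ (T? ∘ p)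

∈-filterᵇ⁻ : ∀ {a} {A : Set a} (p : A → Bool) {x xs} → x ∈ filterᵇ p xs → x ∈ xs × T (p x)
∈-filterᵇ⁻ p = ∈-filter⁻ (T? ∘ p)

𝔇⇒DPermutation : ∀ {n σ} → σ ∈ 𝔇 n → DPermutation (2 * n) σ
𝔇⇒DPermutation {n} {σ} σ∈ with ∈-filterᵇ⁻ (inD n) σ∈
... | σ∈P , d with ∈-filterᵇ⁻ distinct σ∈P
...   | σ∈L , dis with ∈-lists⁻ (range (2 * n)) (2 * n) σ∈L
...     | len , all∈ = record
  { length≡   = len
  ; into      = λ wi → ∈-range⁻ (All.lookup all∈ (at-within σ (to-len wi)))
  ; injective = λ wi wi′ → distinct⁻ σ dis (to-len wi) (to-len wi′)
  ; odd≤      = odd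
  ; even≥     = even
  }
  where
  to-len : ∀ {i} → Within (2 * n) i → Within (length σ) i
  to-len {i} = subst (λ l → Within l i) (sym len)
  odd : ∀ {i} → Within (2 * n) i → isEven i ≡ false → i ≤ at σ i
  odd {i} wi e with halve i
  ... | inj₁ (k , refl) with trans (sym e) (isEven-double k)
  ...   | ()
  odd {i} wi e | inj₂ (k , refl) = subst (λ j → j ≤ at σ j) (2*suc∸1 k) (proj₁ (inD⁻ n {σ} d (suc-double-within {n} {k} wi)))
  even : ∀ {i} → Within (2 * n) i → isEven i ≡ true → at σ i ≤ i
  even {i} wi e with halve i
  ... | inj₁ (k , refl) = subst (λ j → at σ j ≤ j) (2*-double k) (proj₂ (inD⁻ n {σ} d (double-within {n} {k} wi)))
  ... | inj₂ (k , refl) with trans (sym e) (trans (isEven-suc (k + k)) (cong not (isEven-double k)))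
  ...   | ()

DPermutation⇒𝔇 : ∀ {n σ} → DPermutation (2 * n) σ → σ ∈ 𝔇 n
DPermutation⇒𝔇 {n} {σ} D =
  ∈-filterᵇ⁺ (inD n) (∈-filterᵇ⁺ distinct (∈-lists⁺ (range (2 * n)) (2 * n) length≡ (All.tabulate entry))
    (distinct⁺ σ (λ wi wi′ → injective (from-len wi) (from-len wi′))))
    (All.all⁻ _ {xs = range n} (All.tabulate (cond ∘ ∈-range⁻)))
  where
  open DPermutation D
  from-len : ∀ {i} → Within (length σ) i → Within (2 * n) i
  from-len {i} = subst (λ l → Within l i) length≡
  entry : ∀ {x} → x ∈ σ → x ∈ range (2 * n)
  entry x∈ with at-hit x∈
  ... | i , wi , refl = ∈-range⁺ (into (from-len wi))
  cond : ∀ {k} → Within n k → T ((2 * k ∸ 1 ≤ᵇ at σ (2 * k ∸ 1)) ∧ (at σ (2 * k) ≤ᵇ 2 * k))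
  cond {suc k} (_ , u) = T-∧⁺ (≤⇒≤ᵇ (odd≤ (z≤n′ , ≤-trans (m∸n≤m _ 1) 2k≤) odd-index))
                              (≤⇒≤ᵇ (even≥ (s≤s z≤n , 2k≤) even-index))
    where
    2k≤ : 2 * suc k ≤ 2 * n
    2k≤ = *-monoʳ-≤ 2 u
    z≤n′ : 1 ≤ 2 * suc k ∸ 1
    z≤n′ = subst (1 ≤_) (sym (2*suc∸1 k)) (s≤s z≤n)
    odd-index : isEven (2 * suc k ∸ 1) ≡ false
    odd-index = trans (cong isEven (2*suc∸1 k)) (trans (isEven-suc (k + k)) (cong not (isEven-double k)))
    even-index : isEven (2 * suc k) ≡ true
    even-index = trans (cong isEven (2*-double (suc k))) (isEven-double (suc k))

-- No entry of the word is 0, so by `zeros≡frees` no value is free.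
surjective : ∀ {m σ} → DPermutation m σ → ∀ {i} → Within m i → ∃[ p ] Within m p × at σ p ≡ i
surjective {m} {σ} D {i} wi = ¬free⁻ {m} {at σ} (λ t → ∑-𝟙-≡0 m (free m (at σ)) no-frees i wi t)
  where
  open DPermutation D
  no-frees : ∑ m (𝟙 ∘ free m (at σ)) ≡ 0
  no-frees = trans (sym (zeros≡frees {m} {at σ} (record { bounded = proj₂ ∘ into ; injective = λ wi wi′ _ → injective wi wi′ })))
                   (∑-𝟙-none m (λ p wp t → 0-∉ (into wp) (≡ᵇ⇒≡ _ 0 t)))

module Inverse {m : ℕ} {σ : List ℕ} (D : DPermutation m σ) where
  open DPermutation D

  inv-at : ∀ {i} → Within m i → inv m σ (at σ i) ≡ i
  inv-at {i} wi = trans (∑-range m _)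
    (∑-select m {λ j → at σ j ≡ᵇ at σ i} {id} i wi (≡⇒≡ᵇ (at σ i) _ refl) (λ j wj t → injective wj wi (≡ᵇ⇒≡ _ _ t)))

  inv-within : ∀ {i} → Within m i → Within m (inv m σ i)
  inv-within wi with surjective D wi
  ... | p , wp , refl = subst (Within m) (sym (inv-at wp)) wp

  at-inv : ∀ {i} → Within m i → at σ (inv m σ i) ≡ i
  at-inv wi with surjective D wi
  ... | p , wp , refl = cong (at σ) (inv-at wp)

-- Cycle minima and cycle maxima

-- The m + 1 times 0, ..., m share m values; `pred` moves these values to 0, ..., m - 1, the range
-- of `Fin m`.
pigeonhole : ∀ m (g : ℕ → ℕ) → (∀ t → t ≤ m → Within m (g t)) → ∃[ a ] ∃[ b ] a < b × b ≤ m × g a ≡ g b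
pigeonhole m g h = collide (Fin.pigeonhole (n<1+n m) box)
  where
  bound : ∀ i → Within m (g (toℕ {suc m} i))
  bound i = h (toℕ i) (≤-pred (Fin.toℕ<n i))
  pred< : ∀ {x} → Within m x → pred x < m
  pred< {suc x} (_ , u) = u
  box : Fin (suc m) → Fin m
  box i = fromℕ< (pred< (bound i))
  pred-cancel : ∀ {x y} → Within m x → Within m y → pred x ≡ pred y → x ≡ y
  pred-cancel {suc x} {suc y} _ _ = cong suc
  collide : (∃[ i ] ∃[ i′ ] toℕ i < toℕ i′ × box i ≡ box i′) → ∃[ a ] ∃[ b ] a < b × b ≤ m × g a ≡ g b
  collide (i , i′ , i<i′ , e) = toℕ i , toℕ i′ , i<i′ , ≤-pred (Fin.toℕ<n i′) ,
    pred-cancel (bound i) (bound i′)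
      (trans (sym (Fin.toℕ-fromℕ< (pred< (bound i)))) (trans (cong toℕ e) (Fin.toℕ-fromℕ< (pred< (bound i′)))))

iter-+ : ∀ σ a b i → iter σ (a + b) i ≡ iter σ a (iter σ b i)
iter-+ σ zero    b i = refl
iter-+ σ (suc a) b i = cong (at σ) (iter-+ σ a b i)

-- With the order abstract, one inequality between numbers of extremes serves in both directions,
-- for `_≤ᵇ_` and for its flip.
record IsTotalOrderᵇ (R : ℕ → ℕ → Bool) : Set where
  field
    total   : ∀ x y → T (R x y) ⊎ T (R y x)
    R-trans : ∀ {x y z} → T (R x y) → T (R y z) → T (R x z)
    antisym : ∀ {x y} → T (R x y) → T (R y x) → x ≡ y

  R-refl : ∀ x → T (R x x)
  R-refl x with total x x
  ... | inj₁ p = p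
  ... | inj₂ p = p

≤ᵇ-isTotalOrderᵇ : IsTotalOrderᵇ _≤ᵇ_
≤ᵇ-isTotalOrderᵇ = record
  { total   = λ x y → tot x y (≤-total x y)
  ; R-trans = λ {x} {y} p q → ≤⇒≤ᵇ (≤-trans (≤ᵇ⇒≤ x y p) (≤ᵇ⇒≤ y _ q))
  ; antisym = λ {x} {y} p q → ≤-antisym (≤ᵇ⇒≤ x y p) (≤ᵇ⇒≤ y x q)
  }
  where
  tot : ∀ x y → x ≤ y ⊎ y ≤ x → T (x ≤ᵇ y) ⊎ T (y ≤ᵇ x)
  tot x y (inj₁ p) = inj₁ (≤⇒≤ᵇ p)
  tot x y (inj₂ p) = inj₂ (≤⇒≤ᵇ p)

flip-isTotalOrderᵇ : ∀ {R} → IsTotalOrderᵇ R → IsTotalOrderᵇ (λ x y → R y x)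
flip-isTotalOrderᵇ O = record
  { total   = λ x y → total y x
  ; R-trans = λ p q → R-trans q p
  ; antisym = λ p q → antisym q p
  }
  where open IsTotalOrderᵇ O

isExtreme : (ℕ → ℕ → Bool) → ℕ → List ℕ → ℕ → Bool
isExtreme R m σ i = all (λ t → R i (iter σ t i)) (range m)

isCycleMax : ℕ → List ℕ → ℕ → Bool
isCycleMax = isExtreme (λ x y → y ≤ᵇ x)

isExtreme⁺ : ∀ {R m σ i} → (∀ t → T (R i (iter σ t i))) → T (isExtreme R m σ i)
isExtreme⁺ {m = m} h = All.all⁻ _ {xs = range m} (All.universal h (range m))

extremum : ∀ {R} → IsTotalOrderᵇ R → (g : ℕ → ℕ) → ∀ m → ∃[ t ] (∀ t′ → t′ ≤ m → T (R (g t) (g t′)))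
extremum O g zero = 0 , λ { .0 z≤n → IsTotalOrderᵇ.R-refl O (g 0) }
extremum {R} O g (suc m) with extremum O g m
... | t , best with IsTotalOrderᵇ.total O (g t) (g (suc m))
...   | inj₁ p = t , step
  where
  step : ∀ t′ → t′ ≤ suc m → T (R (g t) (g t′))
  step t′ t′≤ with t′ ≟ suc m
  ... | yes refl = p
  ... | no  t′≢  = best t′ (≤-pred (≤∧≢⇒< t′≤ t′≢))
...   | inj₂ p = suc m , step
  where
  open IsTotalOrderᵇ O
  step : ∀ t′ → t′ ≤ suc m → T (R (g (suc m)) (g t′))
  step t′ t′≤ with t′ ≟ suc m
  ... | yes refl = R-refl _
  ... | no  t′≢  = R-trans p (best t′ (≤-pred (≤∧≢⇒< t′≤ t′≢)))

module Orbits {m : ℕ} {σ : List ℕ} (D : DPermutation m σ) where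
  open DPermutation D

  iter-within : ∀ t {i} → Within m i → Within m (iter σ t i)
  iter-within zero    wi = wi
  iter-within (suc t) wi = into (iter-within t wi)

  iter-injective : ∀ t {i i′} → Within m i → Within m i′ → iter σ t i ≡ iter σ t i′ → i ≡ i′
  iter-injective zero    _  _   e = e
  iter-injective (suc t) wi wi′ e = iter-injective t wi wi′ (injective (iter-within t wi) (iter-within t wi′) e)

  period : ∀ {i} → Within m i → ∃[ p ] Within m p × iter σ p i ≡ i
  period {i} wi with pigeonhole m (λ t → iter σ t i) (λ t _ → iter-within t wi)
  ... | a , b , a<b , b≤m , e = b ∸ a , (m<n⇒0<n∸m a<b , ≤-trans (m∸n≤m b a) b≤m) ,
    iter-injective a (iter-within (b ∸ a) wi) wi
      (trans (sym (iter-+ σ a (b ∸ a) i)) (trans (cong (λ t → iter σ t i) (m+[n∸m]≡n (<⇒≤ a<b))) (sym e)))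

  -- `isExtreme` inspects only the times 1, ..., m; modulo the period every time is one of these.
  iter-reduce : ∀ {i} → Within m i → ∀ t → ∃[ t′ ] Within m t′ × iter σ t i ≡ iter σ t′ i
  iter-reduce {i} wi t with period wi
  ... | p , (1≤p , p≤m) , e = reduced (go t)
    where
    reduced : (∃[ t′ ] Within p t′ × iter σ t i ≡ iter σ t′ i) → ∃[ t′ ] Within m t′ × iter σ t i ≡ iter σ t′ i
    reduced (t′ , wt′ , q) = t′ , within-≤ p≤m wt′ , q
    go : ∀ t → ∃[ t′ ] Within p t′ × iter σ t i ≡ iter σ t′ i
    -- Residues are kept in 1, ..., p, so time 0 is represented by the full period.
    go zero = p , (1≤p , ≤-refl) , sym e
    go (suc t) with go t
    ... | t′ , (l , u) , q with t′ ≟ p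
    ...   | yes refl = 1 , (≤-refl , 1≤p) , cong (at σ) (trans q e)
    ...   | no  t′≢p = suc t′ , (s≤s z≤n , ≤∧≢⇒< u t′≢p) , cong (at σ) q

  iter-return : ∀ {i} → Within m i → ∀ t → ∃[ u ] iter σ u (iter σ t i) ≡ i
  iter-return {i} wi t with period wi
  ... | p , (1≤p , _) , e = go t
    where
    go : ∀ t → ∃[ u ] iter σ u (iter σ t i) ≡ i
    go zero = 0 , refl
    go (suc t) with go t
    ... | suc u , q = u , trans (sym (iter-+ σ u 1 (iter σ t i))) (trans (cong (λ z → iter σ z (iter σ t i)) (ℕ.+-comm u 1)) q)
    -- Time t is already back at `i`; after one more step, p - 1 steps complete the period.
    ... | zero  , q = pred p , trans (cong (λ z → iter σ (pred p) (at σ z)) q)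
      (trans (sym (iter-+ σ (pred p) 1 i)) (trans (cong (λ z → iter σ z i) (trans (ℕ.+-comm (pred p) 1) (suc-pred p {{>-nonZero 1≤p}}))) e))

  isExtreme⁻ : ∀ {R i} → Within m i → T (isExtreme R m σ i) → ∀ t → T (R i (iter σ t i))
  isExtreme⁻ {R} {i} wi ext t with iter-reduce wi t
  ... | t′ , wt′ , e = subst (T ∘ R i) (sym e) (All.lookup (All.all⁺ _ (range m) ext) (∈-range⁺ wt′))

  -- The `R`-extreme of a cycle is sent to the `S`-extreme of the same cycle. Two `R`-extremes with
  -- the same target lie on one cycle, so each is related to the other and antisymmetry identifies
  -- them.
  extremes≤ : ∀ {R S} → IsTotalOrderᵇ R → IsTotalOrderᵇ S →
              ∑ m (𝟙 ∘ isExtreme R m σ) ≤ ∑ m (𝟙 ∘ isExtreme S m σ)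
  extremes≤ {R} {S} OR OS = ∑-𝟙-injection m (isExtreme R m σ) (isExtreme S m σ) top top-extreme top-injective
    where
    index : ℕ → ℕ
    index i = proj₁ (extremum OS (λ t → iter σ t i) m)
    top : ℕ → ℕ
    top i = iter σ (index i) i
    top-best : ∀ {i} → Within m i → ∀ t → T (S (top i) (iter σ t i))
    top-best {i} wi t with iter-reduce wi t
    ... | t′ , (_ , u) , e = subst (T ∘ S (top i)) (sym e) (proj₂ (extremum OS (λ t → iter σ t i) m) t′ u)
    top-extreme : ∀ i → Within m i → T (isExtreme R m σ i) → Within m (top i) × T (isExtreme S m σ (top i))
    top-extreme i wi _ = iter-within (index i) wi ,
      isExtreme⁺ {S} {m} {σ} {top i} (λ t → subst (T ∘ S (top i)) (iter-+ σ t (index i) i) (top-best wi (t + index i)))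
    same-orbit : ∀ {i i′} → Within m i → top i ≡ top i′ → ∃[ t ] iter σ t i′ ≡ i
    same-orbit {i} {i′} wi e with iter-return wi (index i)
    ... | u , q = u + index i′ , trans (iter-+ σ u (index i′) i′) (trans (cong (iter σ u) (sym e)) q)
    top-injective : ∀ i i′ → Within m i → Within m i′ → T (isExtreme R m σ i) → T (isExtreme R m σ i′) →
                    top i ≡ top i′ → i ≡ i′
    top-injective i i′ wi wi′ x x′ e with same-orbit wi e | same-orbit wi′ (sym e)
    ... | t , q | t′ , q′ = IsTotalOrderᵇ.antisym OR
      (subst (T ∘ R i) q′ (isExtreme⁻ {R} wi x t′)) (subst (T ∘ R i′) q (isExtreme⁻ {R} wi′ x′ t))

  cyc≡maxima : cyc m σ ≡ ∑ m (𝟙 ∘ isCycleMax m σ)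
  cyc≡maxima = trans (countB-range m (isExtreme _≤ᵇ_ m σ))
    (≤-antisym (extremes≤ ≤ᵇ-isTotalOrderᵇ (flip-isTotalOrderᵇ ≤ᵇ-isTotalOrderᵇ))
               (extremes≤ (flip-isTotalOrderᵇ ≤ᵇ-isTotalOrderᵇ) ≤ᵇ-isTotalOrderᵇ))

-- Power series and height walks

double : ℕ → ℕ
double zero    = zero
double (suc h) = suc (suc (double h))

module PowerSeries {c ℓ : Level} (R : CommutativeRing c ℓ) where
  open CommutativeRing R renaming (Carrier to A; _+_ to _⊕_; _*_ to _⊛_; refl to ≈-refl; sym to ≈-sym; trans to ≈-trans; zero to ⊛-zero)
  open SetoidReasoning setoid
  open CommutativeSemiringSolver commutativeSemiring using (solve; _:+_; _:*_; _:=_; con)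

  -- The Cauchy product, by recursion that consumes the left factor as `dot` does.
  conv : Series R → Series R → Series R
  conv g h zero    = g 0 ⊛ h 0
  conv g h (suc n) = g 0 ⊛ h (suc n) ⊕ conv (g ∘ suc) h n

  shift : Series R → Series R
  shift g zero    = 0#
  shift g (suc n) = g n

  conv-cong-≤ : ∀ n {f f′ g g′} → (∀ i → i ≤ n → f i ≈ f′ i) → (∀ i → i ≤ n → g i ≈ g′ i) → conv f g n ≈ conv f′ g′ n
  conv-cong-≤ zero    p q = *-cong (p 0 z≤n) (q 0 z≤n)
  conv-cong-≤ (suc n) p q = +-cong (*-cong (p 0 z≤n) (q (suc n) ≤-refl))
    (conv-cong-≤ n (λ i i≤n → p (suc i) (s≤s i≤n)) (λ i i≤n → q i (m≤n⇒m≤1+n i≤n)))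

  conv-congˡ : ∀ n {f f′ g} → (∀ i → f i ≈ f′ i) → conv f g n ≈ conv f′ g n
  conv-congˡ n p = conv-cong-≤ n (λ i _ → p i) (λ _ _ → ≈-refl)

  conv-scaleˡ : ∀ x f g n → conv (λ i → x ⊛ f i) g n ≈ x ⊛ conv f g n
  conv-scaleˡ x f g zero    = *-assoc x (f 0) (g 0)
  conv-scaleˡ x f g (suc n) = begin
    (x ⊛ f 0) ⊛ g (suc n) ⊕ conv (λ i → x ⊛ f (suc i)) g n  ≈⟨ +-cong (*-assoc x (f 0) _) (conv-scaleˡ x (f ∘ suc) g n) ⟩
    x ⊛ (f 0 ⊛ g (suc n)) ⊕ x ⊛ conv (f ∘ suc) g n          ≈⟨ ≈-sym (distribˡ x _ _) ⟩
    x ⊛ conv f g (suc n) ∎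

  conv-scaleʳ : ∀ x f g n → conv f (λ i → x ⊛ g i) n ≈ x ⊛ conv f g n
  conv-scaleʳ x f g zero    = solve 3 (λ f x g → f :* (x :* g) := x :* (f :* g)) ≈-refl (f 0) x (g 0)
  conv-scaleʳ x f g (suc n) = begin
    f 0 ⊛ (x ⊛ g (suc n)) ⊕ conv (f ∘ suc) (λ i → x ⊛ g i) n  ≈⟨ +-cong ≈-refl (conv-scaleʳ x (f ∘ suc) g n) ⟩
    f 0 ⊛ (x ⊛ g (suc n)) ⊕ x ⊛ conv (f ∘ suc) g n
      ≈⟨ solve 4 (λ f x g y → f :* (x :* g) :+ x :* y := x :* (f :* g :+ y)) ≈-refl (f 0) x (g (suc n)) _ ⟩
    x ⊛ conv f g (suc n) ∎

  conv-+ˡ : ∀ f f′ g n → conv (λ i → f i ⊕ f′ i) g n ≈ conv f g n ⊕ conv f′ g n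
  conv-+ˡ f f′ g zero    = distribʳ (g 0) (f 0) (f′ 0)
  conv-+ˡ f f′ g (suc n) = begin
    (f 0 ⊕ f′ 0) ⊛ g (suc n) ⊕ conv (λ i → f (suc i) ⊕ f′ (suc i)) g n  ≈⟨ +-cong ≈-refl (conv-+ˡ (f ∘ suc) (f′ ∘ suc) g n) ⟩
    (f 0 ⊕ f′ 0) ⊛ g (suc n) ⊕ (conv (f ∘ suc) g n ⊕ conv (f′ ∘ suc) g n)
      ≈⟨ solve 5 (λ f f′ g x y → (f :+ f′) :* g :+ (x :+ y) := (f :* g :+ x) :+ (f′ :* g :+ y)) ≈-refl (f 0) (f′ 0) (g (suc n)) _ _ ⟩
    conv f g (suc n) ⊕ conv f′ g (suc n) ∎

  conv-zeroˡ : ∀ f g n → (∀ i → f i ≈ 0#) → conv f g n ≈ 0#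
  conv-zeroˡ f g zero    z = ≈-trans (*-congʳ (z 0)) (zeroˡ _)
  conv-zeroˡ f g (suc n) z = ≈-trans (+-cong (≈-trans (*-congʳ (z 0)) (zeroˡ _)) (conv-zeroˡ (f ∘ suc) g n (z ∘ suc))) (+-identityˡ 0#)

  conv-oneˡ : ∀ g n → conv (oneS R) g n ≈ g n
  conv-oneˡ g zero    = *-identityˡ _
  conv-oneˡ g (suc n) = ≈-trans (+-cong (*-identityˡ _) (conv-zeroˡ (oneS R ∘ suc) g n (λ _ → ≈-refl))) (+-identityʳ _)

  conv-assoc : ∀ f g h n → conv (conv f g) h n ≈ conv f (conv g h) n
  conv-assoc f g h zero    = *-assoc _ _ _
  conv-assoc f g h (suc n) = begin
    (f 0 ⊛ g 0) ⊛ h (suc n) ⊕ conv (λ i → f 0 ⊛ g (suc i) ⊕ conv (f ∘ suc) g i) h n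
      ≈⟨ +-cong (*-assoc _ _ _) (conv-+ˡ (λ i → f 0 ⊛ g (suc i)) (conv (f ∘ suc) g) h n) ⟩
    f 0 ⊛ (g 0 ⊛ h (suc n)) ⊕ (conv (λ i → f 0 ⊛ g (suc i)) h n ⊕ conv (conv (f ∘ suc) g) h n)
      ≈⟨ +-cong ≈-refl (+-cong (conv-scaleˡ (f 0) (g ∘ suc) h n) (conv-assoc (f ∘ suc) g h n)) ⟩
    f 0 ⊛ (g 0 ⊛ h (suc n)) ⊕ (f 0 ⊛ conv (g ∘ suc) h n ⊕ conv (f ∘ suc) (conv g h) n)
      ≈⟨ solve 4 (λ f x y z → f :* x :+ (f :* y :+ z) := f :* (x :+ y) :+ z) ≈-refl (f 0) _ _ _ ⟩
    conv f (conv g h) (suc n) ∎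

  conv-shift : ∀ f g n → conv f (shift g) n ≈ shift (conv f g) n
  conv-shift f g zero          = zeroʳ _
  conv-shift f g (suc zero)    = ≈-trans (+-cong ≈-refl (zeroʳ _)) (+-identityʳ _)
  conv-shift f g (suc (suc n)) = +-cong ≈-refl (conv-shift (f ∘ suc) g (suc n))

  dot-geomHist : ∀ g G n → dot R g (geomHist R G n) ≈ conv g (geom R G) n
  dot-geomHist g G zero    = +-identityʳ _
  dot-geomHist g G (suc n) = +-cong ≈-refl (dot-geomHist (g ∘ suc) G n)

  geom-suc : ∀ G n → geom R G (suc n) ≈ conv G (geom R G) n
  geom-suc G = dot-geomHist G G

  -- In h = 1 + t G h the factor t makes coefficient n depend only on the coefficients of `G` below
  -- n. This gain of one degree per level is what makes truncations stable.
  geom-cong : ∀ {G G′} n → (∀ i → i < n → G i ≈ G′ i) → ∀ j → j ≤ n → geom R G j ≈ geom R G′ j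
  geom-cong         n       p zero    _         = ≈-refl
  geom-cong {G} {G′} (suc n) p (suc j) (s≤s j≤n) = begin
    geom R G (suc j)       ≈⟨ geom-suc G j ⟩
    conv G (geom R G) j    ≈⟨ conv-cong-≤ j (λ i i≤j → p i (s≤s (≤-trans i≤j j≤n)))
                               (λ i i≤j → geom-cong n (λ i i<n → p i (m≤n⇒m≤1+n i<n)) i (≤-trans i≤j j≤n)) ⟩
    conv G′ (geom R G′) j  ≈⟨ ≈-sym (geom-suc G′ j) ⟩
    geom R G′ (suc j)      ∎

  Tconv-stable : ∀ α δ N N′ m n → n < N → n < N′ → Tconv R α δ N m n ≈ Tconv R α δ N′ m n
  Tconv-stable α δ (suc N) (suc N′) m n (s≤s n≤N) (s≤s n≤N′) =
    geom-cong n (λ i i<n → +-cong ≈-refl (*-congˡ (Tconv-stable α δ N N′ (suc m) i (≤-trans i<n n≤N) (≤-trans i<n n≤N′)))) n ≤-refl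

  -- The infinite fraction: coefficient n is taken at depth n + 1, which by `Tconv-stable` is as
  -- good as any greater depth.
  Tfraction : (α δ : ℕ → A) → ℕ → Series R
  Tfraction α δ m n = Tconv R α δ (suc n) m n

  Tfraction-suc : ∀ α δ m n →
    Tfraction α δ m (suc n) ≈ conv (λ i → δ m ⊛ oneS R i ⊕ α m ⊛ Tfraction α δ (suc m) i) (Tfraction α δ m) n
  Tfraction-suc α δ m n = ≈-trans (geom-suc _ n)
    (conv-cong-≤ n (λ i i≤n → +-cong ≈-refl (*-congˡ (Tconv-stable α δ (suc n) (suc i) (suc m) i (s≤s i≤n) ≤-refl)))
                   (λ i i≤n → Tconv-stable α δ (suc (suc n)) (suc i) m i (s≤s (m≤n⇒m≤1+n i≤n)) ≤-refl))

  -- For the fractions C and C′ from levels m and m + 1 this is C = 1 + α t C′ C, multiplied by `X`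
  -- on the right. Carrying `X` along lets the identity act inside a product without commuting its
  -- factors.
  Tfraction-conv : ∀ α δ m X n → δ m ≈ 0# →
    conv (Tfraction α δ m) X n ≈ X n ⊕ α m ⊛ shift (conv (Tfraction α δ (suc m)) (conv (Tfraction α δ m) X)) n
  Tfraction-conv α δ m X zero    δ≈0 = solve 2 (λ x a → con 1 :* x := x :+ a :* con 0) ≈-refl (X 0) (α m)
  Tfraction-conv α δ m X (suc n) δ≈0 = begin
    1# ⊛ X (suc n) ⊕ conv (λ i → C (suc i)) X n          ≈⟨ +-cong (*-identityˡ _) (conv-congˡ n (Tfraction-suc α δ m)) ⟩
    X (suc n) ⊕ conv (conv (λ i → δ m ⊛ oneS R i ⊕ α m ⊛ C′ i) C) X n
      ≈⟨ +-cong ≈-refl (conv-congˡ n (λ i → conv-congˡ i (λ k → ≈-trans (+-cong (≈-trans (*-congʳ δ≈0) (zeroˡ _)) ≈-refl) (+-identityˡ _)))) ⟩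
    X (suc n) ⊕ conv (conv (λ i → α m ⊛ C′ i) C) X n     ≈⟨ +-cong ≈-refl (conv-assoc _ C X n) ⟩
    X (suc n) ⊕ conv (λ i → α m ⊛ C′ i) (conv C X) n     ≈⟨ +-cong ≈-refl (conv-scaleˡ (α m) C′ (conv C X) n) ⟩
    X (suc n) ⊕ α m ⊛ conv C′ (conv C X) n ∎
    where
    C C′ : Series R
    C  = Tfraction α δ m
    C′ = Tfraction α δ (suc m)

  -- Weighted walks on heights whose steps alternate between {up, level} (weights a, F) and
  -- {level, down} (weights E, B).
  module Walks (a F E B : ℕ → A) where

    mutual
      -- The remaining walk consists of n pairs of steps and has to end at height 0; `walkDown`
      -- starts in the middle of a pair, with n whole pairs to follow.
      walkUp : ℕ → ℕ → A
      walkUp zero    zero    = 1#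
      walkUp zero    (suc h) = 0#
      walkUp (suc n) h       = a h ⊛ walkDown n (suc h) ⊕ F h ⊛ walkDown n h

      walkDown : ℕ → ℕ → A
      walkDown n zero    = E 0 ⊛ walkUp n 0
      walkDown n (suc h) = E (suc h) ⊛ walkUp n (suc h) ⊕ B (suc h) ⊛ walkUp n h

    -- The hypotheses are the contraction formulas for the walk made of pairs of steps. A rise from
    -- h to h + 1 (up, level) and the matching fall (level, down) together weigh a_h E_{h+1} F_{h+1}
    -- B_{h+1}, which is α_{2h+1} α_{2h+2}; the two ways of staying at a positive height weigh
    -- α_{2h} and α_{2h+1}.
    module Contraction (α δ : ℕ → A)
      (α-odd  : ∀ h → α (suc (double h)) ≈ a h ⊛ B (suc h))
      (α-even : ∀ h → α (suc (suc (double h))) ≈ E (suc h) ⊛ F (suc h))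
      (δ₁ : δ 1 ≈ E 0 ⊛ F 0) (δ₂ : ∀ m → δ (suc (suc m)) ≈ 0#) where

      C : ℕ → Series R
      C = Tfraction α δ

      -- The generating functions of walkUp and walkDown, factored at the first passages below each level.
      mutual
        upSeries : ℕ → Series R
        upSeries zero    = C 1
        upSeries (suc h) = shift (λ n → F (suc h) ⊛ conv (C (suc (double (suc h)))) (downSeries h) n)

        downSeries : ℕ → Series R
        downSeries h n = B (suc h) ⊛ conv (C (suc (suc (double h)))) (upSeries h) n

      -- `downSeries h` starts at height h + 1. Unfolding the even-indexed fraction once leaves the
      -- down step as the term without α; in the other term α is E F, and F with the remaining
      -- product is `upSeries (suc h)`, so that E is the level step.
      downSeries-rec : ∀ h n → downSeries h n ≈ E (suc h) ⊛ upSeries (suc h) n ⊕ B (suc h) ⊛ upSeries h n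
      downSeries-rec h n = begin
        B′ ⊛ conv Cₑ (upSeries h) n                                ≈⟨ *-congˡ (Tfraction-conv α δ _ (upSeries h) n (δ₂ _)) ⟩
        B′ ⊛ (upSeries h n ⊕ α _ ⊛ shift (conv Cₒ (conv Cₑ (upSeries h))) n)
          ≈⟨ *-congˡ (+-cong ≈-refl (*-congʳ (α-even h))) ⟩
        B′ ⊛ (upSeries h n ⊕ (E′ ⊛ F′) ⊛ shift (conv Cₒ (conv Cₑ (upSeries h))) n)
          ≈⟨ solve 5 (λ b x e f y → b :* (x :+ (e :* f) :* y) := e :* (f :* (b :* y)) :+ b :* x) ≈-refl B′ _ E′ F′ _ ⟩
        E′ ⊛ (F′ ⊛ (B′ ⊛ shift (conv Cₒ (conv Cₑ (upSeries h))) n)) ⊕ B′ ⊛ upSeries h n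
          ≈⟨ +-cong (*-congˡ (unshift n)) ≈-refl ⟩
        E′ ⊛ upSeries (suc h) n ⊕ B′ ⊛ upSeries h n ∎
        where
        B′ E′ F′ : A
        B′ = B (suc h)
        E′ = E (suc h)
        F′ = F (suc h)
        Cₑ Cₒ : Series R
        Cₑ = C (suc (suc (double h)))
        Cₒ = C (suc (double (suc h)))
        unshift : ∀ n → F′ ⊛ (B′ ⊛ shift (conv Cₒ (conv Cₑ (upSeries h))) n) ≈ upSeries (suc h) n
        unshift zero    = solve 2 (λ f b → f :* (b :* con 0) := con 0) ≈-refl F′ B′
        unshift (suc n) = *-congˡ (≈-sym (conv-scaleʳ B′ Cₒ (conv Cₑ (upSeries h)) n))

      upSeries-zero-rec : ∀ n → upSeries 0 (suc n) ≈ a 0 ⊛ downSeries 0 n ⊕ F 0 ⊛ (E 0 ⊛ upSeries 0 n)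
      upSeries-zero-rec n = begin
        C 1 (suc n)                                              ≈⟨ Tfraction-suc α δ 1 n ⟩
        conv (λ i → δ 1 ⊛ oneS R i ⊕ α 1 ⊛ C 2 i) (C 1) n        ≈⟨ conv-+ˡ _ _ (C 1) n ⟩
        conv (λ i → δ 1 ⊛ oneS R i) (C 1) n ⊕ conv (λ i → α 1 ⊛ C 2 i) (C 1) n
          ≈⟨ +-cong (≈-trans (conv-scaleˡ (δ 1) (oneS R) (C 1) n) (*-cong δ₁ (conv-oneˡ (C 1) n)))
                    (≈-trans (conv-scaleˡ (α 1) (C 2) (C 1) n) (*-congʳ (α-odd 0))) ⟩
        (E 0 ⊛ F 0) ⊛ C 1 n ⊕ (a 0 ⊛ B 1) ⊛ conv (C 2) (C 1) n
          ≈⟨ solve 6 (λ e f c a b d → (e :* f) :* c :+ (a :* b) :* d := a :* (b :* d) :+ f :* (e :* c)) ≈-refl (E 0) (F 0) _ (a 0) (B 1) _ ⟩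
        a 0 ⊛ downSeries 0 n ⊕ F 0 ⊛ (E 0 ⊛ upSeries 0 n) ∎

      upSeries-suc-rec : ∀ h n → upSeries (suc h) (suc n) ≈ a (suc h) ⊛ downSeries (suc h) n ⊕ F (suc h) ⊛ downSeries h n
      upSeries-suc-rec h n = begin
        F′ ⊛ conv Cₒ (downSeries h) n                                     ≈⟨ *-congˡ (Tfraction-conv α δ _ (downSeries h) n (δ₂ _)) ⟩
        F′ ⊛ (downSeries h n ⊕ α _ ⊛ shift (conv Cₑ (conv Cₒ (downSeries h))) n)
          ≈⟨ *-congˡ (+-cong ≈-refl (*-congʳ (α-odd (suc h)))) ⟩
        F′ ⊛ (downSeries h n ⊕ (a′ ⊛ B″) ⊛ shift (conv Cₑ (conv Cₒ (downSeries h))) n)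
          ≈⟨ solve 5 (λ f x a b y → f :* (x :+ (a :* b) :* y) := a :* (b :* (f :* y)) :+ f :* x) ≈-refl F′ _ a′ B″ _ ⟩
        a′ ⊛ (B″ ⊛ (F′ ⊛ shift (conv Cₑ (conv Cₒ (downSeries h))) n)) ⊕ F′ ⊛ downSeries h n
          -- In `downSeries (suc h)` the factor t sits inside `upSeries (suc h)`, hence it has to
          -- pass through the outer fraction.
          ≈⟨ +-cong (*-congˡ (*-congˡ (≈-trans (unshift n) (≈-sym (conv-shift Cₑ _ n))))) ≈-refl ⟩
        a′ ⊛ downSeries (suc h) n ⊕ F′ ⊛ downSeries h n ∎
        where
        a′ B″ F′ : A
        a′ = a (suc h)
        B″ = B (suc (suc h))
        F′ = F (suc h)
        Cₑ Cₒ : Series R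
        Cₑ = C (suc (suc (double (suc h))))
        Cₒ = C (suc (double (suc h)))
        unshift : ∀ n → F′ ⊛ shift (conv Cₑ (conv Cₒ (downSeries h))) n ≈ shift (conv Cₑ (λ n → F′ ⊛ conv Cₒ (downSeries h) n)) n
        unshift zero    = zeroʳ F′
        unshift (suc n) = ≈-sym (conv-scaleʳ F′ Cₑ (conv Cₒ (downSeries h)) n)

      mutual
        walkUp≈ : ∀ n h → walkUp n h ≈ upSeries h n
        walkUp≈ zero    zero    = ≈-refl
        walkUp≈ zero    (suc h) = ≈-refl
        walkUp≈ (suc n) zero    = ≈-trans (+-cong (*-congˡ (walkDown≈ n 0)) (*-congˡ (*-congˡ (walkUp≈ n 0)))) (≈-sym (upSeries-zero-rec n))
        walkUp≈ (suc n) (suc h) = ≈-trans (+-cong (*-congˡ (walkDown≈ n (suc h))) (*-congˡ (walkDown≈ n h))) (≈-sym (upSeries-suc-rec h n))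

        walkDown≈ : ∀ n h → walkDown n (suc h) ≈ downSeries h n
        walkDown≈ n h = ≈-trans (+-cong (*-congˡ (walkUp≈ n (suc h))) (*-congˡ (walkUp≈ n h))) (≈-sym (downSeries-rec h n))

      Tconv≈walkUp : ∀ N n → n < N → Tconv R α δ N 1 n ≈ walkUp n 0
      Tconv≈walkUp N n n<N = ≈-trans (Tconv-stable α δ N (suc n) 1 n n<N ≤-refl) (≈-sym (walkUp≈ n 0))

-- Partial permutations as traces

-- Traces are stored as words and not as functions: equality of words is decidable, and `matches`
-- has to test it.
tab : ℕ → (ℕ → ℕ) → List ℕ
tab m g = applyUpTo (g ∘ suc) m

at-applyUpTo : ∀ f m i → i < m → at (applyUpTo f m) (suc i) ≡ f i
at-applyUpTo f (suc m) zero    _         = refl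
at-applyUpTo f (suc m) (suc i) (s≤s i<m) = at-applyUpTo (f ∘ suc) m i i<m

at-tab : ∀ m g {i} → Within m i → at (tab m g) i ≡ g i
at-tab m g {suc i} (_ , u) = at-applyUpTo (g ∘ suc) m i u

applyUpTo-cong : ∀ {a} {A : Set a} {f g : ℕ → A} m → (∀ i → i < m → f i ≡ g i) → applyUpTo f m ≡ applyUpTo g m
applyUpTo-cong zero    h = refl
applyUpTo-cong (suc m) h = cong₂ _∷_ (h 0 (s≤s z≤n)) (applyUpTo-cong m (λ i i<m → h (suc i) (s≤s i<m)))

tab-cong : ∀ m {f g} → (∀ i → Within m i → f i ≡ g i) → tab m f ≡ tab m g
tab-cong m h = applyUpTo-cong m (λ i i<m → h (suc i) (s≤s z≤n , i<m))

tab-at : ∀ w {m} → length w ≡ m → tab m (at w) ≡ w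
tab-at []      refl = refl
tab-at (x ∷ w) refl = cong (x ∷_) (tab-at w refl)

cut : ℕ → ℕ → ℕ
cut j x = if x ≤ᵇ j then x else 0

cut-≤ : ∀ {j x} → x ≤ j → cut j x ≡ x
cut-≤ {j} {x} p = cong (λ b → if b then x else 0) (≤ᵇ-true p)

cut-> : ∀ {j x} → j < x → cut j x ≡ 0
cut-> {j} {x} p = cong (λ b → if b then x else 0) (≤ᵇ-false p)

cut-suc : ∀ {j x} → x ≢ suc j → cut (suc j) x ≡ cut j x
cut-suc {j} {x} x≢ with x ≤? j
... | yes p = trans (cut-≤ (m≤n⇒m≤1+n p)) (sym (cut-≤ p))
... | no ¬p = trans (cut-> (≤∧≢⇒< (≰⇒> ¬p) (x≢ ∘ sym))) (sym (cut-> (≰⇒> ¬p)))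

trunc : ℕ → List ℕ → List ℕ
trunc j σ = tab j (cut j ∘ at σ)

at-trunc : ∀ j σ {i} → Within j i → at (trunc j σ) i ≡ cut j (at σ i)
at-trunc j σ = at-tab j (cut j ∘ at σ)

-- The effect of position k = j + 1: (p , v) sets w(p) = k and w(k) = v, where p = 0 or v = 0
-- stand for a preimage or image beyond k.
update : ℕ → List ℕ → ℕ × ℕ → ℕ → ℕ
update k w (p , v) i = if i ≡ᵇ k then v else if i ≡ᵇ p then k else at w i

extend : ℕ → List ℕ → ℕ × ℕ → List ℕ
extend j w o = tab (suc j) (update (suc j) w o)

module _ (j : ℕ) (w : List ℕ) (p v : ℕ) where

  at-extend-last : at (extend j w (p , v)) (suc j) ≡ v
  at-extend-last = trans (at-tab (suc j) (update (suc j) w (p , v)) (within-last j))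
    (cong (λ b → if b then v else (if suc j ≡ᵇ p then suc j else at w (suc j))) (≡ᵇ-true {suc j} refl))

  at-extend-init : ∀ {i} → Within j i → at (extend j w (p , v)) i ≡ (if i ≡ᵇ p then suc j else at w i)
  at-extend-init {i} wi = trans (at-tab (suc j) (update (suc j) w (p , v)) (within-suc wi))
    (cong (λ b → if b then v else (if i ≡ᵇ p then suc j else at w i)) (≡ᵇ-false (λ e → <⇒≱ (n<1+n j) (subst (_≤ j) e (proj₂ wi)))))

  at-extend-hit : ∀ {i} → Within j i → i ≡ p → at (extend j w (p , v)) i ≡ suc j
  at-extend-hit {i} wi e = trans (at-extend-init wi) (cong (λ b → if b then suc j else at w i) (≡ᵇ-true e))

  at-extend-miss : ∀ {i} → Within j i → i ≢ p → at (extend j w (p , v)) i ≡ at w i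
  at-extend-miss {i} wi ne = trans (at-extend-init wi) (cong (λ b → if b then suc j else at w i) (≡ᵇ-false ne))

-- An even position maps to at most itself, so its image is known as soon as the position is
-- revealed. Only odd positions can be open.
record State (j : ℕ) (w : List ℕ) : Set where
  field
    length≡ : length w ≡ j
    partial : PartialInjection j (at w)
    odd≤    : ∀ {i} → Within j i → isEven i ≡ false → at w i ≡ 0 ⊎ i ≤ at w i
    even≥   : ∀ {i} → Within j i → isEven i ≡ true → at w i ≢ 0 × at w i ≤ i
  open PartialInjection partial public

-- A fixed point is `(0 , suc j)`, since the first component names only preimages in [j]. Odd
-- positions do not map down and even ones do not map up, so the parity rules out two of the other
-- four kinds.
data Option (j : ℕ) (w : List ℕ) : ℕ × ℕ → Set where
  valley : isEven (suc j) ≡ false → Option j w (0 , 0)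
  drise  : ∀ {p} → isEven (suc j) ≡ false → Within j p → at w p ≡ 0 → Option j w (p , 0)
  fixed  : Option j w (0 , suc j)
  dfall  : ∀ {v} → isEven (suc j) ≡ true → Within j v → T (free j (at w) v) → Option j w (0 , v)
  peak   : ∀ {p v} → isEven (suc j) ≡ true → Within j p → at w p ≡ 0 → Within j v → T (free j (at w) v) → Option j w (p , v)

option-out : ∀ {j w p v} → Option j w (p , v) → p ≡ 0 ⊎ (Within j p × at w p ≡ 0)
option-out (valley _)         = inj₁ refl
option-out (drise _ wp z)     = inj₂ (wp , z)
option-out fixed              = inj₁ refl
option-out (dfall _ _ _)      = inj₁ refl
option-out (peak _ wp z _ _)  = inj₂ (wp , z)

option-in : ∀ {j w p v} → Option j w (p , v) → v ≡ 0 ⊎ (p ≡ 0 × v ≡ suc j) ⊎ (Within j v × T (free j (at w) v))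
option-in (valley _)        = inj₁ refl
option-in (drise _ _ _)     = inj₁ refl
option-in fixed             = inj₂ (inj₁ (refl , refl))
option-in (dfall _ wv f)    = inj₂ (inj₂ (wv , f))
option-in (peak _ _ _ wv f) = inj₂ (inj₂ (wv , f))

option-odd : ∀ {j w p v} → Option j w (p , v) → isEven (suc j) ≡ false → v ≡ 0 ⊎ suc j ≤ v
option-odd (valley _)       _ = inj₁ refl
option-odd (drise _ _ _)    _ = inj₁ refl
option-odd fixed            _ = inj₂ ≤-refl
option-odd (dfall e _ _)    o with trans (sym e) o
... | ()
option-odd (peak e _ _ _ _) o with trans (sym e) o
... | ()

option-even : ∀ {j w p v} → Option j w (p , v) → isEven (suc j) ≡ true → v ≢ 0
option-even (valley o)        e with trans (sym e) o
... | ()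
option-even (drise o _ _)     e with trans (sym e) o
... | ()
option-even fixed             _ = 1+n≢0
option-even (dfall _ wv _)    _ = 0-∉ wv
option-even (peak _ _ _ wv _) _ = 0-∉ wv

option-≤ : ∀ {j w p v} → Option j w (p , v) → v ≤ suc j
option-≤ o with option-in o
... | inj₁ refl              = z≤n
... | inj₂ (inj₁ (_ , refl)) = ≤-refl
... | inj₂ (inj₂ (wv , _))   = m≤n⇒m≤1+n (proj₂ wv)

data InitLast (j i : ℕ) : Set where
  last : i ≡ suc j → InitLast j i
  init : Within j i → InitLast j i

initLast : ∀ {j i} → Within (suc j) i → InitLast j i
initLast {j} {i} wi with i ≟ suc j
... | yes e = last e
... | no ne = init (within-suc⁻ wi ne)

module _ {j : ℕ} {w : List ℕ} (S : State j w) where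
  open State S

  bound-last : ∀ {i} → Within j i → at w i ≢ suc j
  bound-last wi e = <⇒≱ (n<1+n j) (subst (_≤ j) e (bounded wi))

  extend-state : ∀ {o} → Option j w o → State (suc j) (extend j w o)
  extend-state {p , v} o = record
    { length≡ = length-applyUpTo (update (suc j) w (p , v) ∘ suc) (suc j)
    ; partial = record { bounded = λ wi → bnd (initLast wi) ; injective = λ wi wi′ → inj (initLast wi) (initLast wi′) }
    ; odd≤    = λ wi → odd (initLast wi)
    ; even≥   = λ wi → even (initLast wi)
    }
    where
    w′ : List ℕ
    w′ = extend j w (p , v)
    bnd : ∀ {i} → InitLast j i → at w′ i ≤ suc j
    bnd (last refl) = subst (_≤ suc j) (sym (at-extend-last j w p v)) (option-≤ o)
    bnd {i} (init wi) with i ≟ p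
    ... | yes e = ≤-reflexive (at-extend-hit j w p v wi e)
    ... | no ne = subst (_≤ suc j) (sym (at-extend-miss j w p v wi ne)) (m≤n⇒m≤1+n (bounded wi))
    -- The value `v` is j + 1 only at a fixed point, and there p = 0 places j + 1 nowhere in [j].
    -- Otherwise `v` is 0, which is not counted as a repetition, or free.
    last≢init : ∀ {i} → Within j i → at w′ i ≢ 0 → v ≢ at w′ i
    last≢init {i} wi nz e with i ≟ p
    ... | yes refl rewrite at-extend-hit j w p v wi refl with option-in o
    ...   | inj₁ refl              = 0≢1+n e
    ...   | inj₂ (inj₁ (refl , _)) = 0-∉ wi refl
    ...   | inj₂ (inj₂ (wv , _))   = <⇒≱ (n<1+n j) (subst (_≤ j) e (proj₂ wv))
    last≢init {i} wi nz e | no ne rewrite at-extend-miss j w p v wi ne with option-in o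
    ...   | inj₁ refl              = nz (sym e)
    ...   | inj₂ (inj₁ (_ , refl)) = bound-last wi (sym e)
    ...   | inj₂ (inj₂ (_ , f))    = free⁻ {j} {at w} f i wi (sym e)
    inj : ∀ {i i′} → InitLast j i → InitLast j i′ → at w′ i ≢ 0 → at w′ i ≡ at w′ i′ → i ≡ i′
    inj (last refl) (last refl) _ _ = refl
    inj (last refl) (init wi′) nz e =
      ⊥-elim (last≢init wi′ (subst (_≢ 0) e nz) (trans (sym (at-extend-last j w p v)) e))
    inj (init wi) (last refl) nz e =
      ⊥-elim (last≢init wi nz (trans (sym (at-extend-last j w p v)) (sym e)))
    inj {i} {i′} (init wi) (init wi′) nz e with i ≟ p | i′ ≟ p
    ... | yes q | yes q′ = trans q (sym q′)
    ... | yes q | no ne′ = ⊥-elim (bound-last wi′ (trans (sym (at-extend-miss j w p v wi′ ne′)) (trans (sym e) (at-extend-hit j w p v wi q))))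
    ... | no ne | yes q′ = ⊥-elim (bound-last wi (trans (sym (at-extend-miss j w p v wi ne)) (trans e (at-extend-hit j w p v wi′ q′))))
    ... | no ne | no ne′ = injective wi wi′ (subst (_≢ 0) (at-extend-miss j w p v wi ne) nz)
      (trans (sym (at-extend-miss j w p v wi ne)) (trans e (at-extend-miss j w p v wi′ ne′)))
    odd : ∀ {i} → InitLast j i → isEven i ≡ false → at w′ i ≡ 0 ⊎ i ≤ at w′ i
    odd (last refl) e rewrite at-extend-last j w p v = option-odd o e
    odd {i} (init wi) e with i ≟ p
    ... | yes q rewrite at-extend-hit j w p v wi q = inj₂ (m≤n⇒m≤1+n (proj₂ wi))
    ... | no ne rewrite at-extend-miss j w p v wi ne = odd≤ wi e
    even : ∀ {i} → InitLast j i → isEven i ≡ true → at w′ i ≢ 0 × at w′ i ≤ i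
    even (last refl) e rewrite at-extend-last j w p v = option-even o e , option-≤ o
    even {i} (init wi) e with i ≟ p
    ... | no ne rewrite at-extend-miss j w p v wi ne = even≥ wi e
    ... | yes refl with option-out o
    ...   | inj₁ refl    = ⊥-elim (0-∉ wi refl)
    ...   | inj₂ (_ , z) = ⊥-elim (proj₁ (even≥ wi e) z)

-- Open ends, free starts and the height

height : ℕ → List ℕ → ℕ
height j w = ∑ j (λ p → 𝟙 (at w p ≡ᵇ 0))

outs ins : ℕ → List ℕ → List ℕ
outs j w = filterᵇ (λ p → at w p ≡ᵇ 0) (range j)
ins  j w = filterᵇ (free j (at w)) (range j)

∈-outs⁻ : ∀ {j w p} → p ∈ outs j w → Within j p × at w p ≡ 0
∈-outs⁻ {j} {w} p∈ with ∈-filterᵇ⁻ (λ p → at w p ≡ᵇ 0) p∈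
... | p∈r , t = ∈-range⁻ p∈r , ≡ᵇ⇒≡ _ 0 t

∈-outs⁺ : ∀ {j w p} → Within j p → at w p ≡ 0 → p ∈ outs j w
∈-outs⁺ {j} {w} wp z = ∈-filterᵇ⁺ (λ p → at w p ≡ᵇ 0) (∈-range⁺ wp) (≡⇒≡ᵇ _ 0 z)

∈-ins⁻ : ∀ {j w v} → v ∈ ins j w → Within j v × T (free j (at w) v)
∈-ins⁻ {j} {w} v∈ with ∈-filterᵇ⁻ (free j (at w)) v∈
... | v∈r , t = ∈-range⁻ v∈r , t

∈-ins⁺ : ∀ {j w v} → Within j v → T (free j (at w) v) → v ∈ ins j w
∈-ins⁺ {j} {w} wv = ∈-filterᵇ⁺ (free j (at w)) (∈-range⁺ wv)

outs-unique : ∀ j w → Unique (outs j w)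
outs-unique j w = filterᵇ-unique _ (range-unique j)

ins-unique : ∀ j w → Unique (ins j w)
ins-unique j w = filterᵇ-unique _ (range-unique j)

length-outs : ∀ j w → length (outs j w) ≡ height j w
length-outs j w = countB-range j (λ p → at w p ≡ᵇ 0)

length-ins : ∀ {j w} → State j w → length (ins j w) ≡ height j w
length-ins {j} {w} S = trans (countB-range j (free j (at w))) (sym (zeros≡frees (State.partial S)))

-- Peaks are listed by start first and by end within each start, because the closing end is unique
-- for a given start and the rank weight belongs to the start.
optionsOdd optionsEven : ℕ → List ℕ → List (ℕ × ℕ)
optionsOdd  j w = (0 , 0) ∷ (0 , suc j) ∷ map (_, 0) (outs j w)
optionsEven j w = (0 , suc j) ∷ (map (0 ,_) (ins j w) ++ cartesianProductWith (λ v p → p , v) (ins j w) (outs j w))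

optionsOdd⇒Option : ∀ {j w o} → isEven (suc j) ≡ false → o ∈ optionsOdd j w → Option j w o
optionsOdd⇒Option e (here refl)         = valley e
optionsOdd⇒Option e (there (here refl)) = fixed
optionsOdd⇒Option {j} {w} e (there (there m)) with ∈-map⁻ (_, 0) m
... | p , p∈ , refl with ∈-outs⁻ {j} {w} p∈
...   | wp , z = drise e wp z

optionsEven⇒Option : ∀ {j w o} → isEven (suc j) ≡ true → o ∈ optionsEven j w → Option j w o
optionsEven⇒Option e (here refl) = fixed
optionsEven⇒Option {j} {w} e (there m) with ∈-++⁻ (map (0 ,_) (ins j w)) m
... | inj₁ m₁ with ∈-map⁻ (0 ,_) m₁
...   | v , v∈ , refl with ∈-ins⁻ {j} {w} v∈
...     | wv , f = dfall e wv f
optionsEven⇒Option {j} {w} e (there m) | inj₂ m₂ with ∈-cartesianProductWith⁻ (λ v p → p , v) (ins j w) (outs j w) m₂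
...   | v , p , v∈ , p∈ , refl with ∈-ins⁻ {j} {w} v∈ | ∈-outs⁻ {j} {w} p∈
...     | wv , f | wp , z = peak e wp z wv f

Option⇒optionsOdd : ∀ {j w o} → isEven (suc j) ≡ false → Option j w o → o ∈ optionsOdd j w
Option⇒optionsOdd {j} {w} e (valley _)       = here refl
Option⇒optionsOdd {j} {w} e (drise _ wp z)   = there (there (∈-map⁺ (_, 0) (∈-outs⁺ {j} {w} wp z)))
Option⇒optionsOdd {j} {w} e fixed            = there (here refl)
Option⇒optionsOdd {j} {w} e (dfall e′ _ _)    with trans (sym e′) e
... | ()
Option⇒optionsOdd {j} {w} e (peak e′ _ _ _ _) with trans (sym e′) e
... | ()

Option⇒optionsEven : ∀ {j w o} → isEven (suc j) ≡ true → Option j w o → o ∈ optionsEven j w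
Option⇒optionsEven {j} {w} e (valley e′)     with trans (sym e′) e
... | ()
Option⇒optionsEven {j} {w} e (drise e′ _ _)  with trans (sym e′) e
... | ()
Option⇒optionsEven {j} {w} e fixed           = here refl
Option⇒optionsEven {j} {w} e (dfall _ wv f)  = there (∈-++⁺ˡ (∈-map⁺ (0 ,_) (∈-ins⁺ {j} {w} wv f)))
Option⇒optionsEven {j} {w} e (peak _ wp z wv f) = there (∈-++⁺ʳ (map (0 ,_) (ins j w))
  (∈-cartesianProductWith⁺ (λ v p → p , v) (∈-ins⁺ {j} {w} wv f) (∈-outs⁺ {j} {w} wp z)))

optionsOdd-unique : ∀ j w → Unique (optionsOdd j w)
optionsOdd-unique j w =
  ((λ ()) ∷ All.tabulate (λ m → ne0 m))
  ∷ All.tabulate (λ m → nek m)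
  ∷ Unique.map⁺ (λ { refl → refl }) (outs-unique j w)
  where
  ne0 : ∀ {o} → o ∈ map (_, 0) (outs j w) → (0 , 0) ≢ o
  ne0 m e with ∈-map⁻ (_, 0) m
  ne0 m refl | .0 , p∈ , refl = 0-∉ (proj₁ (∈-outs⁻ {j} {w} p∈)) refl
  nek : ∀ {o} → o ∈ map (_, 0) (outs j w) → (0 , suc j) ≢ o
  nek m e with ∈-map⁻ (_, 0) m
  nek m () | _ , _ , refl

optionsEven-unique : ∀ j w → Unique (optionsEven j w)
optionsEven-unique j w =
  All.tabulate (λ m → fresh m)
  ∷ Unique.++⁺ (Unique.map⁺ (λ { refl → refl }) (ins-unique j w))
               (Unique.cartesianProductWith⁺ (λ v p → p , v) (λ { refl → refl , refl }) (ins-unique j w) (outs-unique j w))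
               disjoint
  where
  cart : List (ℕ × ℕ)
  cart = cartesianProductWith (λ v p → p , v) (ins j w) (outs j w)
  fresh : ∀ {o} → o ∈ map (0 ,_) (ins j w) ++ cart → (0 , suc j) ≢ o
  fresh m refl with ∈-++⁻ (map (0 ,_) (ins j w)) m
  ... | inj₁ m₁ with ∈-map⁻ (0 ,_) m₁
  ...   | _ , v∈ , refl = <⇒≱ (n<1+n j) (proj₂ (proj₁ (∈-ins⁻ {j} {w} v∈)))
  fresh m refl | inj₂ m₂ with ∈-cartesianProductWith⁻ (λ v p → p , v) (ins j w) (outs j w) m₂
  ...   | _ , _ , _ , p∈ , refl = 0-∉ (proj₁ (∈-outs⁻ {j} {w} p∈)) refl
  disjoint : ∀ {o} → ¬ (o ∈ map (0 ,_) (ins j w) × o ∈ cart)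
  disjoint (m₁ , m₂) with ∈-map⁻ (0 ,_) m₁ | ∈-cartesianProductWith⁻ (λ v p → p , v) (ins j w) (outs j w) m₂
  ... | _ , _ , refl | _ , _ , _ , p∈ , refl = 0-∉ (proj₁ (∈-outs⁻ {j} {w} p∈)) refl

height-extend : ∀ j w p v → height (suc j) (extend j w (p , v)) ≡ ∑ j (λ i → 𝟙 (at (extend j w (p , v)) i ≡ᵇ 0)) + 𝟙 (v ≡ᵇ 0)
height-extend j w p v = cong (λ x → ∑ j (λ i → 𝟙 (at (extend j w (p , v)) i ≡ᵇ 0)) + 𝟙 (x ≡ᵇ 0)) (at-extend-last j w p v)

height-keep : ∀ j w v → ∑ j (λ i → 𝟙 (at (extend j w (0 , v)) i ≡ᵇ 0)) ≡ height j w
height-keep j w v = ∑-cong j (λ i wi → cong (λ x → 𝟙 (x ≡ᵇ 0)) (at-extend-miss j w 0 v wi (0-∉ wi)))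

height-drop : ∀ {j w p} v → Within j p → at w p ≡ 0 → height j w ≡ suc (∑ j (λ i → 𝟙 (at (extend j w (p , v)) i ≡ᵇ 0)))
height-drop {j} {w} {p} v wp z = ∑-drop j p wp
  (trans (cong (λ x → 𝟙 (x ≡ᵇ 0)) z) (cong (λ x → suc (𝟙 (x ≡ᵇ 0))) (sym (at-extend-hit j w p v wp refl))))
  (λ i wi ne → cong (λ x → 𝟙 (x ≡ᵇ 0)) (sym (at-extend-miss j w p v wi ne)))

height-valley : ∀ j w → height (suc j) (extend j w (0 , 0)) ≡ suc (height j w)
height-valley j w = trans (height-extend j w 0 0) (trans (ℕ.+-comm _ 1) (cong suc (height-keep j w 0)))

height-level : ∀ j w {v} → v ≢ 0 → height (suc j) (extend j w (0 , v)) ≡ height j w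
height-level j w {v} nz = trans (height-extend j w 0 v)
  (trans (cong₂ _+_ (height-keep j w v) (cong 𝟙 (≡ᵇ-false nz))) (ℕ.+-identityʳ _))

-- Position `p` closes and j + 1 opens in its place.
height-drise : ∀ {j w p} → Within j p → at w p ≡ 0 → height (suc j) (extend j w (p , 0)) ≡ height j w
height-drise {j} {w} {p} wp z = trans (height-extend j w p 0) (trans (ℕ.+-comm _ 1) (sym (height-drop {j} {w} 0 wp z)))

height-peak : ∀ {j w p v} → Within j p → at w p ≡ 0 → v ≢ 0 → height j w ≡ suc (height (suc j) (extend j w (p , v)))
height-peak {j} {w} {p} {v} wp z nz = trans (height-drop {j} {w} v wp z)
  (cong suc (sym (trans (height-extend j w p v) (trans (cong (λ x → ∑ j (λ i → 𝟙 (at (extend j w (p , v)) i ≡ᵇ 0)) + 𝟙 x) (≡ᵇ-false nz)) (ℕ.+-identityʳ _)))))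

-- Statistics of a position in terms of the trace

above below : List ℕ → ℕ → ℕ
above xs x = countB xs (x <ᵇ_)
below xs x = countB xs (_<ᵇ x)

countB-filterᵇ : ∀ (p q : ℕ → Bool) xs → countB (filterᵇ p xs) q ≡ countB xs (λ x → p x ∧ q x)
countB-filterᵇ p q []       = refl
countB-filterᵇ p q (x ∷ xs) with p x
... | false = countB-filterᵇ p q xs
... | true with q x
...   | true  = cong suc (countB-filterᵇ p q xs)
...   | false = countB-filterᵇ p q xs

countB-filterᵇ-range : ∀ j (p q : ℕ → Bool) → countB (filterᵇ p (range j)) q ≡ ∑ j (λ x → 𝟙 (p x ∧ q x))
countB-filterᵇ-range j p q = trans (countB-filterᵇ p q (range j)) (countB-range j (λ x → p x ∧ q x))

count3-∑ : ∀ m P → count3 m P ≡ ∑ m (λ x → ∑ m (λ y → ∑ m (λ z → 𝟙 (P x y z))))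
count3-∑ m P = trans (∑-range m _) (∑-cong m (λ x _ → trans (∑-range m _) (∑-cong m (λ y _ → countB-range m (P x y)))))

-- Puts the middle entry of the triple outermost, for the statistics in which σ and k determine the
-- other two entries from it.
count3-∑′ : ∀ m P → count3 m P ≡ ∑ m (λ y → ∑ m (λ x → ∑ m (λ z → 𝟙 (P x y z))))
count3-∑′ m P = trans (count3-∑ m P) (∑-swap m m (λ x y → ∑ m (λ z → 𝟙 (P x y z))))

-- Crossings and nestings at a position are counted as triples, but one entry together with σ fixes
-- the other two. The triple sum thus becomes a count of single positions or values in [j], which
-- can be compared with the trace.
∑-determined : ∀ {j m} → j ≤ m → (P : ℕ → ℕ → ℕ → Bool) (Q : ℕ → Bool) (f g : ℕ → ℕ) →
  (∀ i → Within j i → Within m (f i) × Within m (g i)) →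
  (∀ i x y → Within m i → Within m x → Within m y → T (P i x y) → Within j i × x ≡ f i × y ≡ g i × T (Q i)) →
  (∀ i → Within j i → T (Q i) → T (P i (f i) (g i))) →
  ∑ m (λ i → ∑ m (λ x → ∑ m (λ y → 𝟙 (P i x y)))) ≡ ∑ j (𝟙 ∘ Q)
∑-determined {j} {m} j≤m P Q f g within only attained =
  trans (∑-prefix _ j≤m (λ i j<i i≤m → none i (≤-trans (s≤s z≤n) j<i , i≤m) (λ t → <⇒≱ j<i (proj₂ t)))) (∑-cong j pointwise)
  where
  none : ∀ i → Within m i → ¬ Within j i → ∑ m (λ x → ∑ m (λ y → 𝟙 (P i x y))) ≡ 0
  none i wi nwi = ∑-zero m (λ x wx → ∑-𝟙-none m (λ y wy t → nwi (proj₁ (only i x y wi wx wy t))))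
  pointwise : ∀ i → Within j i → ∑ m (λ x → ∑ m (λ y → 𝟙 (P i x y))) ≡ 𝟙 (Q i)
  pointwise i wi with T? (Q i)
  ... | no nq = trans (∑-zero m (λ x wx → ∑-𝟙-none m (λ y wy t → nq (proj₂ (proj₂ (proj₂ (only i x y (within-≤ j≤m wi) wx wy t)))))))
                      (cong 𝟙 (sym (¬T⇒≡false nq)))
  ... | yes q = trans (∑-single m (f i) (proj₁ (within i wi)) off) (trans on (cong 𝟙 (sym (T⇒≡true q))))
    where
    wmi : Within m i
    wmi = within-≤ j≤m wi
    off : ∀ x → Within m x → x ≢ f i → ∑ m (λ y → 𝟙 (P i x y)) ≡ 0
    off x wx ne = ∑-𝟙-none m (λ y wy t → ne (proj₁ (proj₂ (only i x y wmi wx wy t))))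
    on : ∑ m (λ y → 𝟙 (P i (f i) y)) ≡ 1
    on = ∑-𝟙-unique m (g i) (proj₂ (within i wi)) (attained i wi q)
           (λ y wy t → proj₁ (proj₂ (proj₂ (only i (f i) y wmi (proj₁ (within i wi)) wy t))))

chain⁻ : ∀ i j k l a b c d → T ((i <ᵇ j) ∧ (j <ᵇ k) ∧ (k <ᵇ l) ∧ (a ≡ᵇ b) ∧ (c ≡ᵇ d)) → i < j × j < k × k < l × a ≡ b × c ≡ d
chain⁻ i j k l a b c d t with T-∧⁻ (i <ᵇ j) _ t
... | t₁ , t′ with T-∧⁻ (j <ᵇ k) _ t′
...   | t₂ , t″ with T-∧⁻ (k <ᵇ l) _ t″
...     | t₃ , t‴ with T-∧⁻ (a ≡ᵇ b) _ t‴
...       | t₄ , t₅ = <ᵇ⇒< i j t₁ , <ᵇ⇒< j k t₂ , <ᵇ⇒< k l t₃ , ≡ᵇ⇒≡ a b t₄ , ≡ᵇ⇒≡ c d t₅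

chain⁺ : ∀ i j k l a b c d → i < j → j < k → k < l → a ≡ b → c ≡ d → T ((i <ᵇ j) ∧ (j <ᵇ k) ∧ (k <ᵇ l) ∧ (a ≡ᵇ b) ∧ (c ≡ᵇ d))
chain⁺ i j k l a b c d p q r e f = T-∧⁺ (<⇒<ᵇ p) (T-∧⁺ (<⇒<ᵇ q) (T-∧⁺ (<⇒<ᵇ r) (T-∧⁺ (≡⇒≡ᵇ a b e) (≡⇒≡ᵇ c d f))))

-- Paths of a trace and their ends

at-zero : ∀ w → at w 0 ≡ 0
at-zero []      = refl
at-zero (_ ∷ _) = refl

iter-zero : ∀ w t → iter w t 0 ≡ 0
iter-zero w zero    = refl
iter-zero w (suc t) = trans (cong (at w) (iter-zero w t)) (at-zero w)

iter-stays-zero : ∀ w {x} a t → a ≤ t → iter w a x ≡ 0 → iter w t x ≡ 0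
iter-stays-zero w {x} a t a≤t z = trans (cong (λ n → iter w n x) (sym (m∸n+n≡m a≤t)))
  (trans (iter-+ w (t ∸ a) a x) (trans (cong (iter w (t ∸ a)) z) (iter-zero w (t ∸ a))))

-- Times below j suffice, since a path in [j] has at most j points.
reach : ℕ → List ℕ → ℕ → ℕ → Bool
reach j w v p = any (λ t → iter w t v ≡ᵇ p) (upTo j)

reach⁺ : ∀ {j w v p t} → t < j → iter w t v ≡ p → T (reach j w v p)
reach⁺ {j} {w} {v} {p} t<j e = Any.any⁺ {xs = upTo j} _ (Any.map (λ { refl → ≡⇒≡ᵇ _ p e }) (∈-upTo⁺ t<j))

reach⁻ : ∀ {j w v p} → T (reach j w v p) → ∃[ t ] iter w t v ≡ p
reach⁻ {j} {w} {v} {p} r with Any.satisfied (Any.any⁻ (λ t → iter w t v ≡ᵇ p) (upTo j) r)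
... | t , e = t , ≡ᵇ⇒≡ _ p e

module PathEnd {j w} (S : State j w) {v} (wv : Within j v) (fv : T (free j (at w) v)) where
  open State S

  private
    Stops : ℕ → Set
    Stops n = ∃[ t ] t < n × Within j (iter w t v) × at w (iter w t v) ≡ 0

    search : ∀ n → Stops n ⊎ (∀ t → t ≤ n → Within j (iter w t v))
    search zero = inj₂ (λ { .0 z≤n → wv })
    search (suc n) with search n
    ... | inj₁ (t , t<n , rest) = inj₁ (t , m≤n⇒m≤1+n t<n , rest)
    ... | inj₂ all-within with at w (iter w n v) ≟ 0
    ...   | yes z = inj₁ (n , ≤-refl , all-within n ≤-refl , z)
    ...   | no nz = inj₂ extended
      where
      extended : ∀ t → t ≤ suc n → Within j (iter w t v)
      extended t t≤ with t ≟ suc n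
      ... | yes refl = n≢0⇒n>0 nz , bounded (all-within n ≤-refl)
      ... | no  t≢   = all-within t (≤-pred (≤∧≢⇒< t≤ t≢))

    -- Injectivity pulls a repetition back to time 0, where `v` would have a preimage although it is
    -- free.
    no-repeat : (∀ t → t ≤ j → Within j (iter w t v)) → ∀ a b → a < b → b ≤ j → iter w a v ≢ iter w b v
    no-repeat h zero    (suc b) _         b≤j e = free⁻ {j} {at w} fv (iter w b v) (h b (<⇒≤ b≤j)) (sym e)
    no-repeat h (suc a) (suc b) (s≤s a<b) b≤j e = no-repeat h a b a<b (<⇒≤ b≤j)
      (injective (h a (<⇒≤ (<-trans a<b b≤j))) (h b (<⇒≤ b≤j)) (0-∉ (h (suc a) (≤-trans a<b (<⇒≤ b≤j)))) e)

  stops : Stops j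
  stops with search j
  ... | inj₁ s = s
  ... | inj₂ h with pigeonhole j (λ t → iter w t v) h
  ...   | a , b , a<b , b≤j , e = ⊥-elim (no-repeat h a b a<b b≤j e)

  private
    -- After an open end every iterate is the absent value 0, which `at w` fixes. Hence a path has
    -- only one end.
    not-after : ∀ {t t′} → at w (iter w t v) ≡ 0 → iter w t′ v ≢ 0 → t′ ≤ t
    not-after {t} {t′} z nz with t′ ≤? t
    ... | yes p = p
    ... | no ¬p = ⊥-elim (nz (iter-stays-zero w (suc t) t′ (≰⇒> ¬p) z))

  end : ℕ
  end = iter w (proj₁ stops) v

  end∈outs : end ∈ outs j w
  end∈outs = ∈-outs⁺ {j} {w} (proj₁ (proj₂ (proj₂ stops))) (proj₂ (proj₂ (proj₂ stops)))

  reach-end : T (reach j w v end)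
  reach-end = reach⁺ {j} {w} (proj₁ (proj₂ stops)) refl

  reach-only-end : ∀ {p} → p ∈ outs j w → T (reach j w v p) → p ≡ end
  reach-only-end {p} p∈ r with reach⁻ {j} {w} r | ∈-outs⁻ {j} {w} p∈ | stops
  ... | t , refl | wp , z | t′ , _ , w′ , z′ =
    cong (λ n → iter w n v) (≤-antisym (not-after {t′} {t} z′ (0-∉ wp)) (not-after {t} {t′} z (0-∉ w′)))

-- The preimage is cut at j and the image at j + 1, so that a fixed point becomes `(0 , suc j)`, as
-- `Option` encodes it.
choice : ℕ → ℕ → List ℕ → ℕ × ℕ
choice m j σ = cut j (inv m σ (suc j)) , cut (suc j) (at σ (suc j))

-- A permutation seen from position k = j + 1

module Scan {m σ} (D : DPermutation m σ) (j : ℕ) (j<m : j < m) where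
  open DPermutation D
  open Inverse D
  open Orbits D

  private
    k : ℕ
    k = suc j
    s r : ℕ → ℕ
    s = at σ
    r = inv m σ
    w : List ℕ
    w = trunc j σ
    j≤m : j ≤ m
    j≤m = <⇒≤ j<m

  k-within : Within m k
  k-within = s≤s z≤n , j<m

  up : ∀ {i} → Within j i → Within m i
  up = within-≤ j≤m

  j≱k : ¬ (k ≤ j)
  j≱k = <⇒≱ (n<1+n j)

  open⁺ : ∀ {i} → Within j i → j < s i → T (at w i ≡ᵇ 0)
  open⁺ wi p = ≡⇒≡ᵇ _ 0 (trans (at-trunc j σ wi) (cut-> p))

  open⁻ : ∀ {i} → Within j i → T (at w i ≡ᵇ 0) → j < s i
  open⁻ {i} wi t with s i ≤? j
  ... | no ¬p = ≰⇒> ¬p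
  ... | yes p = ⊥-elim (0-∉ (into (up wi)) (trans (sym (trans (at-trunc j σ wi) (cut-≤ p))) (≡ᵇ⇒≡ _ 0 t)))

  at-trunc-nonzero : ∀ {i} → Within j i → at w i ≢ 0 → s i ≡ at w i
  at-trunc-nonzero {i} wi nz with s i ≤? j
  ... | yes p = sym (trans (at-trunc j σ wi) (cut-≤ p))
  ... | no ¬p = ⊥-elim (nz (trans (at-trunc j σ wi) (cut-> (≰⇒> ¬p))))

  free-trunc⁺ : ∀ {u} → Within j u → j < r u → T (free j (at w) u)
  free-trunc⁺ {u} wu j<ru = free⁺ {j} {at w} (λ p wp e → <⇒≱ j<ru
    (subst (_≤ j) (trans (sym (inv-at (up wp))) (cong r (trans (at-trunc-nonzero wp (λ z → 0-∉ wu (trans (sym e) z))) e))) (proj₂ wp)))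

  free-trunc⁻ : ∀ {u} → Within j u → T (free j (at w) u) → j < r u
  free-trunc⁻ {u} wu f with r u ≤? j
  ... | no ¬p = ≰⇒> ¬p
  ... | yes p = ⊥-elim (free⁻ {j} {at w} f (r u) wr
    (trans (at-trunc j σ wr) (trans (cong (cut j) (at-inv (up wu))) (cut-≤ (proj₂ wu)))))
    where
    wr : Within j (r u)
    wr = proj₁ (inv-within (up wu)) , p

  at≡⇒inv≡ : ∀ {i x} → Within m i → s i ≡ x → i ≡ r x
  at≡⇒inv≡ wi refl = sym (inv-at wi)

  -- An open end maps beyond j, hence to k or further; k is excluded, being its own image.
  psnest-fixed : s k ≡ k → psnest m σ k ≡ height j w
  psnest-fixed fix = trans (countB-range m _) (trans (∑-prefix _ j≤m beyond) (∑-cong j pointwise))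
    where
    beyond : ∀ i → j < i → i ≤ m → 𝟙 ((i <ᵇ k) ∧ (k <ᵇ s i)) ≡ 0
    beyond i j<i _ = cong (λ b → 𝟙 (b ∧ (k <ᵇ s i))) (<ᵇ-false j<i)
    pointwise : ∀ i → Within j i → 𝟙 ((i <ᵇ k) ∧ (k <ᵇ s i)) ≡ 𝟙 (at w i ≡ᵇ 0)
    pointwise i wi = cong 𝟙 (T-ext (λ t → open⁺ wi (<-trans (n<1+n j) (<ᵇ⇒< k (s i) (proj₂ (T-∧⁻ (i <ᵇ k) _ t)))))
      (λ t → T-∧⁺ (<⇒<ᵇ (s≤s (proj₂ wi))) (<⇒<ᵇ (≤∧≢⇒< (open⁻ wi t)
        (λ e → j≱k (subst (_≤ j) (injective (up wi) k-within (trans (sym e) (sym fix))) (proj₂ wi)))))))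

  -- An open end crosses or nests with k according to whether its image precedes or follows σ(k).
  -- The trace does not tell which, but the two cases exhaust the open ends: none of them maps to k,
  -- as k has a later preimage.
  ucross+unest-valley : k < s k → k < r k → ucross m σ k + unest m σ k ≡ height j w
  ucross+unest-valley k<s k<r = trans (cong₂ _+_ ucross≡ unest≡) (trans (sym (∑-+ j _ _)) (∑-cong j pointwise))
    where
    avoid : ∀ {i} → Within j i → k ≢ s i
    avoid wi e = <⇒≱ k<r (subst (_≤ k) (at≡⇒inv≡ (up wi) (sym e)) (m≤n⇒m≤1+n (proj₂ wi)))
    later : ∀ {i} → Within j i → T (at w i ≡ᵇ 0) → k < s i
    later wi t = ≤∧≢⇒< (open⁻ wi t) (avoid wi)
    Q₁ Q₂ : ℕ → Bool
    Q₁ i = (at w i ≡ᵇ 0) ∧ (s i <ᵇ s k)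
    Q₂ i = (at w i ≡ᵇ 0) ∧ (s k <ᵇ s i)
    ucross≡ : ucross m σ k ≡ ∑ j (𝟙 ∘ Q₁)
    ucross≡ = trans (count3-∑ m _) (∑-determined j≤m _ Q₁ s (λ _ → s k) (λ i wi → into (up wi) , into k-within) only attained)
      where
      only : ∀ i x y → Within m i → Within m x → Within m y →
             T ((i <ᵇ k) ∧ (k <ᵇ x) ∧ (x <ᵇ y) ∧ (x ≡ᵇ s i) ∧ (y ≡ᵇ s k)) → Within j i × x ≡ s i × y ≡ s k × T (Q₁ i)
      only i x y wi _ _ t with chain⁻ i k x y x (s i) y (s k) t
      ... | i<k , k<x , x<y , refl , refl = w′ , refl , refl , T-∧⁺ (open⁺ w′ (<-trans (n<1+n j) k<x)) (<⇒<ᵇ x<y)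
        where
        w′ : Within j i
        w′ = proj₁ wi , ≤-pred i<k
      attained : ∀ i → Within j i → T (Q₁ i) → T ((i <ᵇ k) ∧ (k <ᵇ s i) ∧ (s i <ᵇ s k) ∧ (s i ≡ᵇ s i) ∧ (s k ≡ᵇ s k))
      attained i wi t with T-∧⁻ (at w i ≡ᵇ 0) _ t
      ... | o , lt = chain⁺ i k (s i) (s k) (s i) (s i) (s k) (s k) (s≤s (proj₂ wi)) (later wi o) (<ᵇ⇒< (s i) (s k) lt) refl refl
    unest≡ : unest m σ k ≡ ∑ j (𝟙 ∘ Q₂)
    unest≡ = trans (count3-∑ m _) (∑-determined j≤m _ Q₂ (λ _ → s k) s (λ i wi → into k-within , into (up wi)) only attained)
      where
      only : ∀ i x y → Within m i → Within m x → Within m y →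
             T ((i <ᵇ k) ∧ (k <ᵇ x) ∧ (x <ᵇ y) ∧ (x ≡ᵇ s k) ∧ (y ≡ᵇ s i)) → Within j i × x ≡ s k × y ≡ s i × T (Q₂ i)
      only i x y wi _ _ t with chain⁻ i k x y x (s k) y (s i) t
      ... | i<k , k<x , x<y , refl , refl = w′ , refl , refl , T-∧⁺ (open⁺ w′ (<-trans (n<1+n j) (<-trans k<x x<y))) (<⇒<ᵇ x<y)
        where
        w′ : Within j i
        w′ = proj₁ wi , ≤-pred i<k
      attained : ∀ i → Within j i → T (Q₂ i) → T ((i <ᵇ k) ∧ (k <ᵇ s k) ∧ (s k <ᵇ s i) ∧ (s k ≡ᵇ s k) ∧ (s i ≡ᵇ s i))
      attained i wi t with T-∧⁻ (at w i ≡ᵇ 0) _ t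
      ... | o , lt = chain⁺ i k (s k) (s i) (s k) (s k) (s i) (s i) (s≤s (proj₂ wi)) k<s (<ᵇ⇒< (s k) (s i) lt) refl refl
    pointwise : ∀ i → Within j i → 𝟙 (Q₁ i) + 𝟙 (Q₂ i) ≡ 𝟙 (at w i ≡ᵇ 0)
    pointwise i wi with at w i ≡ᵇ 0
    ... | false = refl
    ... | true with <-cmp (s i) (s k)
    ...   | tri< lt _ _ = cong₂ (λ b c → 𝟙 b + 𝟙 c) (<ᵇ-true lt) (<ᵇ-false (<⇒≤ lt))
    ...   | tri> _ _ gt = cong₂ (λ b c → 𝟙 b + 𝟙 c) (<ᵇ-false (<⇒≤ gt)) (<ᵇ-true gt)
    ...   | tri≈ _ e _  = ⊥-elim (j≱k (subst (_≤ j) (injective (up wi) k-within e) (proj₂ wi)))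

  module _ (s<k : s k < k) where
    private
      v : ℕ
      v = s k
      -- Being free in the trace only puts the preimage beyond j; it is not k, whose image is `v`.
      free-later : ∀ {u} → Within j u → u ≢ v → T (free j (at w) u) → k < r u
      free-later wu u≢v f = ≤∧≢⇒< (free-trunc⁻ wu f) (λ e → u≢v (trans (sym (at-inv (up wu))) (cong s (sym e))))

    -- The second arc of a crossing runs from some l > k to a value u with v < u < k: such u are
    -- exactly the free starts above `v`. For nestings they are the free starts below `v`.
    lcross≡above : lcross m σ k ≡ above (ins j w) v
    lcross≡above = trans (trans (count3-∑′ m _)
      (∑-determined j≤m (λ u i l → (i <ᵇ u) ∧ (u <ᵇ k) ∧ (k <ᵇ l) ∧ (i ≡ᵇ v) ∧ (u ≡ᵇ s l)) Q (λ _ → v) r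
        (λ u wu → into k-within , inv-within (up wu)) only attained))
      (sym (countB-filterᵇ-range j _ _))
      where
      Q : ℕ → Bool
      Q u = free j (at w) u ∧ (v <ᵇ u)
      only : ∀ u i l → Within m u → Within m i → Within m l →
             T ((i <ᵇ u) ∧ (u <ᵇ k) ∧ (k <ᵇ l) ∧ (i ≡ᵇ v) ∧ (u ≡ᵇ s l)) → Within j u × i ≡ v × l ≡ r u × T (Q u)
      only u i l wu _ wl t with chain⁻ i u k l i v u (s l) t
      ... | i<u , u<k , k<l , refl , refl = w′ , refl , sym (inv-at wl) ,
        T-∧⁺ (free-trunc⁺ w′ (subst (j <_) (sym (inv-at wl)) (<-trans (n<1+n j) k<l))) (<⇒<ᵇ i<u)
        where
        w′ : Within j u
        w′ = proj₁ wu , ≤-pred u<k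
      attained : ∀ u → Within j u → T (Q u) → T ((v <ᵇ u) ∧ (u <ᵇ k) ∧ (k <ᵇ r u) ∧ (v ≡ᵇ v) ∧ (u ≡ᵇ s (r u)))
      attained u wu t with T-∧⁻ (free j (at w) u) _ t
      ... | f , lt = chain⁺ v u k (r u) v v u (s (r u)) v<u (s≤s (proj₂ wu)) (free-later wu (λ e → <-irrefl (sym e) v<u) f) refl (sym (at-inv (up wu)))
        where
        v<u : v < u
        v<u = <ᵇ⇒< v u lt

    lnest≡below : lnest m σ k ≡ below (ins j w) v
    lnest≡below = trans (trans (count3-∑ m _)
      (∑-determined j≤m (λ u i l → (u <ᵇ i) ∧ (i <ᵇ k) ∧ (k <ᵇ l) ∧ (u ≡ᵇ s l) ∧ (i ≡ᵇ v)) Q (λ _ → v) r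
        (λ u wu → into k-within , inv-within (up wu)) only attained))
      (sym (countB-filterᵇ-range j _ _))
      where
      Q : ℕ → Bool
      Q u = free j (at w) u ∧ (u <ᵇ v)
      only : ∀ u i l → Within m u → Within m i → Within m l →
             T ((u <ᵇ i) ∧ (i <ᵇ k) ∧ (k <ᵇ l) ∧ (u ≡ᵇ s l) ∧ (i ≡ᵇ v)) → Within j u × i ≡ v × l ≡ r u × T (Q u)
      only u i l wu _ wl t with chain⁻ u i k l u (s l) i v t
      ... | u<i , i<k , k<l , refl , refl = w′ , refl , sym (inv-at wl) ,
        T-∧⁺ (free-trunc⁺ w′ (subst (j <_) (sym (inv-at wl)) (<-trans (n<1+n j) k<l))) (<⇒<ᵇ u<i)
        where
        w′ : Within j u
        w′ = proj₁ wu , ≤-pred (<-trans u<i i<k)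
      attained : ∀ u → Within j u → T (Q u) → T ((u <ᵇ v) ∧ (v <ᵇ k) ∧ (k <ᵇ r u) ∧ (u ≡ᵇ s (r u)) ∧ (v ≡ᵇ v))
      attained u wu t with T-∧⁻ (free j (at w) u) _ t
      ... | f , lt = chain⁺ u v k (r u) u (s (r u)) v v u<v s<k (free-later wu (λ e → <-irrefl e u<v) f) (sym (at-inv (up wu))) refl
        where
        u<v : u < v
        u<v = <ᵇ⇒< u v lt

  module _ (r<k : r k < k) where
    private
      p : ℕ
      p = r k
      open-later : ∀ {i} → Within j i → i ≢ p → T (at w i ≡ᵇ 0) → k < s i
      open-later wi i≢p t = ≤∧≢⇒< (open⁻ wi t) (λ e → i≢p (at≡⇒inv≡ (up wi) (sym e)))

    -- The primed statistics look at k as an image, so the preimage `p` is ranked instead. The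
    -- second arc leaves an open end q and passes over k: q lies above `p` in a crossing and below
    -- it in a nesting.
    ucross′≡above : ucross' m σ k ≡ above (outs j w) p
    ucross′≡above = trans (trans (count3-∑′ m _)
      (∑-determined j≤m (λ q i l → (i <ᵇ q) ∧ (q <ᵇ k) ∧ (k <ᵇ l) ∧ (k ≡ᵇ s i) ∧ (l ≡ᵇ s q)) Q (λ _ → p) s
        (λ q wq → inv-within k-within , into (up wq)) only attained))
      (sym (countB-filterᵇ-range j _ _))
      where
      Q : ℕ → Bool
      Q q = (at w q ≡ᵇ 0) ∧ (p <ᵇ q)
      only : ∀ q i l → Within m q → Within m i → Within m l →
             T ((i <ᵇ q) ∧ (q <ᵇ k) ∧ (k <ᵇ l) ∧ (k ≡ᵇ s i) ∧ (l ≡ᵇ s q)) → Within j q × i ≡ p × l ≡ s q × T (Q q)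
      only q i l wq wi _ t with chain⁻ i q k l k (s i) l (s q) t
      ... | i<q , q<k , k<l , e , refl = w′ , i≡p , refl ,
        T-∧⁺ (open⁺ w′ (<-trans (n<1+n j) k<l)) (<⇒<ᵇ (subst (_< q) i≡p i<q))
        where
        w′ : Within j q
        w′ = proj₁ wq , ≤-pred q<k
        i≡p : i ≡ p
        i≡p = at≡⇒inv≡ wi (sym e)
      attained : ∀ q → Within j q → T (Q q) → T ((p <ᵇ q) ∧ (q <ᵇ k) ∧ (k <ᵇ s q) ∧ (k ≡ᵇ s p) ∧ (s q ≡ᵇ s q))
      attained q wq t with T-∧⁻ (at w q ≡ᵇ 0) _ t
      ... | o , lt = chain⁺ p q k (s q) k (s p) (s q) (s q) p<q (s≤s (proj₂ wq)) (open-later wq (λ e → <-irrefl (sym e) p<q) o) (sym (at-inv k-within)) refl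
        where
        p<q : p < q
        p<q = <ᵇ⇒< p q lt

    unest′≡below : unest' m σ k ≡ below (outs j w) p
    unest′≡below = trans (trans (count3-∑ m _)
      (∑-determined j≤m (λ q i l → (q <ᵇ i) ∧ (i <ᵇ k) ∧ (k <ᵇ l) ∧ (k ≡ᵇ s i) ∧ (l ≡ᵇ s q)) Q (λ _ → p) s
        (λ q wq → inv-within k-within , into (up wq)) only attained))
      (sym (countB-filterᵇ-range j _ _))
      where
      Q : ℕ → Bool
      Q q = (at w q ≡ᵇ 0) ∧ (q <ᵇ p)
      only : ∀ q i l → Within m q → Within m i → Within m l →
             T ((q <ᵇ i) ∧ (i <ᵇ k) ∧ (k <ᵇ l) ∧ (k ≡ᵇ s i) ∧ (l ≡ᵇ s q)) → Within j q × i ≡ p × l ≡ s q × T (Q q)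
      only q i l wq wi _ t with chain⁻ q i k l k (s i) l (s q) t
      ... | q<i , i<k , k<l , e , refl = w′ , i≡p , refl ,
        T-∧⁺ (open⁺ w′ (<-trans (n<1+n j) k<l)) (<⇒<ᵇ (subst (q <_) i≡p q<i))
        where
        w′ : Within j q
        w′ = proj₁ wq , ≤-pred (<-trans q<i i<k)
        i≡p : i ≡ p
        i≡p = at≡⇒inv≡ wi (sym e)
      attained : ∀ q → Within j q → T (Q q) → T ((q <ᵇ p) ∧ (p <ᵇ k) ∧ (k <ᵇ s q) ∧ (k ≡ᵇ s p) ∧ (s q ≡ᵇ s q))
      attained q wq t with T-∧⁻ (at w q ≡ᵇ 0) _ t
      ... | o , lt = chain⁺ q p k (s q) k (s p) (s q) (s q) q<p r<k (open-later wq (λ e → <-irrefl e q<p) o) (sym (at-inv k-within)) refl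
        where
        q<p : q < p
        q<p = <ᵇ⇒< q p lt

  data Kind : Set where
    valley : isEven k ≡ false → k < s k → k < r k → Kind
    drise  : isEven k ≡ false → k < s k → r k < k → Kind
    fixed  : s k ≡ k → Kind
    dfall  : isEven k ≡ true → s k < k → k < r k → Kind
    peak   : isEven k ≡ true → s k < k → r k < k → Kind

  inv≢ : s k ≢ k → r k ≢ k
  inv≢ s≢ e = s≢ (trans (cong s (sym e)) (at-inv k-within))

  kind : Kind
  kind with s k ≟ k
  ... | yes e = fixed e
  ... | no s≢ with isEven k in eq | <-cmp (r k) k
  ...   | _     | tri≈ _ e _ = ⊥-elim (inv≢ s≢ e)
  ...   | false | tri< lt _ _ = drise eq (≤∧≢⇒< (odd≤ k-within eq) (s≢ ∘ sym)) lt
  ...   | false | tri> _ _ gt = valley eq (≤∧≢⇒< (odd≤ k-within eq) (s≢ ∘ sym)) gt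
  ...   | true  | tri< lt _ _ = peak eq (≤∧≢⇒< (even≥ k-within eq) s≢) lt
  ...   | true  | tri> _ _ gt = dfall eq (≤∧≢⇒< (even≥ k-within eq) s≢) gt

  inv-fixed : s k ≡ k → r k ≡ k
  inv-fixed e = sym (at≡⇒inv≡ k-within e)

  source-< : r k < k → cut j (r k) ≡ r k
  source-< (s≤s p) = cut-≤ p

  source-≥ : k ≤ r k → cut j (r k) ≡ 0
  source-≥ = cut->

  target-≤ : s k ≤ k → cut k (s k) ≡ s k
  target-≤ = cut-≤

  target-> : k < s k → cut k (s k) ≡ 0
  target-> = cut->

  choice-fixed : s k ≡ k → choice m j σ ≡ (0 , k)
  choice-fixed e = cong₂ _,_ (source-≥ (≤-reflexive (sym (inv-fixed e)))) (trans (target-≤ (≤-reflexive e)) e)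

  source-open : r k < k → Within j (r k) × at w (r k) ≡ 0
  source-open r<k = wr , ≡ᵇ⇒≡ _ 0 (open⁺ wr (≤-reflexive (sym (at-inv k-within))))
    where
    wr : Within j (r k)
    wr = proj₁ (inv-within k-within) , ≤-pred r<k

  target-free : s k < k → Within j (s k) × T (free j (at w) (s k))
  target-free s<k = ws , free-trunc⁺ ws (≤-reflexive (sym (inv-at k-within)))
    where
    ws : Within j (s k)
    ws = proj₁ (into k-within) , ≤-pred s<k

  choice-option : Option j w (choice m j σ)
  choice-option with kind
  ... | fixed e rewrite choice-fixed e = fixed
  ... | valley o k<s k<r rewrite source-≥ (<⇒≤ k<r) | target-> k<s = valley o
  ... | drise o k<s r<k rewrite source-< r<k | target-> k<s = drise o (proj₁ (source-open r<k)) (proj₂ (source-open r<k))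
  ... | dfall e s<k k<r rewrite source-≥ (<⇒≤ k<r) | target-≤ (<⇒≤ s<k) = dfall e (proj₁ (target-free s<k)) (proj₂ (target-free s<k))
  ... | peak e s<k r<k rewrite source-< r<k | target-≤ (<⇒≤ s<k) =
    peak e (proj₁ (source-open r<k)) (proj₂ (source-open r<k)) (proj₁ (target-free s<k)) (proj₂ (target-free s<k))

  extend-choice : extend j w (choice m j σ) ≡ trunc k σ
  extend-choice = tab-cong k (λ i wi → pointwise i (initLast wi))
    where
    pointwise : ∀ i → InitLast j i → update k w (choice m j σ) i ≡ cut k (s i)
    pointwise i (last refl) = cong (λ b → if b then cut k (s k) else (if k ≡ᵇ cut j (r k) then k else at w k)) (≡ᵇ-true {k} refl)
    pointwise i (init wi) = trans
      (cong (λ b → if b then cut k (s k) else (if i ≡ᵇ cut j (r k) then k else at w i)) (≡ᵇ-false (λ e → j≱k (subst (_≤ j) e (proj₂ wi)))))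
      (hit-or-miss (s i ≟ k))
      where
      hit-or-miss : Dec (s i ≡ k) → (if i ≡ᵇ cut j (r k) then k else at w i) ≡ cut k (s i)
      hit-or-miss (yes e) = trans (cong (λ b → if b then k else at w i) (≡ᵇ-true i≡cut)) (sym (trans (cong (cut k) e) (cut-≤ ≤-refl)))
        where
        i≡cut : i ≡ cut j (r k)
        i≡cut = trans (sym (cut-≤ (proj₂ wi))) (cong (cut j) (at≡⇒inv≡ (up wi) e))
      hit-or-miss (no ne) = trans (cong (λ b → if b then k else at w i) (≡ᵇ-false i≢cut)) (trans (at-trunc j σ wi) (sym (cut-suc ne)))
        where
        i≢cut : i ≢ cut j (r k)
        i≢cut e with r k ≤? j
        ... | yes p = ne (trans (cong s (trans e (cut-≤ p))) (at-inv k-within))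
        ... | no ¬p = 0-∉ wi (trans e (cut-> (≰⇒> ¬p)))

  -- The longer trace remembers both data: the choice shows in where k occurs among [j] and in the
  -- last entry. Since `Option` makes p an open end, the entry overwritten by k was 0, so w₀ can be
  -- restored.
  extend-injective : ∀ {w₀ o} → State j w₀ → Option j w₀ o → trunc k σ ≡ extend j w₀ o → w ≡ w₀ × choice m j σ ≡ o
  extend-injective {w₀} {p , v} S o e =
    trans (tab-cong j (λ i wi → pointwise i wi (i ≟ p))) (tab-at w₀ (State.length≡ S)) , cong₂ _,_ source target
    where
    image : ∀ {i} → Within k i → cut k (s i) ≡ at (extend j w₀ (p , v)) i
    image {i} wi = trans (sym (at-trunc k σ wi)) (cong (λ x → at x i) e)
    hit : ∀ {i} → Within j i → i ≡ p → s i ≡ k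
    hit {i} wi q with s i ≤? k | trans (image (within-suc wi)) (at-extend-hit j w₀ p v wi q)
    ... | yes p≤ | c = trans (sym (cut-≤ p≤)) c
    ... | no ¬p  | c = ⊥-elim (1+n≢0 (trans (sym c) (cut-> (≰⇒> ¬p))))
    pointwise : ∀ i → Within j i → Dec (i ≡ p) → cut j (s i) ≡ at w₀ i
    pointwise i wi (yes q) with option-out o
    ... | inj₁ refl    = ⊥-elim (0-∉ wi q)
    ... | inj₂ (_ , z) = trans (cut-> (≤-reflexive (sym (hit wi q)))) (sym (trans (cong (at w₀) q) z))
    pointwise i wi (no ne) = trans (sym (cut-suc s≢k)) cut≡
      where
      cut≡ : cut k (s i) ≡ at w₀ i
      cut≡ = trans (image (within-suc wi)) (at-extend-miss j w₀ p v wi ne)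
      s≢k : s i ≢ k
      s≢k q = bound-last S wi (trans (sym cut≡) (trans (cong (cut k) q) (cut-≤ ≤-refl)))
    target : cut k (s k) ≡ v
    target = trans (image (within-last j)) (at-extend-last j w₀ p v)
    source : cut j (r k) ≡ p
    source with option-out o
    ... | inj₂ (wp , _) = trans (cong (cut j) (sym (at≡⇒inv≡ (up wp) (hit wp refl)))) (cut-≤ (proj₂ wp))
    ... | inj₁ refl with r k ≤? j
    ...   | no ¬p = cut-> (≰⇒> ¬p)
    ...   | yes p = ⊥-elim (bound-last S wr (trans (sym (at-extend-miss j w₀ 0 v wr (0-∉ wr)))
                      (trans (sym (image (within-suc wr))) (trans (cong (cut k) (at-inv k-within)) (cut-≤ ≤-refl)))))
      where
      wr : Within j (r k)
      wr = proj₁ (inv-within k-within) , p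

  cycleMax-fixed : s k ≡ k → T (isCycleMax m σ k)
  cycleMax-fixed e = isExtreme⁺ {λ x y → y ≤ᵇ x} {m} {σ} {k} (λ t → ≤⇒≤ᵇ (≤-reflexive (stay t)))
    where
    stay : ∀ t → iter σ t k ≡ k
    stay zero    = refl
    stay (suc t) = trans (cong s (stay t)) e

  cycleMax⁻ : T (isCycleMax m σ k) → ∀ t → iter σ t k ≤ k
  cycleMax⁻ t n = ≤ᵇ⇒≤ _ _ (isExtreme⁻ {λ x y → y ≤ᵇ x} k-within t n)

  ¬cycleMax-image : k < s k → ¬ T (isCycleMax m σ k)
  ¬cycleMax-image k<s t = <⇒≱ k<s (cycleMax⁻ t 1)

  ¬cycleMax-preimage : k < r k → ¬ T (isCycleMax m σ k)
  ¬cycleMax-preimage k<r t with iter-return (inv-within k-within) 1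
  ... | u , e = <⇒≱ k<r (subst (_≤ k) (trans (cong (iter σ u) (sym (at-inv k-within))) e) (cycleMax⁻ t u))

  -- If the path from σ(k) ends at σ⁻¹(k), the rest of the cycle of k lies in [j]. Conversely, if
  -- this cycle never exceeds k, the path from σ(k) can leave [j] only into k.
  reach≡cycleMax : State j w → s k < k → r k < k → reach j w (s k) (r k) ≡ isCycleMax m σ k
  reach≡cycleMax S s<k r<k = T-ext closes traverses
    where
    v : ℕ
    v = s k
    wv : Within j v
    wv = proj₁ (target-free s<k)
    iter-agree : ∀ t → iter w t v ≢ 0 → Within j (iter w t v) × iter σ t v ≡ iter w t v
    iter-agree zero    _  = wv , refl
    iter-agree (suc t) nz with iter-agree t (λ z → nz (trans (cong (at w) z) (at-zero w)))
    ... | wt , e = (n≢0⇒n>0 nz , State.bounded S wt) , trans (cong s e) (at-trunc-nonzero wt nz)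
    closes : T (reach j w v (r k)) → T (isCycleMax m σ k)
    closes q with reach⁻ {j} {w} q
    ... | t , e = isExtreme⁺ {λ x y → y ≤ᵇ x} {m} {σ} {k} (λ n → ≤⇒≤ᵇ (bounded (orbit n)))
      where
      live : ∀ {i} → i ≤ t → iter w i v ≢ 0
      live {i} i≤t z = 0-∉ (inv-within k-within) (trans (sym e) (iter-stays-zero w i t i≤t z))
      -- The position k and the path up to time t form a set closed under σ, which bounds the whole
      -- orbit by k.
      OnPath : ℕ → Set
      OnPath x = x ≡ k ⊎ (∃[ i ] i ≤ t × x ≡ iter w i v)
      bounded : ∀ {x} → OnPath x → x ≤ k
      bounded (inj₁ refl)           = ≤-refl
      bounded (inj₂ (i , i≤t , refl)) = m≤n⇒m≤1+n (proj₂ (proj₁ (iter-agree i (live i≤t))))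
      step : ∀ {x} → OnPath x → OnPath (s x)
      step (inj₁ refl) = inj₂ (0 , z≤n , refl)
      step (inj₂ (i , i≤t , refl)) with i ≟ t
      ... | yes refl = inj₁ (trans (cong s e) (at-inv k-within))
      ... | no  i≢t  = inj₂ (suc i , i<t , at-trunc-nonzero (proj₁ (iter-agree i (live i≤t))) (live i<t))
        where
        i<t : i < t
        i<t = ≤∧≢⇒< i≤t i≢t
      orbit : ∀ n → OnPath (iter σ n k)
      orbit zero    = inj₁ refl
      orbit (suc n) = step (orbit n)
    traverses : T (isCycleMax m σ k) → T (reach j w v (r k))
    traverses q with PathEnd.stops S wv (proj₂ (target-free s<k))
    ... | t , t<j , wt , z = reach⁺ {j} {w} t<j (at≡⇒inv≡ (up wt) s-end)
      where
      agree : iter σ t v ≡ iter w t v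
      agree = proj₂ (iter-agree t (0-∉ wt))
      -- The end is open in the trace, so its image is at least k; maximality of k gives the other
      -- inequality.
      s-end : s (iter w t v) ≡ k
      s-end = ≤-antisym
        (subst (_≤ k) (trans (iter-+ σ (suc t) 1 k) (cong s agree))
          (cycleMax⁻ q (suc t + 1)))
        (open⁻ wt (≡⇒≡ᵇ _ 0 z))

-- Weighted enumeration

range-sorted : ∀ m → AllPairs _<_ (range m)
range-sorted m = AllPairs.map⁺ (AllPairs.applyUpTo⁺₁ id m (λ i<j _ → s≤s i<j))

filterᵇ-sorted : ∀ (p : ℕ → Bool) {xs} → AllPairs _<_ xs → AllPairs _<_ (filterᵇ p xs)
filterᵇ-sorted p = AllPairs.filter⁺ (T? ∘ p)

countB-all : ∀ {ℓ} {A : Set ℓ} {xs : List A} {p : A → Bool} → All (T ∘ p) xs → countB xs p ≡ length xs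
countB-all []                          = refl
countB-all {xs = x ∷ _} {p} (px ∷ pxs) with p x
... | true = cong suc (countB-all pxs)

countB-none : ∀ {ℓ} {A : Set ℓ} {xs : List A} {p : A → Bool} → All (λ x → ¬ T (p x)) xs → countB xs p ≡ 0
countB-none []                          = refl
countB-none {xs = x ∷ _} {p} (px ∷ pxs) with p x
... | false = countB-none pxs
... | true  = ⊥-elim (px tt)

countB-cons-true : ∀ {ℓ} {A : Set ℓ} {x : A} {xs p} → T (p x) → countB (x ∷ xs) p ≡ suc (countB xs p)
countB-cons-true {x = x} {xs} {p} t with p x
... | true = refl

countB-cons-false : ∀ {ℓ} {A : Set ℓ} {x : A} {xs p} → ¬ T (p x) → countB (x ∷ xs) p ≡ countB xs p
countB-cons-false {x = x} {xs} {p} t with p x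
... | false = refl
... | true  = ⊥-elim (t tt)

if-true : ∀ {a} {A : Set a} {b} {x y : A} → b ≡ true → (if b then x else y) ≡ x
if-true refl = refl

if-false : ∀ {a} {A : Set a} {b} {x y : A} → b ≡ false → (if b then x else y) ≡ y
if-false refl = refl

-- Sums and products over lists in the ring

module ListSums {c ℓ : Level} (R : CommutativeRing c ℓ) where
  open CommutativeRing R renaming (Carrier to A; _+_ to _⊕_; _*_ to _⊛_; refl to ≈-refl; sym to ≈-sym; trans to ≈-trans; zero to ⊛-zero; reflexive to ≈-reflexive)
  open SetoidReasoning setoid
  open CommutativeSemiringSolver commutativeSemiring using (solve; _:+_; _:*_; _:=_; con)

  sumOver : ∀ {x} {X : Set x} → List X → (X → A) → A
  sumOver xs F = sumR R (map F xs)

  module _ {x} {X : Set x} where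

    sum-cong : ∀ (xs : List X) {F G} → (∀ y → y ∈ xs → F y ≈ G y) → sumOver xs F ≈ sumOver xs G
    sum-cong []       h = ≈-refl
    sum-cong (y ∷ xs) h = +-cong (h y (here refl)) (sum-cong xs (λ z → h z ∘ there))

    sum-zero : ∀ (xs : List X) {F} → (∀ y → y ∈ xs → F y ≈ 0#) → sumOver xs F ≈ 0#
    sum-zero []       h = ≈-refl
    sum-zero (y ∷ xs) h = ≈-trans (+-cong (h y (here refl)) (sum-zero xs (λ z → h z ∘ there))) (+-identityˡ 0#)

    sum-++ : ∀ (xs ys : List X) F → sumOver (xs ++ ys) F ≈ sumOver xs F ⊕ sumOver ys F
    sum-++ []       ys F = ≈-sym (+-identityˡ _)
    sum-++ (x ∷ xs) ys F = ≈-trans (+-cong ≈-refl (sum-++ xs ys F)) (≈-sym (+-assoc _ _ _))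

    sum-scaleʳ : ∀ (xs : List X) F z → sumOver xs (λ y → F y ⊛ z) ≈ sumOver xs F ⊛ z
    sum-scaleʳ []       F z = ≈-sym (zeroˡ z)
    sum-scaleʳ (y ∷ xs) F z = ≈-trans (+-cong ≈-refl (sum-scaleʳ xs F z)) (≈-sym (distribʳ z _ _))

    sum-scaleˡ : ∀ (xs : List X) F z → sumOver xs (λ y → z ⊛ F y) ≈ z ⊛ sumOver xs F
    sum-scaleˡ []       F z = ≈-sym (zeroʳ z)
    sum-scaleˡ (y ∷ xs) F z = ≈-trans (+-cong ≈-refl (sum-scaleˡ xs F z)) (≈-sym (distribˡ z _ _))

    sum-+ : ∀ (xs : List X) F G → sumOver xs (λ y → F y ⊕ G y) ≈ sumOver xs F ⊕ sumOver xs G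
    sum-+ []       F G = ≈-sym (+-identityˡ 0#)
    sum-+ (y ∷ xs) F G = ≈-trans (+-cong ≈-refl (sum-+ xs F G))
      (solve 4 (λ p q r s → (p :+ q) :+ (r :+ s) := (p :+ r) :+ (q :+ s)) ≈-refl (F y) (G y) _ _)

    sum-single : ∀ {xs : List X} {F} {y} → Unique xs → y ∈ xs → (∀ z → z ∈ xs → z ≢ y → F z ≈ 0#) → sumOver xs F ≈ F y
    sum-single {x ∷ xs} {F} (x∉ ∷ u) (here refl) h =
      ≈-trans (+-cong ≈-refl (sum-zero xs (λ z z∈ → h z (there z∈) (All.lookup x∉ z∈ ∘ sym)))) (+-identityʳ _)
    sum-single {x ∷ xs} {F} (x∉ ∷ u) (there y∈) h =
      ≈-trans (+-cong (h x (here refl) (All.lookup x∉ y∈)) (sum-single u y∈ (λ z → h z ∘ there))) (+-identityˡ _)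

    sum-ones : ∀ (xs : List X) {F} → (∀ y → y ∈ xs → F y ≈ 1#) → sumOver xs F ≈ nat R (length xs)
    sum-ones []       h = ≈-refl
    sum-ones (y ∷ xs) h = +-cong (h y (here refl)) (sum-ones xs (λ z → h z ∘ there))

    sum-one-marked : ∀ {xs : List X} {F y} z → Unique xs → y ∈ xs → F y ≈ z → (∀ x → x ∈ xs → x ≢ y → F x ≈ 1#) →
                     sumOver xs F ≈ z ⊕ nat R (length xs ∸ 1)
    sum-one-marked {x ∷ xs} z (x∉ ∷ u) (here refl) Fy h =
      +-cong Fy (sum-ones xs (λ y y∈ → h y (there y∈) (All.lookup x∉ y∈ ∘ sym)))
    -- Membership in the tail makes it nonempty, so `nat R (length xs)` gives off the unit for `x`.
    sum-one-marked {x ∷ xs@(_ ∷ _)} z (x∉ ∷ u) (there y∈) Fy h =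
      ≈-trans (+-cong (h x (here refl) (All.lookup x∉ y∈)) (sum-one-marked z u y∈ Fy (λ y → h y ∘ there)))
              (solve 3 (λ o z n → o :+ (z :+ n) := z :+ (o :+ n)) ≈-refl 1# z _)

  sum-swap : ∀ {x y} {X : Set x} {Y : Set y} (xs : List X) (ys : List Y) (F : X → Y → A) →
             sumOver xs (λ p → sumOver ys (F p)) ≈ sumOver ys (λ q → sumOver xs (λ p → F p q))
  sum-swap []       ys F = ≈-sym (sum-zero ys (λ _ _ → ≈-refl))
  sum-swap (p ∷ xs) ys F = ≈-trans (+-cong ≈-refl (sum-swap xs ys F)) (≈-sym (sum-+ ys (F p) _))

  sum-map : ∀ {x y} {X : Set x} {Y : Set y} (h : X → Y) xs F → sumOver (map h xs) F ≈ sumOver xs (F ∘ h)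
  sum-map h xs F = ≈-reflexive (cong (sumR R) (sym (map-∘ xs)))

  sum-cartesianProductWith : ∀ {x y z} {X : Set x} {Y : Set y} {Z : Set z} (h : X → Y → Z) xs ys F →
    sumOver (cartesianProductWith h xs ys) F ≈ sumOver xs (λ p → sumOver ys (λ q → F (h p q)))
  sum-cartesianProductWith h []       ys F = ≈-refl
  sum-cartesianProductWith h (p ∷ xs) ys F =
    ≈-trans (sum-++ (map (h p) ys) _ F) (+-cong (sum-map (h p) ys F) (sum-cartesianProductWith h xs ys F))

  -- In a strictly sorted list the entry with ξ entries below it has all the others above it.
  -- Removing the least entry lowers every remaining `below` by one and leaves `above` unchanged,
  -- whence the shifted `G` in the induction.
  sum-ranks : ∀ {xs} → AllPairs _<_ xs → (G : ℕ → ℕ → A) →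
              sumOver xs (λ x → G (above xs x) (below xs x)) ≈ sumUpTo R (length xs) (λ ξ → G (length xs ∸ 1 ∸ ξ) ξ)
  sum-ranks {[]}     _          G = ≈-refl
  sum-ranks {x ∷ xs} (x< ∷ srt) G = +-cong (≈-reflexive first) (begin
    sumOver xs (λ y → G (above (x ∷ xs) y) (below (x ∷ xs) y))          ≈⟨ sum-cong xs (λ y y∈ → ≈-reflexive (later y∈)) ⟩
    sumOver xs (λ y → G (above xs y) (suc (below xs y)))                ≈⟨ sum-ranks srt (λ p q → G p (suc q)) ⟩
    sumOver (upTo (length xs)) (λ ξ → G (length xs ∸ 1 ∸ ξ) (suc ξ))    ≈⟨ sum-cong (upTo (length xs)) (λ ξ _ → ≈-reflexive (cong (λ n → G n (suc ξ)) (∸-+-assoc (length xs) 1 ξ))) ⟩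
    sumOver (upTo (length xs)) (λ ξ → G (length xs ∸ suc ξ) (suc ξ))    ≈⟨ ≈-reflexive (cong (sumR R) (trans (map-upTo _ (length xs)) (sym (map-applyUpTo suc (λ ξ → G (length xs ∸ ξ) ξ) (length xs))))) ⟩
    sumOver (applyUpTo suc (length xs)) (λ ξ → G (length xs ∸ ξ) ξ) ∎)
    where
    first : G (above (x ∷ xs) x) (below (x ∷ xs) x) ≡ G (length xs) 0
    first = cong₂ G
      (trans (countB-cons-false {x = x} {xs} {x <ᵇ_} (λ t → <-irrefl refl (<ᵇ⇒< x x t))) (countB-all (All.map <⇒<ᵇ x<)))
      (trans (countB-cons-false {x = x} {xs} {_<ᵇ x} (λ t → <-irrefl refl (<ᵇ⇒< x x t))) (countB-none (All.map (λ {y} x<y t → <-asym x<y (<ᵇ⇒< y x t)) x<)))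
    later : ∀ {y} → y ∈ xs → G (above (x ∷ xs) y) (below (x ∷ xs) y) ≡ G (above xs y) (suc (below xs y))
    later {y} y∈ = cong₂ G
      (countB-cons-false {x = x} {xs} {y <ᵇ_} (λ t → <-asym x<y (<ᵇ⇒< y x t)))
      (countB-cons-true {x = x} {xs} {_<ᵇ y} (<⇒<ᵇ x<y))
      where
      x<y : x < y
      x<y = All.lookup x< y∈

  -- The offset lets the product be consumed one position at a time, in step with the growing trace.
  prodFrom : ℕ → ℕ → (ℕ → A) → A
  prodFrom j zero    F = 1#
  prodFrom j (suc r) F = F (suc j) ⊛ prodFrom (suc j) r F

  prodR-applyUpTo : ∀ r j F → prodR R (applyUpTo (λ i → F (suc (i + j))) r) ≈ prodFrom j r F
  prodR-applyUpTo zero    j F = ≈-refl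
  prodR-applyUpTo (suc r) j F = *-congˡ (≈-trans
    (≈-reflexive (cong (prodR R) (applyUpTo-cong r (λ i _ → cong (F ∘ suc) (sym (+-suc i j))))))
    (prodR-applyUpTo r (suc j) F))

  prodR-range : ∀ m F → prodR R (map F (range m)) ≈ prodFrom 0 m F
  prodR-range m F = ≈-trans
    (≈-reflexive (cong (prodR R) (trans (sym (map-∘ (upTo m))) (trans (map-upTo (F ∘ suc) m)
      (applyUpTo-cong m (λ i _ → cong (F ∘ suc) (sym (ℕ.+-identityʳ i))))))))
    (prodR-applyUpTo m 0 F)

  -- Turns the global power of λ into local factors, one at each cycle maximum.
  pow-countB : ∀ lam (p : ℕ → Bool) (F : ℕ → A) xs →
    pow R lam (countB xs p) ⊛ prodR R (map F xs) ≈ prodR R (map (λ x → (if p x then lam else 1#) ⊛ F x) xs)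
  pow-countB lam p F []       = *-identityˡ 1#
  pow-countB lam p F (x ∷ xs) with p x
  ... | true  = ≈-trans (solve 4 (λ l q y z → (l :* q) :* (y :* z) := (l :* y) :* (q :* z)) ≈-refl lam _ (F x) _)
                        (*-congˡ (pow-countB lam p F xs))
  ... | false = ≈-trans (solve 4 (λ o q y z → q :* (y :* z) := y :* (q :* z)) ≈-refl 1# _ (F x) _)
                        (*-cong (≈-sym (*-identityˡ (F x))) (pow-countB lam p F xs))

double-2* : ∀ n → double n ≡ 2 * n
double-2* zero    = refl
double-2* (suc n) = trans (cong (suc ∘ suc) (double-2* n)) (cong suc (sym (+-suc n (n + 0))))

full-state : ∀ {m w} → State m w → height m w ≡ 0 → DPermutation m w
full-state {m} {w} S h≡0 = record
  { length≡   = length≡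
  ; into      = λ wi → n≢0⇒n>0 (nonzero wi) , bounded wi
  ; injective = λ wi wi′ → injective wi wi′ (nonzero wi)
  ; odd≤      = λ wi e → [ ⊥-elim ∘ nonzero wi , id ]′ (odd≤ wi e)
  ; even≥     = λ wi e → proj₂ (even≥ wi e)
  }
  where
  open State S
  nonzero : ∀ {i} → Within m i → at w i ≢ 0
  nonzero wi z = ∑-𝟙-≡0 m (λ p → at w p ≡ᵇ 0) h≡0 _ wi (≡⇒≡ᵇ _ 0 z)

full-height : ∀ {m w} → DPermutation m w → height m w ≡ 0
full-height {m} {w} D = ∑-𝟙-none m (λ p wp t → 0-∉ (DPermutation.into D wp) (≡ᵇ⇒≡ _ 0 t))

trunc-full : ∀ {m σ} → DPermutation m σ → trunc m σ ≡ σ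
trunc-full {m} {σ} D = trans (tab-cong m (λ i wi → cut-≤ (proj₂ (DPermutation.into D wi)))) (tab-at σ (DPermutation.length≡ D))

empty-state : State 0 []
empty-state = record
  { length≡ = refl
  ; partial = record { bounded = λ { (l , u) → ⊥-elim (<⇒≱ l u) } ; injective = λ { (l , u) → ⊥-elim (<⇒≱ l u) } }
  ; odd≤    = λ { (l , u) → ⊥-elim (<⇒≱ l u) }
  ; even≥   = λ { (l , u) → ⊥-elim (<⇒≱ l u) }
  }

-- The weight of a single choice

module OptionWeights {c ℓ : Level} (R : CommutativeRing c ℓ)
  (lam : CommutativeRing.Carrier R) (a : ℕ → CommutativeRing.Carrier R)
  (b cc d : ℕ → ℕ → CommutativeRing.Carrier R) (e f : ℕ → CommutativeRing.Carrier R) where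
  open CommutativeRing R renaming (Carrier to A; _+_ to _⊕_; _*_ to _⊛_; refl to ≈-refl; sym to ≈-sym; trans to ≈-trans; zero to ⊛-zero; reflexive to ≈-reflexive)
  open SetoidReasoning setoid
  open CommutativeSemiringSolver commutativeSemiring using (solve; _:+_; _:*_; _:=_; con)
  open ListSums R

  -- The local factor of `weightQ` under a name of its own; the two agree by unfolding.
  factor : ℕ → List ℕ → ℕ → A
  factor m σ i =
    if at σ i ≡ᵇ i then
      (if isEven i then e (psnest m σ i) else f (psnest m σ i))
    else if (i <ᵇ inv m σ i) ∧ (i <ᵇ at σ i) then
      a (ucross m σ i + unest m σ i)
    else if (inv m σ i <ᵇ i) ∧ (at σ i <ᵇ i) then
      b (lcross m σ i) (lnest m σ i)
    else if (i <ᵇ inv m σ i) ∧ (at σ i <ᵇ i) then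
      cc (lcross m σ i) (lnest m σ i)
    else
      d (ucross' m σ i) (unest' m σ i)

  cycleFactor : ℕ → List ℕ → ℕ → A
  cycleFactor m σ i = (if isCycleMax m σ i then lam else 1#) ⊛ factor m σ i

  weightQ≈prodFrom : ∀ {m σ} → DPermutation m σ → weightQ R lam a b cc d e f m σ ≈ prodFrom 0 m (cycleFactor m σ)
  weightQ≈prodFrom {m} {σ} D = begin
    pow R lam (cyc m σ) ⊛ prodR R (map (factor m σ) (range m))
      ≈⟨ *-congʳ (≈-reflexive (cong (pow R lam) (trans (Orbits.cyc≡maxima D) (sym (countB-range m (isCycleMax m σ)))))) ⟩
    pow R lam (countB (range m) (isCycleMax m σ)) ⊛ prodR R (map (factor m σ) (range m))
      ≈⟨ pow-countB lam (isCycleMax m σ) (factor m σ) (range m) ⟩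
    prodR R (map (cycleFactor m σ) (range m))
      ≈⟨ prodR-range m (cycleFactor m σ) ⟩
    prodFrom 0 m (cycleFactor m σ) ∎

  -- Depends on the trace and the option alone. Parity only separates `e` from `f`; the other kinds
  -- are told apart by which components vanish, and `reach` decides whether a peak closes a cycle.
  optionWeight : ℕ → List ℕ → ℕ × ℕ → A
  optionWeight j w (p , v) =
    if v ≡ᵇ suc j then lam ⊛ (if isEven (suc j) then e (height j w) else f (height j w))
    else if p ≡ᵇ 0 then
      (if v ≡ᵇ 0 then a (height j w) else cc (above (ins j w) v) (below (ins j w) v))
    else
      (if v ≡ᵇ 0 then d (above (outs j w) p) (below (outs j w) p)
       else (if reach j w v p then lam else 1#) ⊛ b (above (ins j w) v) (below (ins j w) v))

  -- With the values of the tests as variables it holds by `refl`, and each kind of option is an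
  -- instance.
  optionWeight-cases : ∀ j w p v {t₀ t₁ t₂} → (v ≡ᵇ suc j) ≡ t₀ → (p ≡ᵇ 0) ≡ t₁ → (v ≡ᵇ 0) ≡ t₂ → optionWeight j w (p , v) ≡
    (if t₀ then lam ⊛ (if isEven (suc j) then e (height j w) else f (height j w))
     else if t₁ then
       (if t₂ then a (height j w) else cc (above (ins j w) v) (below (ins j w) v))
     else
       (if t₂ then d (above (outs j w) p) (below (outs j w) p)
        else (if reach j w v p then lam else 1#) ⊛ b (above (ins j w) v) (below (ins j w) v)))
  optionWeight-cases j w p v refl refl refl = refl

  weight-fixed : ∀ j w → optionWeight j w (0 , suc j) ≡ lam ⊛ (if isEven (suc j) then e (height j w) else f (height j w))
  weight-fixed j w = optionWeight-cases j w 0 (suc j) (≡ᵇ-true {suc j} refl) refl refl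

  weight-dfall : ∀ {j w v} → Within j v → optionWeight j w (0 , v) ≡ cc (above (ins j w) v) (below (ins j w) v)
  weight-dfall {j} {w} {v} wv = optionWeight-cases j w 0 v (≡ᵇ-false (<⇒≢ (s≤s (proj₂ wv)))) refl (≡ᵇ-false (0-∉ wv))

  weight-drise : ∀ {j w p} → Within j p → optionWeight j w (p , 0) ≡ d (above (outs j w) p) (below (outs j w) p)
  weight-drise {j} {w} {p} wp = optionWeight-cases j w p 0 refl (≡ᵇ-false (0-∉ wp)) refl

  weight-peak : ∀ {j w p v} → Within j p → Within j v →
    optionWeight j w (p , v) ≡ (if reach j w v p then lam else 1#) ⊛ b (above (ins j w) v) (below (ins j w) v)
  weight-peak {j} {w} {p} {v} wp wv = optionWeight-cases j w p v (≡ᵇ-false (<⇒≢ (s≤s (proj₂ wv)))) (≡ᵇ-false (0-∉ wp)) (≡ᵇ-false (0-∉ wv))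

  factor-cases : ∀ {m σ i t₀ t₁ t₂ t₃ t₄} → (at σ i ≡ᵇ i) ≡ t₀ → (i <ᵇ inv m σ i) ≡ t₁ → (i <ᵇ at σ i) ≡ t₂ →
    (inv m σ i <ᵇ i) ≡ t₃ → (at σ i <ᵇ i) ≡ t₄ → factor m σ i ≡
    (if t₀ then (if isEven i then e (psnest m σ i) else f (psnest m σ i))
     else if t₁ ∧ t₂ then a (ucross m σ i + unest m σ i)
     else if t₃ ∧ t₄ then b (lcross m σ i) (lnest m σ i)
     else if t₁ ∧ t₄ then cc (lcross m σ i) (lnest m σ i)
     else d (ucross' m σ i) (unest' m σ i))
  factor-cases refl refl refl refl refl = refl

  -- The passage from σ to its trace. A fixed point is always a cycle maximum; valleys and rises
  -- have a larger image and falls a larger preimage, so they never are. For a peak `reach≡cycleMax`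
  -- decides.
  cycleFactor≈weight : ∀ {m σ} (D : DPermutation m σ) {j} (j<m : j < m) → State j (trunc j σ) →
    cycleFactor m σ (suc j) ≈ optionWeight j (trunc j σ) (choice m j σ)
  cycleFactor≈weight {m} {σ} D {j} j<m S = by-kind kind
    where
    open Scan D j j<m
    k : ℕ
    k = suc j
    w : List ℕ
    w = trunc j σ
    unmarked : ∀ {F} → ¬ T (isCycleMax m σ k) → factor m σ k ≡ F → cycleFactor m σ k ≈ F
    unmarked {F} n q = begin
      (if isCycleMax m σ k then lam else 1#) ⊛ factor m σ k
        ≈⟨ ≈-reflexive (cong₂ (λ t x → (if t then lam else 1#) ⊛ x) (¬T⇒≡false n) q) ⟩
      1# ⊛ F  ≈⟨ *-identityˡ F ⟩
      F ∎
    by-kind : Kind → cycleFactor m σ k ≈ optionWeight j w (choice m j σ)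
    by-kind (fixed q) = begin
      (if isCycleMax m σ k then lam else 1#) ⊛ factor m σ k
        ≡⟨ cong₂ (λ t x → (if t then lam else 1#) ⊛ x) (T⇒≡true (cycleMax-fixed q)) (factor-cases {m} {σ} (≡ᵇ-true q) refl refl refl refl) ⟩
      lam ⊛ (if isEven k then e (psnest m σ k) else f (psnest m σ k))
        ≡⟨ cong (λ h → lam ⊛ (if isEven k then e h else f h)) (psnest-fixed q) ⟩
      lam ⊛ (if isEven k then e (height j w) else f (height j w))
        ≡⟨ sym (weight-fixed j w) ⟩
      optionWeight j w (0 , k)
        ≡⟨ cong (optionWeight j w) (sym (choice-fixed q)) ⟩
      optionWeight j w (choice m j σ) ∎
    by-kind (valley _ k<s k<r) = ≈-trans
      (unmarked (¬cycleMax-image k<s)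
        (trans (factor-cases {m} {σ} (≡ᵇ-false (>⇒≢ k<s)) (<ᵇ-true k<r) (<ᵇ-true k<s) refl refl)
               (cong a (ucross+unest-valley k<s k<r))))
      (≈-reflexive (sym (cong (optionWeight j w) (cong₂ _,_ (source-≥ (<⇒≤ k<r)) (target-> k<s)))))
    by-kind (drise _ k<s r<k) = ≈-trans
      (unmarked (¬cycleMax-image k<s)
        (trans (factor-cases {m} {σ} (≡ᵇ-false (>⇒≢ k<s)) (<ᵇ-false (<⇒≤ r<k)) (<ᵇ-true k<s) (<ᵇ-true r<k) (<ᵇ-false (<⇒≤ k<s)))
               (cong₂ d (ucross′≡above r<k) (unest′≡below r<k))))
      (≈-reflexive (sym (trans (cong (optionWeight j w) (cong₂ _,_ (source-< r<k) (target-> k<s))) (weight-drise {j} {w} (proj₁ (source-open r<k))))))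
    by-kind (dfall _ s<k k<r) = ≈-trans
      (unmarked (¬cycleMax-preimage k<r)
        (trans (factor-cases {m} {σ} (≡ᵇ-false (<⇒≢ s<k)) (<ᵇ-true k<r) (<ᵇ-false (<⇒≤ s<k)) (<ᵇ-false (<⇒≤ k<r)) (<ᵇ-true s<k))
               (cong₂ cc (lcross≡above s<k) (lnest≡below s<k))))
      (≈-reflexive (sym (trans (cong (optionWeight j w) (cong₂ _,_ (source-≥ (<⇒≤ k<r)) (target-≤ (<⇒≤ s<k)))) (weight-dfall {j} {w} (proj₁ (target-free s<k))))))
    by-kind (peak _ s<k r<k) = ≈-trans
      (≈-reflexive (cong₂ (λ t x → (if t then lam else 1#) ⊛ x) (sym (reach≡cycleMax S s<k r<k))
        (trans (factor-cases {m} {σ} (≡ᵇ-false (<⇒≢ s<k)) (<ᵇ-false (<⇒≤ r<k)) (<ᵇ-false (<⇒≤ s<k)) (<ᵇ-true r<k) (<ᵇ-true s<k))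
               (cong₂ b (lcross≡above s<k) (lnest≡below s<k)))))
      (≈-reflexive (sym (trans (cong (optionWeight j w) (cong₂ _,_ (source-< r<k) (target-≤ (<⇒≤ s<k))))
        (weight-peak {j} {w} (proj₁ (source-open r<k)) (proj₁ (target-free s<k))))))

-- Summation over the permutations with a given trace

module Enumeration {c ℓ : Level} (R : CommutativeRing c ℓ)
  (lam : CommutativeRing.Carrier R) (a : ℕ → CommutativeRing.Carrier R)
  (b cc d : ℕ → ℕ → CommutativeRing.Carrier R) (e f : ℕ → CommutativeRing.Carrier R) where
  open CommutativeRing R renaming (Carrier to A; _+_ to _⊕_; _*_ to _⊛_; refl to ≈-refl; sym to ≈-sym; trans to ≈-trans; zero to ⊛-zero; reflexive to ≈-reflexive)
  open SetoidReasoning setoid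
  open CommutativeSemiringSolver commutativeSemiring using (solve; _:+_; _:*_; _:=_; con)
  open ListSums R
  open PowerSeries R
  open OptionWeights R lam a b cc d e f

  matches : List ℕ → List ℕ → A
  matches u w = if does (≡-dec _≟_ u w) then 1# else 0#

  matches-≡ : ∀ {u w} → u ≡ w → matches u w ≡ 1#
  matches-≡ {u} {w} q = cong (λ t → if t then 1# else 0#) (dec-true (≡-dec _≟_ u w) q)

  matches-≢ : ∀ {u w} → u ≢ w → matches u w ≡ 0#
  matches-≢ {u} {w} q = cong (λ t → if t then 1# else 0#) (dec-false (≡-dec _≟_ u w) q)

  height-level-fixed : ∀ j w → height (suc j) (extend j w (0 , suc j)) ≡ height j w
  height-level-fixed j w = height-level j w 1+n≢0

  dRiseSum dFallSum peakSum : ℕ → A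
  dRiseSum h = lam ⊛ f h ⊕ sumUpTo R h (λ ξ → d (h ∸ 1 ∸ ξ) ξ)
  dFallSum h = lam ⊛ e h ⊕ sumUpTo R h (λ ξ → cc (h ∸ 1 ∸ ξ) ξ)
  peakSum  h = (lam ⊕ nat R (h ∸ 1)) ⊛ sumUpTo R h (λ ξ → b (h ∸ 1 ∸ ξ) ξ)

  open Walks a dRiseSum dFallSum peakSum

  sum-outs : ∀ j w (G : ℕ → ℕ → A) →
    sumOver (outs j w) (λ p → G (above (outs j w) p) (below (outs j w) p)) ≈ sumUpTo R (height j w) (λ ξ → G (height j w ∸ 1 ∸ ξ) ξ)
  sum-outs j w G = ≈-trans (sum-ranks (filterᵇ-sorted _ (range-sorted j)) G)
    (≈-reflexive (cong (λ h → sumUpTo R h (λ ξ → G (h ∸ 1 ∸ ξ) ξ)) (length-outs j w)))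

  sum-ins : ∀ {j w} → State j w → (G : ℕ → ℕ → A) →
    sumOver (ins j w) (λ v → G (above (ins j w) v) (below (ins j w) v)) ≈ sumUpTo R (height j w) (λ ξ → G (height j w ∸ 1 ∸ ξ) ξ)
  sum-ins {j} {w} S G = ≈-trans (sum-ranks (filterᵇ-sorted _ (range-sorted j)) G)
    (≈-reflexive (cong (λ h → sumUpTo R h (λ ξ → G (h ∸ 1 ∸ ξ) ξ)) (length-ins S)))

  -- At height 0 the sum in `peakSum` is empty, so the spurious term at `pred 0` has weight 0.
  walkDown-split : ∀ n h → dFallSum h ⊛ walkUp n h ⊕ peakSum h ⊛ walkUp n (pred h) ≈ walkDown n h
  walkDown-split n zero    = ≈-trans (+-cong ≈-refl (≈-trans (*-congʳ (zeroʳ _)) (zeroˡ _))) (+-identityʳ _)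
  walkDown-split n (suc h) = ≈-refl

  module _ (n : ℕ) where

    -- The weighted sum over the D-permutations whose trace on [j] is w, without the factors of [j].
    completions : ℕ → ℕ → List ℕ → A
    completions j r w = sumOver (𝔇 n) (λ σ → matches (trunc j σ) w ⊛ prodFrom j r (cycleFactor (2 * n) σ))

    -- A permutation with trace w on [j] has the trace `extend j w o` for exactly one option, its
    -- `choice`; by `extend-injective` any other permutation matches none of the extensions. The
    -- indicator of w therefore splits into those of its extensions, and the sums can be exchanged.
    completions-step : ∀ {j r w} {opts : List (ℕ × ℕ)} → j < 2 * n → State j w → Unique opts →
      (∀ {o} → o ∈ opts → Option j w o) → (∀ {o} → Option j w o → o ∈ opts) →
      completions j (suc r) w ≈ sumOver opts (λ o → optionWeight j w o ⊛ completions (suc j) r (extend j w o))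
    completions-step {j} {r} {w} {opts} j<m S unique sound complete = begin
      completions j (suc r) w
        ≈⟨ sum-cong (𝔇 n) (λ σ σ∈ → split σ (𝔇⇒DPermutation {n} σ∈)) ⟩
      sumOver (𝔇 n) (λ σ → sumOver opts (λ o → term σ o))
        ≈⟨ sum-swap (𝔇 n) opts term ⟩
      sumOver opts (λ o → sumOver (𝔇 n) (λ σ → term σ o))
        ≈⟨ sum-cong opts (λ o _ → sum-scaleˡ (𝔇 n) _ (optionWeight j w o)) ⟩
      sumOver opts (λ o → optionWeight j w o ⊛ completions (suc j) r (extend j w o)) ∎
      where
      rest : List ℕ → A
      rest σ = prodFrom (suc j) r (cycleFactor (2 * n) σ)
      term : List ℕ → ℕ × ℕ → A
      term σ o = optionWeight j w o ⊛ (matches (trunc (suc j) σ) (extend j w o) ⊛ rest σ)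
      term-zero : ∀ σ o → trunc (suc j) σ ≢ extend j w o → term σ o ≈ 0#
      term-zero σ o ne = ≈-trans (*-congˡ (≈-trans (*-congʳ (≈-reflexive (matches-≢ ne))) (zeroˡ _))) (zeroʳ _)
      split : ∀ σ → DPermutation (2 * n) σ →
              matches (trunc j σ) w ⊛ (cycleFactor (2 * n) σ (suc j) ⊛ rest σ) ≈ sumOver opts (term σ)
      split σ D with ≡-dec _≟_ (trunc j σ) w
      ... | no ne = ≈-trans (zeroˡ _) (≈-sym (sum-zero opts (λ o o∈ → term-zero σ o
                      (λ q → ne (proj₁ (extend-injective S (sound o∈) q))))))
        where open Scan D j j<m
      ... | yes refl = ≈-sym (begin
        sumOver opts (term σ)
          ≈⟨ sum-single unique (complete choice-option) (λ o o∈ o≢ → term-zero σ o (λ q → o≢ (sym (proj₂ (extend-injective S (sound o∈) q))))) ⟩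
        term σ (choice (2 * n) j σ)
          ≈⟨ *-cong (≈-sym (cycleFactor≈weight D j<m S)) (≈-trans (*-congʳ (≈-reflexive (matches-≡ (sym extend-choice)))) (*-identityˡ _)) ⟩
        cycleFactor (2 * n) σ (suc j) ⊛ rest σ
          ≈⟨ ≈-sym (*-identityˡ _) ⟩
        1# ⊛ (cycleFactor (2 * n) σ (suc j) ⊛ rest σ) ∎)
        where open Scan D j j<m

    -- A complete trace without open ends is itself a D-permutation and the only one with this
    -- trace; a trace with open ends comes from none. These are the values of `walkUp 0`.
    completions-full : ∀ {w} → State (2 * n) w → completions (2 * n) 0 w ≈ walkUp 0 (height (2 * n) w)
    completions-full {w} S with height (2 * n) w in eq
    ... | zero = ≈-trans (sum-single (𝔇-unique n) (DPermutation⇒𝔇 {n} D) miss)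
                         (≈-trans (*-identityʳ _) (≈-reflexive (matches-≡ (trunc-full D))))
      where
      D : DPermutation (2 * n) w
      D = full-state S eq
      miss : ∀ σ → σ ∈ 𝔇 n → σ ≢ w → matches (trunc (2 * n) σ) w ⊛ 1# ≈ 0#
      miss σ σ∈ ne = ≈-trans (*-identityʳ _) (≈-reflexive (matches-≢ (λ q → ne (trans (sym (trunc-full (𝔇⇒DPermutation {n} σ∈))) q))))
    ... | suc h = sum-zero (𝔇 n) (λ σ σ∈ → ≈-trans (*-identityʳ _) (≈-reflexive (matches-≢ (λ q →
            0≢1+n (trans (sym (full-height (subst (DPermutation (2 * n)) (trans (sym (trunc-full (𝔇⇒DPermutation {n} σ∈))) q) (𝔇⇒DPermutation {n} σ∈)))) eq)))))

    private
      next-< : ∀ {j r} → j + suc r ≡ 2 * n → j < 2 * n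
      next-< {j} {r} q = subst (j <_) q (m<m+n j (s≤s z≤n))

      next-+ : ∀ {j r} → j + suc r ≡ 2 * n → suc j + r ≡ 2 * n
      next-+ {j} {r} q = trans (sym (+-suc j r)) q

    mutual
      completions≈walkUp : ∀ n′ {j w} → State j w → isEven j ≡ true → j + double n′ ≡ 2 * n →
        completions j (double n′) w ≈ walkUp n′ (height j w)
      completions≈walkUp zero {j} {w} S _ q with trans (sym (ℕ.+-identityʳ j)) q
      ... | refl = completions-full S
      completions≈walkUp (suc n′) {j} {w} S ev q = begin
        completions j (suc r) w
          ≈⟨ completions-step {r = r} (next-< {j} q) S (optionsOdd-unique j w) (optionsOdd⇒Option odd) (Option⇒optionsOdd odd) ⟩
        optionWeight j w (0 , 0) ⊛ Φ (0 , 0) ⊕ (optionWeight j w (0 , suc j) ⊛ Φ (0 , suc j) ⊕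
          sumOver (map (_, 0) (outs j w)) (λ o → optionWeight j w o ⊛ Φ o))
          ≈⟨ +-cong (*-congˡ (next (valley odd) (height-valley j w)))
                    (+-cong (*-cong fixed-weight (next fixed (height-level-fixed j w))) rises) ⟩
        a h ⊛ walkDown n′ (suc h) ⊕ ((lam ⊛ f h) ⊛ W ⊕ sumUpTo R h (λ ξ → d (h ∸ 1 ∸ ξ) ξ) ⊛ W)
          ≈⟨ +-cong ≈-refl (≈-sym (distribʳ W _ _)) ⟩
        walkUp (suc n′) h ∎
        where
        r h : ℕ
        r = suc (double n′)
        h = height j w
        W : A
        W = walkDown n′ h
        odd : isEven (suc j) ≡ false
        odd = trans (isEven-suc j) (cong not ev)
        Φ : ℕ × ℕ → A
        Φ o = completions (suc j) r (extend j w o)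
        next : ∀ {o h′} → Option j w o → height (suc j) (extend j w o) ≡ h′ → Φ o ≈ walkDown n′ h′
        next o refl = completions≈walkDown n′ (extend-state S o) odd (next-+ {j} q)
        fixed-weight : optionWeight j w (0 , suc j) ≈ lam ⊛ f h
        fixed-weight = ≈-reflexive (trans (weight-fixed j w) (cong (lam ⊛_) (if-false odd)))
        D : ℕ → A
        D p = d (above (outs j w) p) (below (outs j w) p)
        rise : ∀ p → p ∈ outs j w → optionWeight j w (p , 0) ⊛ Φ (p , 0) ≈ D p ⊛ W
        rise p p∈ with ∈-outs⁻ {j} {w} p∈
        ... | wp , z = *-cong (≈-reflexive (weight-drise {j} {w} wp)) (next (drise odd wp z) (height-drise {j} {w} wp z))
        rises : sumOver (map (_, 0) (outs j w)) (λ o → optionWeight j w o ⊛ Φ o) ≈ sumUpTo R h (λ ξ → d (h ∸ 1 ∸ ξ) ξ) ⊛ W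
        rises = begin
          sumOver (map (_, 0) (outs j w)) (λ o → optionWeight j w o ⊛ Φ o)
            ≈⟨ sum-map (_, 0) (outs j w) (λ o → optionWeight j w o ⊛ Φ o) ⟩
          sumOver (outs j w) (λ p → optionWeight j w (p , 0) ⊛ Φ (p , 0))  ≈⟨ sum-cong (outs j w) rise ⟩
          sumOver (outs j w) (λ p → D p ⊛ W)                               ≈⟨ sum-scaleʳ (outs j w) D W ⟩
          sumOver (outs j w) D ⊛ W                                         ≈⟨ *-congʳ (sum-outs j w d) ⟩
          sumUpTo R h (λ ξ → d (h ∸ 1 ∸ ξ) ξ) ⊛ W ∎

      completions≈walkDown : ∀ n′ {j w} → State j w → isEven j ≡ false → j + suc (double n′) ≡ 2 * n →
        completions j (suc (double n′)) w ≈ walkDown n′ (height j w)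
      completions≈walkDown n′ {j} {w} S od q = begin
        completions j (suc r) w
          ≈⟨ completions-step {r = r} (next-< {j} q) S (optionsEven-unique j w) (optionsEven⇒Option even) (Option⇒optionsEven even) ⟩
        optionWeight j w (0 , suc j) ⊛ Φ (0 , suc j) ⊕
          sumOver (map (0 ,_) (ins j w) ++ peakOptions) term
          ≈⟨ +-cong (*-cong fixed-weight (next fixed (height-level-fixed j w)))
                    (≈-trans (sum-++ (map (0 ,_) (ins j w)) peakOptions term) (+-cong falls peaks)) ⟩
        (lam ⊛ e h) ⊛ W ⊕ (sumUpTo R h (λ ξ → cc (h ∸ 1 ∸ ξ) ξ) ⊛ W ⊕ peakSum h ⊛ W⁻)
          ≈⟨ ≈-sym (+-assoc _ _ _) ⟩
        ((lam ⊛ e h) ⊛ W ⊕ sumUpTo R h (λ ξ → cc (h ∸ 1 ∸ ξ) ξ) ⊛ W) ⊕ peakSum h ⊛ W⁻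
          ≈⟨ +-cong (≈-sym (distribʳ W _ _)) ≈-refl ⟩
        dFallSum h ⊛ W ⊕ peakSum h ⊛ W⁻
          ≈⟨ walkDown-split n′ h ⟩
        walkDown n′ h ∎
        where
        r h : ℕ
        r = double n′
        h = height j w
        W W⁻ : A
        W  = walkUp n′ h
        W⁻ = walkUp n′ (pred h)
        even : isEven (suc j) ≡ true
        even = trans (isEven-suc j) (cong not od)
        Φ : ℕ × ℕ → A
        Φ o = completions (suc j) r (extend j w o)
        next : ∀ {o h′} → Option j w o → height (suc j) (extend j w o) ≡ h′ → Φ o ≈ walkUp n′ h′
        next o refl = completions≈walkUp n′ (extend-state S o) even (next-+ {j} q)
        fixed-weight : optionWeight j w (0 , suc j) ≈ lam ⊛ e h
        fixed-weight = ≈-reflexive (trans (weight-fixed j w) (cong (lam ⊛_) (if-true even)))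
        term : ℕ × ℕ → A
        term o = optionWeight j w o ⊛ Φ o
        peakOptions : List (ℕ × ℕ)
        peakOptions = cartesianProductWith (λ v p → p , v) (ins j w) (outs j w)
        C B : ℕ → A
        C v = cc (above (ins j w) v) (below (ins j w) v)
        B v = b (above (ins j w) v) (below (ins j w) v)
        M : ℕ → ℕ → A
        M v p = if reach j w v p then lam else 1#
        fall : ∀ v → v ∈ ins j w → term (0 , v) ≈ C v ⊛ W
        fall v v∈ with ∈-ins⁻ {j} {w} v∈
        ... | wv , fr = *-cong (≈-reflexive (weight-dfall {j} {w} wv)) (next (dfall even wv fr) (height-level j w (0-∉ wv)))
        falls : sumOver (map (0 ,_) (ins j w)) term ≈ sumUpTo R h (λ ξ → cc (h ∸ 1 ∸ ξ) ξ) ⊛ W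
        falls = begin
          sumOver (map (0 ,_) (ins j w)) term       ≈⟨ sum-map (0 ,_) (ins j w) term ⟩
          sumOver (ins j w) (λ v → term (0 , v))    ≈⟨ sum-cong (ins j w) fall ⟩
          sumOver (ins j w) (λ v → C v ⊛ W)         ≈⟨ sum-scaleʳ (ins j w) C W ⟩
          sumOver (ins j w) C ⊛ W                   ≈⟨ *-congʳ (sum-ins S cc) ⟩
          sumUpTo R h (λ ξ → cc (h ∸ 1 ∸ ξ) ξ) ⊛ W ∎
        peak-term : ∀ v p → v ∈ ins j w → p ∈ outs j w → term (p , v) ≈ M v p ⊛ (B v ⊛ W⁻)
        peak-term v p v∈ p∈ with ∈-ins⁻ {j} {w} v∈ | ∈-outs⁻ {j} {w} p∈
        ... | wv , fr | wp , z = begin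
          optionWeight j w (p , v) ⊛ Φ (p , v)
            ≈⟨ *-cong (≈-reflexive (weight-peak {j} {w} wp wv)) (next (peak even wp z wv fr) (cong pred (sym (height-peak {j} {w} wp z (0-∉ wv))))) ⟩
          (M v p ⊛ B v) ⊛ W⁻  ≈⟨ *-assoc (M v p) (B v) W⁻ ⟩
          M v p ⊛ (B v ⊛ W⁻) ∎
        -- Exactly one of the h sources closes the path starting at v into a cycle.
        sources : ∀ v → v ∈ ins j w → sumOver (outs j w) (M v) ≈ lam ⊕ nat R (h ∸ 1)
        sources v v∈ with ∈-ins⁻ {j} {w} v∈
        ... | wv , fr = begin
          sumOver (outs j w) (M v)
            ≈⟨ sum-one-marked {F = M v} lam (outs-unique j w) end∈outs (≈-reflexive (marked (T⇒≡true reach-end)))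
                 (λ p p∈ p≢ → ≈-reflexive (marked (¬T⇒≡false (p≢ ∘ reach-only-end p∈)))) ⟩
          lam ⊕ nat R (length (outs j w) ∸ 1)
            ≈⟨ ≈-reflexive (cong (λ l → lam ⊕ nat R (l ∸ 1)) (length-outs j w)) ⟩
          lam ⊕ nat R (h ∸ 1) ∎
          where
          open PathEnd S wv fr
          marked : ∀ {p t} → reach j w v p ≡ t → M v p ≡ (if t then lam else 1#)
          marked refl = refl
        peaks : sumOver peakOptions term ≈ peakSum h ⊛ W⁻
        peaks = begin
          sumOver peakOptions term
            ≈⟨ sum-cartesianProductWith (λ v p → p , v) (ins j w) (outs j w) term ⟩
          sumOver (ins j w) (λ v → sumOver (outs j w) (λ p → term (p , v)))
            -- The ends are summed first: only the cycle mark depends on them, and its sum is the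
            -- same for every start.
            ≈⟨ sum-cong (ins j w) (λ v v∈ → begin
                 sumOver (outs j w) (λ p → term (p , v))             ≈⟨ sum-cong (outs j w) (λ p → peak-term v p v∈) ⟩
                 sumOver (outs j w) (λ p → M v p ⊛ (B v ⊛ W⁻))       ≈⟨ sum-scaleʳ (outs j w) (M v) (B v ⊛ W⁻) ⟩
                 sumOver (outs j w) (M v) ⊛ (B v ⊛ W⁻)               ≈⟨ *-congʳ (sources v v∈) ⟩
                 (lam ⊕ nat R (h ∸ 1)) ⊛ (B v ⊛ W⁻) ∎) ⟩
          sumOver (ins j w) (λ v → (lam ⊕ nat R (h ∸ 1)) ⊛ (B v ⊛ W⁻))
            ≈⟨ sum-scaleˡ (ins j w) (λ v → B v ⊛ W⁻) (lam ⊕ nat R (h ∸ 1)) ⟩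
          (lam ⊕ nat R (h ∸ 1)) ⊛ sumOver (ins j w) (λ v → B v ⊛ W⁻)
            ≈⟨ *-congˡ (sum-scaleʳ (ins j w) B W⁻) ⟩
          (lam ⊕ nat R (h ∸ 1)) ⊛ (sumOver (ins j w) B ⊛ W⁻)
            ≈⟨ ≈-sym (*-assoc _ _ W⁻) ⟩
          ((lam ⊕ nat R (h ∸ 1)) ⊛ sumOver (ins j w) B) ⊛ W⁻
            ≈⟨ *-congʳ (*-congˡ (sum-ins S b)) ⟩
          peakSum h ⊛ W⁻ ∎

  Qhh≈walkUp : ∀ n → Qhh R lam a b cc d e f n ≈ walkUp n 0
  Qhh≈walkUp n = begin
    Qhh R lam a b cc d e f n
      -- The empty trace matches every permutation, so its indicator is the unit inserted here.
      ≈⟨ sum-cong (𝔇 n) (λ σ σ∈ → ≈-trans (weightQ≈prodFrom (𝔇⇒DPermutation {n} σ∈)) (≈-sym (*-identityˡ _))) ⟩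
    completions n 0 (2 * n) []
      ≈⟨ ≈-reflexive (cong (λ r → completions n 0 r []) (sym (double-2* n))) ⟩
    completions n 0 (double n) []
      ≈⟨ completions≈walkUp n n empty-state refl (double-2* n) ⟩
    walkUp n 0 ∎

  altIdx-odd : ∀ P Q h k → altIdx R P Q (suc (double h)) k ≡ P (h + k)
  altIdx-odd P Q zero    k = refl
  altIdx-odd P Q (suc h) k = trans (altIdx-odd P Q h (suc k)) (cong P (+-suc h k))

  altIdx-even : ∀ P Q h k → altIdx R P Q (suc (suc (double h))) k ≡ Q (h + k)
  altIdx-even P Q zero    k = refl
  altIdx-even P Q (suc h) k = trans (altIdx-even P Q h (suc k)) (cong Q (+-suc h k))

  -- The local sequences of `alpha410`, repeated so that the lemmas on `altIdx` can be applied to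
  -- them.
  oddα evenα : ℕ → A
  oddα  k = (lam ⊕ nat R (k ∸ 1)) ⊛ a (k ∸ 1) ⊛ sumUpTo R k (λ ξ → b (k ∸ 1 ∸ ξ) ξ)
  evenα k = dFallSum k ⊛ dRiseSum k

  α δ : ℕ → A
  α = alpha410 R lam a b cc d e f
  δ = delta410 R lam e f

  α-odd : ∀ h → α (suc (double h)) ≈ a h ⊛ peakSum (suc h)
  α-odd h = ≈-trans (≈-reflexive (trans (altIdx-odd oddα evenα h 1) (cong oddα (ℕ.+-comm h 1))))
    (solve 3 (λ l a s → (l :* a) :* s := a :* (l :* s)) ≈-refl _ (a h) _)

  α-even : ∀ h → α (suc (suc (double h))) ≈ dFallSum (suc h) ⊛ dRiseSum (suc h)
  α-even h = ≈-reflexive (trans (altIdx-even oddα evenα h 1) (cong evenα (ℕ.+-comm h 1)))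

  -- At height 0 no path can be extended, so both sums over ranks are empty and only fixed points
  -- remain. The variable `o` stands for the unit that ends `pow lam 2`.
  δ₁ : δ 1 ≈ dFallSum 0 ⊛ dRiseSum 0
  δ₁ = ≈-trans (solve 4 (λ l o e f → ((l :* (l :* o)) :* e) :* f := o :* ((l :* e) :* (l :* f))) ≈-refl lam 1# (e 0) (f 0))
    (≈-trans (*-identityˡ _) (*-cong (≈-sym (+-identityʳ _)) (≈-sym (+-identityʳ _))))

  Tconv≈Qhh : ∀ N n → n < N → Tconv R α δ N 1 n ≈ Qhh R lam a b cc d e f n
  Tconv≈Qhh N n n<N = ≈-trans (Contraction.Tconv≈walkUp α δ α-odd α-even δ₁ (λ _ → ≈-refl) N n n<N) (≈-sym (Qhh≈walkUp n))

theorem4p10 : {c ℓ : Level} (R : CommutativeRing c ℓ) →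
    let open CommutativeRing R renaming (Carrier to A) in
    (lam : A) (a : ℕ → A) (b cc d : ℕ → ℕ → A) (e f : ℕ → A) →
    (N n : ℕ) → n < N →
    Tconv R (alpha410 R lam a b cc d e f) (delta410 R lam e f) N 1 n
      ≈ Qhh R lam a b cc d e f n
theorem4p10 R lam a b cc d e f = Enumeration.Tconv≈Qhh R lam a b cc d e f
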